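{- Let $p$ be a prime and let $F\colon\mathbb{F}_{p^n}\to\mathbb{F}_{p^m}$ be a bent function such that, for a fixed $\epsilon\in\{\pm1,\pm i\}$ and some integers $r_b$, $W_F(b,0)=\epsilon p^{n/2}\zeta_p^{r_b}$ for all $b\in\mathbb{F}_{p^m}^*$. Then $n$ is even, $m\le n/2$, and for any $a\in\mathbb{F}_{p^m}$: - If $\epsilon\in\{1,i\}$: $|F^{ -1}(a)|=p^{n-m}+p^{n/2}-p^{n/2-m}(pk_a+1)$ for some integer $k_a$ with $0\le k_a\le\frac{p^m-1}{p-1}$. In particular, $|F^{ -1}(a)|\ge p^{n-m}-\frac{p^m-1}{p-1}p^{n/2-m}$. - If $\epsilon\in\{ -1,-i\}$: $|F^{ -1}(a)|=p^{n-m}-p^{n/2}+p^{n/2-m}(pk_a+1)$ for some integer $k_a$ with $0\le k_a\le\frac{p^m-1}{p-1}$. In particular, $|F^{ -1}(a)|\le p^{n-m}+\frac{p^m-1}{p-1}p^{n/2-m}$. Additionally, $k_0=|\{b\in\mathbb{F}_{p^m}^*: W_F(b,0)=p^{n/2}\epsilon\zeta_p\}|$.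
   Context: Let $\zeta_p=e^{2\pi i/p}$, $i^2=-1$, and let $\operatorname{Tr}$ denote the absolute trace to $\mathbb{F}_p$. The Walsh transform of $F\colon\mathbb{F}_{p^n}\to\mathbb{F}_{p^m}$ is $W_F(b,a)=\sum_{x\in\mathbb{F}_{p^n}}\zeta_p^{\operatorname{Tr}(bF(x))-\operatorname{Tr}(ax)}$. $F$ is bent if $|W_F(b,a)|=p^{n/2}$ for all $b\in\mathbb{F}_{p^m}^*$ and $a\in\mathbb{F}_{p^n}$; equivalently, $|\{x: F(x+a)-F(x)=c\}|=p^{n-m}$ for all $a\ne0$ and all $c$. -}

module Defs where

open import Level using (Level; _⊔_; suc)
open import Algebra.Apartness.Bundles using (HeytingField)
open import Algebra.Bundles using (CommutativeRing; Semiring)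
open import Algebra.Bundles.Raw using (RawRing)
import Algebra.Definitions.RawSemiring as RawSemiringDefs
open import Data.Fin.Base using (Fin; toℕ)
import Data.Fin.Properties as Fin
open import Data.Integer.Base as ℤ using (ℤ; _%ℕ_)
open import Data.Nat.Base as ℕ using (ℕ; _∸_; _/_)
open import Data.Nat.Primality using (Prime; prime⇒nonZero; prime⇒nonTrivial)
open import Data.Product.Base using (Σ-syntax; ∃-syntax; _×_; _,_)
open import Data.Sum.Base using (_⊎_)
open import Data.Vec.Base using (tabulate; count)
open import Function.Bundles using (Inverse; Func; _⇔_)
open import Function.Properties.Inverse using (Inverse⇒Injection)
import Function.Construct.Symmetry as Symmetry
open import Relation.Binary.Core using (Rel)
open import Relation.Binary.Definitions using () renaming (Decidable to Decidable₂)
open import Relation.Binary.PropositionalEquality.Core using (_≡_)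
open import Relation.Binary.PropositionalEquality.Properties as ≡ using ()
open import Relation.Binary.Structures using (IsStrictPartialOrder)
open import Relation.Nullary.Decidable.Core using (yes; no)
open import Relation.Nullary.Decidable using (via-injection)
open import Relation.Nullary.Negation.Core using (¬_)
open import Relation.Unary using (Pred; Decidable)

-- The real numbers, given axiomatically: a Cauchy-complete Archimedean ordered
-- field.  The order is not assumed total, so that the axioms are also
-- satisfied by constructively built reals.  Cotransitivity of _<_ follows from
-- that of _#_.

record RealNumbers (c ℓ₁ ℓ₂ : Level) : Set (suc (c ⊔ ℓ₁ ⊔ ℓ₂)) where
  field
    heytingField : HeytingField c ℓ₁ ℓ₂

  open HeytingField heytingField public

  rawRing : RawRing c ℓ₁
  rawRing = record
    { _≈_ = _≈_ ; _+_ = _+_ ; _*_ = _*_ ; -_ = -_ ; 0# = 0# ; 1# = 1# }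

  open RawSemiringDefs (RawRing.rawSemiring rawRing) public
    using () renaming (_×_ to _·_)

  fromℕ : ℕ → Carrier
  fromℕ k = k · 1#

  infix 4 _<_ _≤_
  field
    _<_                  : Rel Carrier ℓ₂
    isStrictPartialOrder : IsStrictPartialOrder _≈_ _<_
    #⇔<⊎>                : ∀ x y → (x # y) ⇔ (x < y ⊎ y < x)
    +-monoˡ-<            : ∀ z {x y} → x < y → x + z < y + z
    *-pos                : ∀ {x y} → 0# < x → 0# < y → 0# < x * y

  _≤_ : Rel Carrier ℓ₂
  x ≤ y = ¬ (y < x)

  -- |x - y| ≤ 1/(k+1)
  Within : ℕ → Rel Carrier ℓ₂
  Within k x y = (ℕ.suc k · (x - y) ≤ 1#) × (ℕ.suc k · (y - x) ≤ 1#)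

  field
    archimedean : ∀ x → ∃[ k ] x < fromℕ k
    complete    : (u : ℕ → Carrier) →
                  (∀ k → ∃[ N ] (∀ i j → N ℕ.≤ i → N ℕ.≤ j → Within k (u i) (u j))) →
                  ∃[ l ] (∀ k → ∃[ N ] (∀ i → N ℕ.≤ i → Within k (u i) l))

  -- s = √x
  IsSqrt : Carrier → Carrier → Set (ℓ₁ ⊔ ℓ₂)
  IsSqrt s x = (0# ≤ s) × (s * s ≈ x)

module Complex {c ℓ₁ ℓ₂ : Level} (R : RealNumbers c ℓ₁ ℓ₂) where

  private module ℝ = RealNumbers R

  infix 4 _+i_
  record ℂ : Set c where
    constructor _+i_
    field
      re im : ℝ.Carrier

  open ℂ public

  rawRing : RawRing c ℓ₁
  rawRing = record
    { Carrier = ℂ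
    ; _≈_ = λ z w → (re z ℝ.≈ re w) × (im z ℝ.≈ im w)
    ; _+_ = λ z w → re z ℝ.+ re w +i im z ℝ.+ im w
    ; _*_ = λ z w → re z ℝ.* re w ℝ.- im z ℝ.* im w
                 +i re z ℝ.* im w ℝ.+ im z ℝ.* re w
    ; -_  = λ z → ℝ.- re z +i ℝ.- im z
    ; 0#  = ℝ.0# +i ℝ.0#
    ; 1#  = ℝ.1# +i ℝ.0#
    }

  open RawRing rawRing public hiding (Carrier; rawSemiring)
  open RawSemiringDefs (RawRing.rawSemiring rawRing) public using (_^_; sum)

  𝑖 : ℂ
  𝑖 = ℝ.0# +i ℝ.1#

  fromℝ : ℝ.Carrier → ℂ
  fromℝ x = x +i ℝ.0#

  -- |z| = s
  IsModulus : ℂ → ℝ.Carrier → Set (ℓ₁ ⊔ ℓ₂)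
  IsModulus z s = ℝ.IsSqrt s (re z ℝ.* re z ℝ.+ im z ℝ.* im z)

  -- For prime p these are exactly the primitive p-th roots of unity, among them
  -- e^{2πi/p}.
  IsNontrivialRootOfUnity : ℕ → ℂ → Set ℓ₁
  IsNontrivialRootOfUnity p ζ = (ζ ^ p ≈ 1#) × ¬ (ζ ≈ 1#)

record FiniteField (q : ℕ) (a ℓ : Level) : Set (suc (a ⊔ ℓ)) where
  field
    commutativeRing : CommutativeRing a ℓ

  open CommutativeRing commutativeRing public

  field
    0≉1         : ¬ (0# ≈ 1#)
    inverse     : ∀ x → ¬ (x ≈ 0#) → ∃[ y ] x * y ≈ 1#
    enumeration : Inverse (≡.setoid (Fin q)) setoid

  open RawSemiringDefs (Semiring.rawSemiring semiring) public
    using (_^_; sum) renaming (_×_ to _·_)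

  element : Fin q → Carrier
  element = Inverse.to enumeration

  infix 4 _≟_
  _≟_ : Decidable₂ _≈_
  _≟_ = via-injection (Inverse⇒Injection (Symmetry.inverse enumeration)) Fin._≟_

  card : ∀ {ℓ′} {P : Pred Carrier ℓ′} → Decidable P → ℕ
  card P? = count P? (tabulate element)

  -- |{ x : P x }| = k for a predicate that is not known in advance to be
  -- decidable.
  HasCardinality : ∀ {ℓ′} → Pred Carrier ℓ′ → ℕ → Set (a ⊔ ℓ′)
  HasCardinality P k = Σ[ P? ∈ Decidable P ] card P? ≡ k

module Trace (p n : ℕ) {a ℓ : Level} (K : FiniteField (p ℕ.^ n) a ℓ) where

  open FiniteField K

  Tr : Carrier → Carrier
  Tr x = sum {n} λ i → x ^ (p ℕ.^ toℕ i)

  -- The representative of Tr x ∈ 𝔽ₚ in {0, …, p - 1}.  For prime p the trace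
  -- lies in the prime field, so the second case does not arise.
  tr : Carrier → ℕ
  tr x with Fin.any? {n = p} (λ j → toℕ j · 1# ≟ Tr x)
  ... | yes (j , _) = toℕ j
  ... | no  _       = 0

module Walsh
  {c ℓ₁ ℓ₂ a ℓ b ℓ′ : Level} (R : RealNumbers c ℓ₁ ℓ₂)
  {p : ℕ} (p-prime : Prime p) (ζ : Complex.ℂ R)
  (n m : ℕ) (K : FiniteField (p ℕ.^ n) a ℓ) (L : FiniteField (p ℕ.^ m) b ℓ′)
  (F : Func (FiniteField.setoid K) (FiniteField.setoid L))
  where

  private
    module ℝ = RealNumbers R
    module K = FiniteField K
    module L = FiniteField L
  open Complex R

  -- ζ^k for an integer k, using that ζ^p = 1.
  ζ^_ : ℤ → ℂ
  ζ^ k = ζ ^ (_%ℕ_ k p {{prime⇒nonZero p-prime}})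

  W : L.Carrier → K.Carrier → ℂ
  W b a = sum λ i → let x = K.element i in
    ζ^ (ℤ.+ Trace.tr p m L (b L.* Func.to F x) ℤ.- ℤ.+ Trace.tr p n K (a K.* x))

  -- The argument is p^{n/2}, a real number since n may be odd.
  Bent : ℝ.Carrier → Set (a ⊔ b ⊔ ℓ₁ ⊔ ℓ₂ ⊔ ℓ′)
  Bent √pⁿ = ∀ b a → ¬ (b L.≈ L.0#) → IsModulus (W b a) √pⁿ

  ∣F⁻¹_∣ : L.Carrier → ℕ
  ∣F⁻¹ y ∣ = K.card (λ x → Func.to F x L.≟ y)

-- (p^m - 1)/(p - 1)
geometric : {p : ℕ} → Prime p → ℕ → ℕ
geometric {p} p-prime m =
  _/_ (p ℕ.^ m ∸ 1) (p ∸ 1) {{p∸1≢0 p {{prime⇒nonTrivial p-prime}}}}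
  where
  p∸1≢0 : ∀ q .{{_ : ℕ.NonTrivial q}} → ℕ.NonZero (q ∸ 1)
  p∸1≢0 (ℕ.suc (ℕ.suc _)) = _

{-# OPTIONS --safe #-}

-- Write A = ε p^{n/2} and r_b for the exponents, so that W(b,0) = A ζ^{r_b} for
-- b ≠ 0.
--
-- * If Σ a_j ζ^j = 0 over j < p, then all a_j are equal.  By a Nakayama argument
--   1 ∉ (ζ − 1) ℤ[ζ]; this shows that the a_j agree modulo p, and dividing their
--   differences by p repeatedly, that they agree.  Hence a relation between
--   powers of ζ remains true when ζ is replaced by ζ^c with p ∤ c.
-- * Applied to W(b,0)² = ± p^n ζ^{2 r_b}, this gives W(c b,0) = A ζ^{c r_b} for
--   0 < c < p.  Summing W(c b,0) ζ^{−c r_b} over all c counts solutions, so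
--   (p − 1) A is an integer.  As A² = ± p^n, the number n is even and A = ± p^{n/2}.
-- * By orthogonality p^m |F⁻¹(y)| = p^n + A Σ_{b ≠ 0} ζ^{r_b − Tr(b y)}.  Comparing
--   coefficients, every nonzero residue is attained by the exponents equally
--   often, say k_y times, which gives the formula; since p k_y + 1 is prime to p,
--   the formula forces p^m ∣ p^{n/2}.

module Submission where

open import Defs
open import Algebra.Bundles using (CommutativeMonoid; CommutativeRing)
import Algebra.Properties.AbelianGroup
import Algebra.Properties.CommutativeMonoid.Sum
import Algebra.Properties.CommutativeSemiring.Binomial
import Algebra.Properties.CommutativeSemiring.Exp
import Algebra.Properties.Group
import Algebra.Properties.Ring
import Algebra.Properties.Semiring.Mult
import Algebra.Properties.Semiring.Mult.TCOptimised
import Algebra.Properties.Semiring.Sum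
import Algebra.Solver.Ring
open import Algebra.Solver.Ring.AlmostCommutativeRing using (fromCommutativeRing; _-Raw-AlmostCommutative⟶_)
open import Data.Fin.Base as Fin using (Fin; toℕ)
open import Data.Fin.Permutation using (permutation)
import Data.Fin.Properties as Fin
open import Data.Integer.Base as ℤ using (ℤ; +_; -[1+_]; _⊖_; _%ℕ_)
open import Data.Integer.Divisibility.Signed as ℤ∣ using (divides)
import Data.Integer.DivMod as ℤ
import Data.Integer.Properties as ℤ
open import Data.Integer.Tactic.RingSolver using (solve-∀)
open import Data.List.Base as List using (List; []; _∷_; _++_)
open import Data.Maybe.Base using (Maybe; just; nothing)
open import Data.Nat.Base as ℕ using (ℕ; zero; suc; _∸_; _/_)
open import Data.Nat.Combinatorics using (_C_; nCn≡1; nC1≡n; nCk≡nC[n∸k]; nCk+nC[k+1]≡[n+1]C[k+1])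
open import Data.Nat.Combinatorics.Specification using (k>n⇒nCk≡0)
open import Data.Nat.Coprimality using (prime⇒coprime; coprime-Bézout)
open import Data.Nat.Divisibility using (_∣_)
import Data.Nat.Divisibility as ℕ∣
import Data.Nat.DivMod as ℕ
import Data.Nat.GCD as GCD
open import Data.Nat.Primality using (Prime; euclidsLemma; prime⇒nonZero; prime⇒nonTrivial)
import Data.Nat.Properties as ℕ
import Data.Nat.Tactic.RingSolver as ℕ-Solver
open import Data.Product.Base using (∃-syntax; Σ-syntax; _×_; _,_; proj₁; proj₂)
open import Data.Sum.Base as Sum using (_⊎_; inj₁; inj₂)
open import Data.Vec.Base as Vec using (Vec; count)
open import Function.Base using (_∘_; id)
open import Function.Bundles using (Equivalence; Func; Inverse)
open import Level as Level using (Level; _⊔_)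
open import Relation.Binary.PropositionalEquality as ≡ using (_≡_; _≢_; module ≡-Reasoning)
open import Relation.Binary.Definitions using (tri<; tri≈; tri>)
open import Relation.Binary.Structures using (IsStrictPartialOrder)
open import Relation.Nullary using (¬_; Dec; yes; no; contradiction; ¬?; _×-dec_)
open import Relation.Nullary.Decidable using (decidable-stable; map′)
open import Relation.Unary using (Pred; Decidable)

-- How the non-unit π = ζ - 1 yields congruences: extended p-periodically, the coefficients of a
-- relation satisfy Δ^p a ≡ 0 modulo p, because the shift operator is 1 + Δ and the inner binomial
-- coefficients of p are divisible by p. Differences of relations are relations again, so the order
-- of the vanishing difference can be lowered one step at a time until Δ a ≡ 0. This takes the place
-- of the irreducibility of the cyclotomic polynomial.
--
-- The relation for W(1,0) is squared before ζ is replaced by ζ^c, because the conjugates of A are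
-- not known beforehand, whereas A² is an integer and stays fixed. That the same ε serves every b
-- then removes the ambiguity of sign. The values ±i of ε turn out to be impossible: the integer (p
-- - 1) A would have a negative square.
--
-- Equality of real numbers is not decidable here. The arguments therefore run in an abstract ring
-- with cancellation and characteristic 0, and whatever has to be decided is decided for integers,
-- exponents and elements of the finite fields.

-- Finite sums in commutative monoids, and integers inside a ring

module MonoidSums {a ℓ} (M : CommutativeMonoid a ℓ) where
  open CommutativeMonoid M
  open import Relation.Binary.Reasoning.Setoid setoid
  open Algebra.Properties.CommutativeMonoid.Sum M

  sum-ε : ∀ {n} (f : Fin n → Carrier) → (∀ i → f i ≈ ε) → sum f ≈ ε
  sum-ε {zero}  f f≈ε = refl
  sum-ε {suc n} f f≈ε = trans (∙-cong (f≈ε Fin.zero) (sum-ε _ (f≈ε ∘ Fin.suc))) (identityˡ ε)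

  sum-only : ∀ {n} (f : Fin n → Carrier) i → (∀ j → j ≢ i → f j ≈ ε) → sum f ≈ f i
  sum-only f Fin.zero    others =
    trans (∙-congˡ (sum-ε _ λ j → others (Fin.suc j) λ ())) (identityʳ _)
  sum-only f (Fin.suc i) others =
    trans (∙-cong (others Fin.zero λ ())
                  (sum-only (f ∘ Fin.suc) i λ j j≢i → others (Fin.suc j) λ { ≡.refl → j≢i ≡.refl }))
          (identityˡ _)

  sum-snoc : ∀ n (f : ℕ → Carrier) → sum {suc n} (f ∘ toℕ) ≈ sum {n} (f ∘ toℕ) ∙ f n
  sum-snoc zero    f = comm _ _
  sum-snoc (suc n) f = trans (∙-congˡ (sum-snoc n (f ∘ suc))) (sym (assoc _ _ _))

module IntegerMultiples {a ℓ} (R : CommutativeRing a ℓ) where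
  open CommutativeRing R
  open import Relation.Binary.Reasoning.Setoid setoid
  open Algebra.Properties.Ring ring using (-‿distribˡ-*; -‿distribʳ-*; -‿involutive; -0#≈0#)
  open Algebra.Properties.AbelianGroup +-abelianGroup using (⁻¹-∙-comm)
  open Algebra.Properties.Semiring.Mult.TCOptimised semiring renaming (_×_ to _·_)
  open Algebra.Properties.Semiring.Sum semiring using (sum)
  open Algebra.Properties.CommutativeSemiring.Exp commutativeSemiring using (_^_)

  -- With this version of `_·_`, `ι (+ 0)` and `ι (+ 1)` compute to `0#` and `1#`. The map also
  -- provides the coefficients of the ring solver: equality of integers is decidable, equality in
  -- the ring need not be.
  ι : ℤ → Carrier
  ι (+ n)    = n · 1#
  ι -[1+ n ] = - (suc n · 1#)

  private
    ι-neg : ∀ z → ι (ℤ.- z) ≈ - ι z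
    ι-neg (+ zero)  = sym -0#≈0#
    ι-neg (+ suc n) = refl
    ι-neg -[1+ n ]  = sym (-‿involutive _)

    cancel-1 : ∀ x y → (1# + x) - (1# + y) ≈ x - y
    cancel-1 x y = begin
      (1# + x) - (1# + y)       ≈⟨ +-congˡ (⁻¹-∙-comm 1# y) ⟨
      (1# + x) + (- 1# - y)     ≈⟨ +-congʳ (+-comm 1# x) ⟩
      (x + 1#) + (- 1# - y)     ≈⟨ +-assoc x 1# _ ⟩
      x + (1# + (- 1# - y))     ≈⟨ +-congˡ (+-assoc 1# (- 1#) (- y)) ⟨
      x + ((1# - 1#) - y)       ≈⟨ +-congˡ (+-congʳ (-‿inverseʳ 1#)) ⟩
      x + (0# - y)              ≈⟨ +-congˡ (+-identityˡ (- y)) ⟩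
      x - y                     ∎

    ι-⊖ : ∀ m n → ι (m ⊖ n) ≈ m · 1# - n · 1#
    ι-⊖ m zero = begin
      m · 1#        ≈⟨ +-identityʳ _ ⟨
      m · 1# + 0#   ≈⟨ +-congˡ -0#≈0# ⟨
      m · 1# - 0#   ∎
    ι-⊖ zero (suc n) = sym (+-identityˡ _)
    ι-⊖ (suc m) (suc n) = begin
      ι (suc m ⊖ suc n)                 ≡⟨ ≡.cong ι (ℤ.[1+m]⊖[1+n]≡m⊖n m n) ⟩
      ι (m ⊖ n)                         ≈⟨ ι-⊖ m n ⟩
      m · 1# - n · 1#                   ≈⟨ cancel-1 _ _ ⟨
      (1# + m · 1#) - (1# + n · 1#)     ≈⟨ +-cong (1+× m 1#) (-‿cong (1+× n 1#)) ⟨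
      suc m · 1# - suc n · 1#           ∎

    ι-+ : ∀ y z → ι (y ℤ.+ z) ≈ ι y + ι z
    ι-+ (+ m)    (+ n)    = ×-homo-+ 1# m n
    ι-+ (+ m)    -[1+ n ] = ι-⊖ m (suc n)
    ι-+ -[1+ m ] (+ n)    = trans (ι-⊖ n (suc m)) (+-comm _ _)
    ι-+ -[1+ m ] -[1+ n ] = begin
      - (suc (suc (m ℕ.+ n)) · 1#)        ≡⟨ ≡.cong (λ k → - (k · 1#)) (ℕ.+-suc (suc m) n) ⟨
      - ((suc m ℕ.+ suc n) · 1#)          ≈⟨ -‿cong (×-homo-+ 1# (suc m) (suc n)) ⟩
      - (suc m · 1# + suc n · 1#)         ≈⟨ ⁻¹-∙-comm _ _ ⟨
      - (suc m · 1#) + - (suc n · 1#)     ∎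

    ι-*-pos : ∀ m n → ι (+ m ℤ.* + n) ≈ ι (+ m) * ι (+ n)
    ι-*-pos m n = trans (reflexive (≡.cong ι (≡.sym (ℤ.pos-* m n)))) (×1-homo-* m n)

    ι-*-nonNeg : ∀ m z → ι (+ m ℤ.* z) ≈ ι (+ m) * ι z
    ι-*-nonNeg m (+ n)    = ι-*-pos m n
    ι-*-nonNeg m -[1+ n ] = begin
      ι (+ m ℤ.* -[1+ n ])            ≡⟨ ≡.cong ι (ℤ.neg-distribʳ-* (+ m) (+ suc n)) ⟨
      ι (ℤ.- (+ m ℤ.* + suc n))       ≈⟨ ι-neg (+ m ℤ.* + suc n) ⟩
      - ι (+ m ℤ.* + suc n)           ≈⟨ -‿cong (ι-*-pos m (suc n)) ⟩
      - (ι (+ m) * ι (+ suc n))       ≈⟨ -‿distribʳ-* _ _ ⟩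
      ι (+ m) * ι -[1+ n ]            ∎

    ι-* : ∀ y z → ι (y ℤ.* z) ≈ ι y * ι z
    ι-* (+ m)    z = ι-*-nonNeg m z
    ι-* -[1+ m ] z = begin
      ι (-[1+ m ] ℤ.* z)              ≡⟨ ≡.cong ι (ℤ.neg-distribˡ-* (+ suc m) z) ⟨
      ι (ℤ.- (+ suc m ℤ.* z))         ≈⟨ ι-neg (+ suc m ℤ.* z) ⟩
      - ι (+ suc m ℤ.* z)             ≈⟨ -‿cong (ι-*-nonNeg (suc m) z) ⟩
      - (ι (+ suc m) * ι z)           ≈⟨ -‿distribˡ-* _ _ ⟩
      ι -[1+ m ] * ι z                ∎

  homomorphism : ℤ.+-*-rawRing -Raw-AlmostCommutative⟶ fromCommutativeRing R
  homomorphism = record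
    { ⟦_⟧ = ι ; +-homo = ι-+ ; *-homo = ι-* ; -‿homo = ι-neg ; 0-homo = refl ; 1-homo = refl }

  open _-Raw-AlmostCommutative⟶_ homomorphism public using ()
    renaming (+-homo to ι-homo-+; *-homo to ι-homo-*; -‿homo to ι-homo-neg)

  private
    ι-≟ : ∀ y z → Maybe (ι y ≈ ι z)
    ι-≟ y z with y ℤ.≟ z
    ... | yes y≡z = just (reflexive (≡.cong ι y≡z))
    ... | no  _   = nothing

  module Solver = Algebra.Solver.Ring ℤ.+-*-rawRing (fromCommutativeRing R) homomorphism ι-≟

  ι-homo-sub : ∀ y z → ι (y ℤ.- z) ≈ ι y - ι z
  ι-homo-sub y z = trans (ι-homo-+ y (ℤ.- z)) (+-congˡ (ι-homo-neg z))

  ι-cong : ∀ {y z} → y ≡ z → ι y ≈ ι z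
  ι-cong = reflexive ∘ ≡.cong ι

  sum-const : ∀ n x → sum {n} (λ _ → x) ≈ ι (+ n) * x
  sum-const zero    x = sym (zeroˡ x)
  sum-const (suc n) x = begin
    x + sum {n} (λ _ → x)     ≈⟨ +-congˡ (sum-const n x) ⟩
    x + ι (+ n) * x           ≈⟨ +-congʳ (*-identityˡ x) ⟨
    1# * x + ι (+ n) * x      ≈⟨ distribʳ x 1# (ι (+ n)) ⟨
    (1# + ι (+ n)) * x        ≈⟨ *-congʳ (1+× n 1#) ⟨
    ι (+ suc n) * x           ∎

  1^n≈1 : ∀ n → 1# ^ n ≈ 1#
  1^n≈1 zero    = refl
  1^n≈1 (suc n) = trans (*-identityˡ _) (1^n≈1 n)

-- Binomial coefficients of a prime

nC0≡1 : ∀ n → n C 0 ≡ 1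
nC0≡1 n = ≡.trans (nCk≡nC[n∸k] {0} {n} ℕ.z≤n) (nCn≡1 n)

-- The absorption identity. Pascal's rule splits the left side, and both neighbours in the row above
-- are covered by the induction.
[k+1]*[n+1]C[k+1]≡[n+1]*nCk : ∀ n k → suc k ℕ.* (suc n C suc k) ≡ suc n ℕ.* (n C k)
[k+1]*[n+1]C[k+1]≡[n+1]*nCk zero zero = ≡.refl
[k+1]*[n+1]C[k+1]≡[n+1]*nCk zero (suc k) = begin
  suc (suc k) ℕ.* (1 C suc (suc k))  ≡⟨ ≡.cong (suc (suc k) ℕ.*_) (k>n⇒nCk≡0 {1} {suc (suc k)} (ℕ.s≤s (ℕ.s≤s ℕ.z≤n))) ⟩
  suc (suc k) ℕ.* 0                  ≡⟨ ℕ.*-zeroʳ (suc (suc k)) ⟩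
  1 ℕ.* 0                            ≡⟨ ≡.cong (1 ℕ.*_) (k>n⇒nCk≡0 {0} {suc k} (ℕ.s≤s ℕ.z≤n)) ⟨
  1 ℕ.* (0 C suc k)                  ∎
  where open ≡-Reasoning
[k+1]*[n+1]C[k+1]≡[n+1]*nCk (suc n) zero = begin
  1 ℕ.* (suc (suc n) C 1)               ≡⟨ ≡.cong (1 ℕ.*_) (nCk+nC[k+1]≡[n+1]C[k+1] (suc n) 0) ⟨
  1 ℕ.* ((suc n C 0) ℕ.+ (suc n C 1))   ≡⟨ ≡.cong₂ (λ a b → 1 ℕ.* (a ℕ.+ b)) (nC0≡1 (suc n)) (nC1≡n (suc n)) ⟩
  1 ℕ.* (1 ℕ.+ suc n)                   ≡⟨ ℕ.*-comm 1 _ ⟩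
  suc (suc n) ℕ.* 1                     ≡⟨ ≡.cong (suc (suc n) ℕ.*_) (nC0≡1 (suc n)) ⟨
  suc (suc n) ℕ.* (suc n C 0)           ∎
  where open ≡-Reasoning
[k+1]*[n+1]C[k+1]≡[n+1]*nCk (suc n) (suc k) = begin
  suc (suc k) ℕ.* (suc (suc n) C suc (suc k))
    ≡⟨ ≡.cong (suc (suc k) ℕ.*_) (nCk+nC[k+1]≡[n+1]C[k+1] (suc n) (suc k)) ⟨
  suc (suc k) ℕ.* (a ℕ.+ (suc n C suc (suc k)))
    ≡⟨ ℕ.*-distribˡ-+ (suc (suc k)) a _ ⟩
  suc (suc k) ℕ.* a ℕ.+ suc (suc k) ℕ.* (suc n C suc (suc k))
    ≡⟨ ≡.cong (suc (suc k) ℕ.* a ℕ.+_) ([k+1]*[n+1]C[k+1]≡[n+1]*nCk n (suc k)) ⟩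
  (a ℕ.+ suc k ℕ.* a) ℕ.+ suc n ℕ.* (n C suc k)
    ≡⟨ ≡.cong (λ z → (a ℕ.+ z) ℕ.+ suc n ℕ.* (n C suc k)) ([k+1]*[n+1]C[k+1]≡[n+1]*nCk n k) ⟩
  (a ℕ.+ suc n ℕ.* (n C k)) ℕ.+ suc n ℕ.* (n C suc k)
    ≡⟨ ≡.trans (ℕ.+-assoc a _ _) (≡.cong (a ℕ.+_) (≡.sym (ℕ.*-distribˡ-+ (suc n) (n C k) _))) ⟩
  a ℕ.+ suc n ℕ.* ((n C k) ℕ.+ (n C suc k))
    ≡⟨ ≡.cong (λ z → a ℕ.+ suc n ℕ.* z) (nCk+nC[k+1]≡[n+1]C[k+1] n k) ⟩
  suc (suc n) ℕ.* a ∎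
  where
  open ≡-Reasoning
  a = suc n C suc k

-- By absorption p divides `suc i` times the coefficient, and 0 < `suc i` < p.
prime∣C : ∀ {n} → Prime (suc n) → ∀ {i} → i ℕ.< n → suc n ℕ∣.∣ suc n C suc i
prime∣C {n} p-prime {i} i<n
  with euclidsLemma (suc i) (suc n C suc i) p-prime
         (ℕ∣.divides (n C i) (≡.trans ([k+1]*[n+1]C[k+1]≡[n+1]*nCk n i) (ℕ.*-comm (suc n) (n C i))))
... | inj₁ p∣1+i = contradiction (ℕ∣.∣⇒≤ p∣1+i) (ℕ.<⇒≱ (ℕ.s<s i<n))
... | inj₂ p∣C   = p∣C

-- Finite differences of integer sequences

private
  module ∑ℤ = Algebra.Properties.Semiring.Sum ℤ.+-*-semiring
  module ∑ℤ′ = MonoidSums ℤ.+-0-commutativeMonoid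

∣-sum : ∀ {d n} (f : Fin n → ℤ) → (∀ i → d ℤ∣.∣ f i) → d ℤ∣.∣ ∑ℤ.sum f
∣-sum {n = zero}  f d∣f = divides (+ 0) ≡.refl
∣-sum {n = suc n} f d∣f = ℤ∣.∣m∣n⇒∣m+n (d∣f Fin.zero) (∣-sum (f ∘ Fin.suc) (d∣f ∘ Fin.suc))

Δ : (ℕ → ℤ) → ℕ → ℤ
Δ a j = a (suc j) ℤ.- a j

-- The recursion applies `Δ` to the sequence first, so that an induction on the order can pass from
-- `a` to `Δ a`.
Δ^ : ℕ → (ℕ → ℤ) → ℕ → ℤ
Δ^ zero    a = a
Δ^ (suc i) a = Δ^ i (Δ a)

-- The shift is 1 + Δ, so its k-th power expands binomially. In the step one shift is written as Δ
-- plus the identity, and Pascal's rule merges the two expansions.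
newton : ∀ (a : ℕ → ℤ) j k →
         a (j ℕ.+ k) ≡ ∑ℤ.sum {suc k} λ i → + (k C toℕ i) ℤ.* Δ^ (toℕ i) a j
newton a j zero = begin
  a (j ℕ.+ 0)                           ≡⟨ ≡.cong a (ℕ.+-identityʳ j) ⟩
  a j                                   ≡⟨ lemma (a j) ⟩
  + (0 C 0) ℤ.* a j ℤ.+ + 0             ∎
  where
  open ≡-Reasoning
  lemma : ∀ x → x ≡ + 1 ℤ.* x ℤ.+ + 0
  lemma = solve-∀
newton a j (suc k) = begin
  a (j ℕ.+ suc k)
    ≡⟨ ≡.cong a (ℕ.+-suc j k) ⟩
  a (suc (j ℕ.+ k))
    ≡⟨ split (a (suc (j ℕ.+ k))) (a (j ℕ.+ k)) ⟩
  Δ a (j ℕ.+ k) ℤ.+ a (j ℕ.+ k)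
    ≡⟨ ≡.cong₂ ℤ._+_ (newton (Δ a) j k) (newton a j k) ⟩
  ∑ℤ.sum {suc k} u ℤ.+ (f 0 ℤ.+ ∑ℤ.sum {k} (w ∘ toℕ))
    ≡⟨ ≡.cong₂ (λ x y → ∑ℤ.sum {suc k} u ℤ.+ (x ℤ.+ y)) head-eq tail-eq ⟩
  ∑ℤ.sum {suc k} u ℤ.+ (g 0 ℤ.+ ∑ℤ.sum {suc k} v)
    ≡⟨ swap (∑ℤ.sum u) (g 0) (∑ℤ.sum v) ⟩
  g 0 ℤ.+ (∑ℤ.sum {suc k} u ℤ.+ ∑ℤ.sum {suc k} v)
    ≡⟨ ≡.cong (λ x → g 0 ℤ.+ x) (∑ℤ.∑-distrib-+ u v) ⟨
  g 0 ℤ.+ ∑ℤ.sum {suc k} (λ i → u i ℤ.+ v i)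
    ≡⟨ ≡.cong (λ x → g 0 ℤ.+ x) (∑ℤ.sum-cong-≗ pascal) ⟩
  g 0 ℤ.+ ∑ℤ.sum {suc k} (λ i → g (suc (toℕ i)))
    ∎
  where
  open ≡-Reasoning
  f g w : ℕ → ℤ
  f i = + (k C i) ℤ.* Δ^ i a j
  g i = + (suc k C i) ℤ.* Δ^ i a j
  w i = f (suc i)
  u v : Fin (suc k) → ℤ
  u i = + (k C toℕ i) ℤ.* Δ^ (suc (toℕ i)) a j
  v = w ∘ toℕ
  split : ∀ x y → x ≡ (x ℤ.- y) ℤ.+ y
  split = solve-∀
  swap : ∀ x y z → x ℤ.+ (y ℤ.+ z) ≡ y ℤ.+ (x ℤ.+ z)
  swap = solve-∀
  head-eq : f 0 ≡ g 0
  head-eq = ≡.cong (λ c → + c ℤ.* a j) (≡.trans (nC0≡1 k) (≡.sym (nC0≡1 (suc k))))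
  -- The vanishing coefficient `k C suc k` pads the second expansion to the length of the first.
  last-zero : w k ≡ + 0
  last-zero = ≡.cong (λ c → + c ℤ.* Δ^ (suc k) a j) (k>n⇒nCk≡0 (ℕ.n<1+n k))
  tail-eq : ∑ℤ.sum {k} (w ∘ toℕ) ≡ ∑ℤ.sum {suc k} v
  tail-eq = ≡.sym (≡.trans (∑ℤ′.sum-snoc k w)
                    (≡.trans (≡.cong (λ x → ∑ℤ.sum {k} (w ∘ toℕ) ℤ.+ x) last-zero) (ℤ.+-identityʳ _)))
  pascal : ∀ i → u i ℤ.+ v i ≡ g (suc (toℕ i))
  pascal i = begin
    u i ℤ.+ v i
      ≡⟨ ℤ.*-distribʳ-+ (Δ^ (suc (toℕ i)) a j) (+ (k C toℕ i)) (+ (k C suc (toℕ i))) ⟨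
    (+ (k C toℕ i) ℤ.+ + (k C suc (toℕ i))) ℤ.* Δ^ (suc (toℕ i)) a j
      ≡⟨ ≡.cong (λ c → + c ℤ.* Δ^ (suc (toℕ i)) a j) (nCk+nC[k+1]≡[n+1]C[k+1] k (toℕ i)) ⟩
    g (suc (toℕ i)) ∎

-- Congruences modulo p

module Congruence {p} (p-prime : Prime p) where

  instance
    p-nonZero : ℕ.NonZero p
    p-nonZero = prime⇒nonZero p-prime

  1<p : 1 ℕ.< p
  1<p = ℕ.nonTrivial⇒n>1 p {{prime⇒nonTrivial p-prime}}

  infix 4 p∣_ _≅_
  p∣_ : ℤ → Set
  p∣ z = + p ℤ∣.∣ z

  -- A record and not an abbreviation, since `u` and `v` cannot be recovered from their difference.
  record _≅_ (u v : ℤ) : Set where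
    constructor congruent
    field difference : p∣ u ℤ.- v
  open _≅_ public

  ≡⇒≅ : ∀ {u v} → u ≡ v → u ≅ v
  ≡⇒≅ {u} ≡.refl = congruent (divides (+ 0) (ℤ.+-inverseʳ u))

  ≅-sym : ∀ {u v} → u ≅ v → v ≅ u
  ≅-sym {u} {v} u≅v = congruent (≡.subst p∣_ (lemma u v) (ℤ∣.∣m⇒∣-m (difference u≅v)))
    where lemma : ∀ u v → ℤ.- (u ℤ.- v) ≡ v ℤ.- u
          lemma = solve-∀

  ≅-trans : ∀ {u v w} → u ≅ v → v ≅ w → u ≅ w
  ≅-trans {u} {v} {w} u≅v v≅w = congruent (≡.subst p∣_ (lemma u v w) (ℤ∣.∣m∣n⇒∣m+n (difference u≅v) (difference v≅w)))
    where lemma : ∀ u v w → (u ℤ.- v) ℤ.+ (v ℤ.- w) ≡ u ℤ.- w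
          lemma = solve-∀

  ≅-+ : ∀ {u u′ v v′} → u ≅ u′ → v ≅ v′ → u ℤ.+ v ≅ u′ ℤ.+ v′
  ≅-+ {u} {u′} {v} {v′} u≅u′ v≅v′ = congruent (≡.subst p∣_ (lemma u u′ v v′) (ℤ∣.∣m∣n⇒∣m+n (difference u≅u′) (difference v≅v′)))
    where lemma : ∀ u u′ v v′ → (u ℤ.- u′) ℤ.+ (v ℤ.- v′) ≡ (u ℤ.+ v) ℤ.- (u′ ℤ.+ v′)
          lemma = solve-∀

  ≅-neg : ∀ {u v} → u ≅ v → ℤ.- u ≅ ℤ.- v
  ≅-neg {u} {v} u≅v = congruent (≡.subst p∣_ (lemma u v) (ℤ∣.∣m⇒∣-m (difference u≅v)))
    where lemma : ∀ u v → ℤ.- (u ℤ.- v) ≡ ℤ.- u ℤ.- (ℤ.- v)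
          lemma = solve-∀

  ≅-sub : ∀ {u u′ v v′} → u ≅ u′ → v ≅ v′ → u ℤ.- v ≅ u′ ℤ.- v′
  ≅-sub u≅u′ v≅v′ = ≅-+ u≅u′ (≅-neg v≅v′)

  ≅-*ˡ : ∀ c {u v} → u ≅ v → c ℤ.* u ≅ c ℤ.* v
  ≅-*ˡ c {u} {v} u≅v = congruent (≡.subst p∣_ (lemma c u v) (ℤ∣.∣n⇒∣m*n c (difference u≅v)))
    where lemma : ∀ c u v → c ℤ.* (u ℤ.- v) ≡ c ℤ.* u ℤ.- c ℤ.* v
          lemma = solve-∀

  ≅0⇒p∣ : ∀ {u} → u ≅ + 0 → p∣ u
  ≅0⇒p∣ {u} u≅0 = ≡.subst p∣_ (ℤ.+-identityʳ u) (difference u≅0)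

  p∣⇒≅0 : ∀ {u} → p∣ u → u ≅ + 0
  p∣⇒≅0 {u} p∣u = congruent (≡.subst p∣_ (≡.sym (ℤ.+-identityʳ u)) p∣u)

  p∣-resp-≅ : ∀ {u v} → u ≅ v → p∣ u → p∣ v
  p∣-resp-≅ u≅v p∣u = ≅0⇒p∣ (≅-trans (≅-sym u≅v) (p∣⇒≅0 p∣u))

  p∣m*n : ∀ u v → p∣ u ℤ.* v → p∣ u ⊎ p∣ v
  p∣m*n u v p∣uv = Sum.map ℤ∣.∣ᵤ⇒∣ ℤ∣.∣ᵤ⇒∣
    (euclidsLemma ℤ.∣ u ∣ ℤ.∣ v ∣ p-prime (≡.subst (p ℕ∣.∣_) (ℤ.abs-* u v) (ℤ∣.∣⇒∣ᵤ p∣uv)))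

  p∣p*m : ∀ u → p∣ + p ℤ.* u
  p∣p*m u = divides u (ℤ.*-comm (+ p) u)

  p∤1 : ¬ p∣ + 1
  p∤1 p∣1 = ℕ.<⇒≱ 1<p (ℕ∣.∣⇒≤ (ℤ∣.∣⇒∣ᵤ p∣1))

  small-multiple : ∀ {k} → k ℕ.< p → p∣ + k → k ≡ 0
  small-multiple {zero}  k<p p∣k = ≡.refl
  small-multiple {suc k} k<p p∣k = contradiction (ℕ∣.∣⇒≤ (ℤ∣.∣⇒∣ᵤ p∣k)) (ℕ.<⇒≱ k<p)

  residue-unique : ∀ {r s} → r ℕ.< p → s ℕ.< p → + r ≅ + s → r ≡ s
  residue-unique {r} {s} r<p s<p r≅s with ℕ.≤-total s r
  ... | inj₁ s≤r = ℕ.≤-antisym (ℕ.m∸n≡0⇒m≤n (small-multiple (ℕ.≤-<-trans (ℕ.m∸n≤m r s) r<p)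
                     (≡.subst p∣_ (≡.trans (ℤ.m-n≡m⊖n r s) (ℤ.⊖-≥ s≤r)) (difference r≅s)))) s≤r
  ... | inj₂ r≤s = ℕ.≤-antisym r≤s (ℕ.m∸n≡0⇒m≤n (small-multiple (ℕ.≤-<-trans (ℕ.m∸n≤m s r) s<p)
                     (≡.subst p∣_ (≡.trans (ℤ.m-n≡m⊖n s r) (ℤ.⊖-≥ r≤s)) (difference (≅-sym r≅s)))))

  %-≅ : ∀ u → + (u %ℕ p) ≅ u
  %-≅ u = ≅-sym (congruent (divides (u ℤ./ℕ p) (≡.trans (≡.cong (λ z → z ℤ.- + (u %ℕ p)) (ℤ.a≡a%ℕn+[a/ℕn]*n u p))
                                        (lemma (+ (u %ℕ p)) (u ℤ./ℕ p ℤ.* + p)))))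
    where lemma : ∀ r t → (r ℤ.+ t) ℤ.- r ≡ t
          lemma = solve-∀

  %-cong : ∀ {u v} → u ≅ v → u %ℕ p ≡ v %ℕ p
  %-cong {u} {v} u≅v = residue-unique (ℤ.n%ℕd<d u p) (ℤ.n%ℕd<d v p)
    (≅-trans (%-≅ u) (≅-trans u≅v (≅-sym (%-≅ v))))

  %-small : ∀ {r u} → r ℕ.< p → + r ≅ u → u %ℕ p ≡ r
  %-small {r} {u} r<p r≅u = residue-unique (ℤ.n%ℕd<d u p) r<p (≅-trans (%-≅ u) (≅-sym r≅u))

  bezout : ∀ u → ¬ p∣ u → ∃[ α ] α ℤ.* u ≅ + 1
  bezout u p∤u with u %ℕ p in eq
  ... | zero = contradiction (p∣-resp-≅ (≡.subst (λ r → + r ≅ u) eq (%-≅ u)) (divides (+ 0) ≡.refl)) p∤u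
  ... | suc r with coprime-Bézout (prime⇒coprime p-prime (≡.subst (ℕ._< p) eq (ℤ.n%ℕd<d u p)))
  -- Over the naturals the Bézout identity comes in two forms; this one makes -y the inverse, the
  -- other one y.
  ... | GCD.Bézout.+- x y 1+yr≡xp = ℤ.- + y , ≅-trans (≅-*ˡ (ℤ.- + y) (≅-sym u-residue)) (congruent (divides (ℤ.- + x) step))
    where
    u-residue : + suc r ≅ u
    u-residue = ≡.subst (λ r → + r ≅ u) eq (%-≅ u)
    lemma : ∀ y r → ℤ.- y ℤ.* r ℤ.- + 1 ≡ ℤ.- (+ 1 ℤ.+ y ℤ.* r)
    lemma = solve-∀
    step : ℤ.- + y ℤ.* + suc r ℤ.- + 1 ≡ ℤ.- + x ℤ.* + p
    step = begin
      ℤ.- + y ℤ.* + suc r ℤ.- + 1     ≡⟨ lemma (+ y) (+ suc r) ⟩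
      ℤ.- (+ 1 ℤ.+ + y ℤ.* + suc r)   ≡⟨ ≡.cong (λ z → ℤ.- (+ 1 ℤ.+ z)) (ℤ.pos-* y (suc r)) ⟨
      ℤ.- + (1 ℕ.+ y ℕ.* suc r)       ≡⟨ ≡.cong (λ z → ℤ.- + z) 1+yr≡xp ⟩
      ℤ.- + (x ℕ.* p)                 ≡⟨ ≡.cong ℤ.-_ (ℤ.pos-* x p) ⟩
      ℤ.- (+ x ℤ.* + p)               ≡⟨ ℤ.neg-distribˡ-* (+ x) (+ p) ⟩
      ℤ.- + x ℤ.* + p                 ∎
      where open ≡-Reasoning
  ... | GCD.Bézout.-+ x y 1+xp≡yr = + y , ≅-trans (≅-*ˡ (+ y) (≅-sym u-residue)) (congruent (divides (+ x) step))
    where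
    u-residue : + suc r ≅ u
    u-residue = ≡.subst (λ r → + r ≅ u) eq (%-≅ u)
    lemma : ∀ z → (+ 1 ℤ.+ z) ℤ.- + 1 ≡ z
    lemma = solve-∀
    step : + y ℤ.* + suc r ℤ.- + 1 ≡ + x ℤ.* + p
    step = begin
      + y ℤ.* + suc r ℤ.- + 1         ≡⟨ ≡.cong (λ z → z ℤ.- + 1) (ℤ.pos-* y (suc r)) ⟨
      + (y ℕ.* suc r) ℤ.- + 1         ≡⟨ ≡.cong (λ z → + z ℤ.- + 1) 1+xp≡yr ⟨
      (+ 1 ℤ.+ + (x ℕ.* p)) ℤ.- + 1   ≡⟨ lemma (+ (x ℕ.* p)) ⟩
      + (x ℕ.* p)                     ≡⟨ ℤ.pos-* x p ⟩
      + x ℤ.* + p                     ∎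
      where open ≡-Reasoning

  n<p^n : ∀ n → n ℕ.< p ℕ.^ n
  n<p^n zero    = ℕ.s≤s ℕ.z≤n
  n<p^n (suc n) = ℕ.<-≤-trans (ℕ.s<s (n<p^n n))
    (ℕ.≤-trans (ℕ.+-monoˡ-≤ (p ℕ.^ n) (ℕ.m^n>0 p n)) (ℕ.≤-trans (ℕ.≤-reflexive (≡.cong (p ℕ.^ n ℕ.+_) (≡.sym (ℕ.+-identityʳ _)))) (ℕ.*-monoˡ-≤ (p ℕ.^ n) 1<p)))

  -- A nonzero z is smaller in absolute value than p^|z|, hence not divisible by it.
  p^-divisible⇒≡0 : ∀ z → (∀ k → + (p ℕ.^ k) ℤ∣.∣ z) → z ≡ + 0
  p^-divisible⇒≡0 z p^k∣z with ℤ.∣ z ∣ in eq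
  ... | zero  = ℤ.∣i∣≡0⇒i≡0 eq
  ... | suc n = contradiction (ℕ∣.∣⇒≤ (≡.subst (p ℕ.^ suc n ℕ∣.∣_) eq (ℤ∣.∣⇒∣ᵤ (p^k∣z (suc n)))))
                              (ℕ.<⇒≱ (n<p^n (suc n)))

-- Newton's formula with k = p expresses a (j + p) by a j, terms with inner binomial coefficients,
-- and Δ^p a j. Periodicity cancels a j, so Δ^p a j is minus a multiple of p.
Δ^p-divisible : ∀ {p} → Prime p → ∀ a → (∀ j → a (j ℕ.+ p) ≡ a j) → ∀ j → + p ℤ∣.∣ Δ^ p a j
Δ^p-divisible {suc n} p-prime a periodic j =
  ≡.subst (+ suc n ℤ∣.∣_) (isolate _ _ _ expansion) (ℤ∣.∣m⇒∣-m (∣-sum (g ∘ toℕ) middle))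
  where
  g f : ℕ → ℤ
  f i = + (suc n C i) ℤ.* Δ^ i a j
  g = f ∘ suc
  middle : ∀ i → + suc n ℤ∣.∣ g (toℕ i)
  middle i = ℤ∣.∣m⇒∣m*n {m = + (suc n C suc (toℕ i))} (Δ^ (suc (toℕ i)) a j) (ℤ∣.∣ᵤ⇒∣ (prime∣C p-prime (Fin.toℕ<n i)))
  one : ∀ x → + 1 ℤ.* x ≡ x
  one = ℤ.*-identityˡ
  expansion : a j ≡ a j ℤ.+ (∑ℤ.sum {n} (g ∘ toℕ) ℤ.+ Δ^ (suc n) a j)
  expansion = begin
    a j                      ≡⟨ periodic j ⟨
    a (j ℕ.+ suc n)          ≡⟨ newton a j (suc n) ⟩
    f 0 ℤ.+ ∑ℤ.sum {suc n} (g ∘ toℕ)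
      ≡⟨ ≡.cong₂ ℤ._+_ (≡.trans (≡.cong (λ c → + c ℤ.* a j) (nC0≡1 (suc n))) (one (a j))) (∑ℤ′.sum-snoc n g) ⟩
    a j ℤ.+ (∑ℤ.sum {n} (g ∘ toℕ) ℤ.+ g n)
      ≡⟨ ≡.cong (λ z → a j ℤ.+ (∑ℤ.sum {n} (g ∘ toℕ) ℤ.+ z))
                (≡.trans (≡.cong (λ c → + c ℤ.* Δ^ (suc n) a j) (nCn≡1 (suc n))) (one _)) ⟩
    a j ℤ.+ (∑ℤ.sum {n} (g ∘ toℕ) ℤ.+ Δ^ (suc n) a j) ∎
    where open ≡-Reasoning
  isolate : ∀ x m d → x ≡ x ℤ.+ (m ℤ.+ d) → ℤ.- m ≡ d
  isolate x m d eq = begin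
    ℤ.- m                                  ≡⟨ lemma₁ x m ⟩
    x ℤ.- x ℤ.- m                          ≡⟨ ≡.cong (λ z → z ℤ.- x ℤ.- m) eq ⟩
    (x ℤ.+ (m ℤ.+ d)) ℤ.- x ℤ.- m          ≡⟨ lemma₂ x m d ⟩
    d                                      ∎
    where
    open ≡-Reasoning
    lemma₁ : ∀ x m → ℤ.- m ≡ x ℤ.- x ℤ.- m
    lemma₁ = solve-∀
    lemma₂ : ∀ x m d → (x ℤ.+ (m ℤ.+ d)) ℤ.- x ℤ.- m ≡ d
    lemma₂ = solve-∀

-- The p-th power of a sum

module Freshman {a ℓ} (R : CommutativeRing a ℓ) where
  open CommutativeRing R
  open IntegerMultiples R using (ι; ι-homo-*)
  open Algebra.Properties.Semiring.Sum semiring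
  open Algebra.Properties.CommutativeSemiring.Exp commutativeSemiring
  open import Relation.Binary.Reasoning.Setoid setoid
  open MonoidSums +-commutativeMonoid using (sum-snoc)
  private
    module M = Algebra.Properties.Semiring.Mult.TCOptimised semiring
    module U = Algebra.Properties.Semiring.Mult semiring

  private
    [x+y]^p′ : ∀ {n} → Prime (suc n) → ∀ x y → (x + y) ^ suc n ≈
      x ^ suc n + y ^ suc n +
      ι (+ suc n) * sum {n} λ i → ι (+ ((suc n C suc (toℕ i)) ℕ./ suc n)) * (x ^ suc (toℕ i) * y ^ (n ∸ toℕ i))
    [x+y]^p′ {n} p-prime x y = begin
      (x + y) ^ suc n
        ≈⟨ Algebra.Properties.CommutativeSemiring.Binomial.theorem commutativeSemiring (suc n) x y ⟩
      f 0 + sum {suc n} (g ∘ toℕ)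
        ≈⟨ +-cong (trans (unit (nC0≡1 (suc n))) (*-identityˡ _)) (sum-snoc n g) ⟩
      y ^ suc n + (sum {n} (g ∘ toℕ) + g n)
        ≈⟨ +-congˡ (+-cong middle (trans (unit (nCn≡1 (suc n)))
             (trans (*-congˡ (^-congʳ y (ℕ.n∸n≡0 n))) (*-identityʳ _)))) ⟩
      y ^ suc n + (ι (+ suc n) * sum h + x ^ suc n)
        ≈⟨ trans (+-congˡ (+-comm _ _)) (trans (sym (+-assoc _ _ _)) (+-congʳ (+-comm _ _))) ⟩
      x ^ suc n + y ^ suc n + ι (+ suc n) * sum h ∎
      where
      f g : ℕ → Carrier
      f k = (suc n C k) U.× (x ^ k * y ^ (suc n ∸ k))
      g = f ∘ suc
      h : Fin n → Carrier
      h i = ι (+ ((suc n C suc (toℕ i)) ℕ./ suc n)) * (x ^ suc (toℕ i) * y ^ (n ∸ toℕ i))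
      unit : ∀ {k z} → k ≡ 1 → k U.× z ≈ z
      unit ≡.refl = U.×-homo-1 _
      scale : ∀ k z → k U.× z ≈ ι (+ k) * z
      scale k z = begin
        k U.× z             ≈⟨ U.×-congʳ k (*-identityˡ z) ⟨
        k U.× (1# * z)      ≈⟨ U.×-assoc-* k 1# z ⟨
        (k U.× 1#) * z      ≈⟨ *-congʳ (M.×ᵤ≈× k 1#) ⟩
        ι (+ k) * z         ∎
      term : ∀ i → g (toℕ i) ≈ ι (+ suc n) * h i
      term i = begin
        g (toℕ i)                                    ≈⟨ scale (suc n C suc (toℕ i)) z ⟩
        ι (+ (suc n C suc (toℕ i))) * z              ≡⟨ ≡.cong (λ c → ι (+ c) * z) (ℕ.m*[n/m]≡n
                                                          (prime∣C p-prime (Fin.toℕ<n i))) ⟨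
        ι (+ (suc n ℕ.* c)) * z                      ≡⟨ ≡.cong (λ c → ι c * z) (ℤ.pos-* (suc n) c) ⟩
        ι (+ suc n ℤ.* + c) * z                      ≈⟨ *-congʳ (ι-homo-* (+ suc n) (+ c)) ⟩
        (ι (+ suc n) * ι (+ c)) * z                  ≈⟨ *-assoc _ _ _ ⟩
        ι (+ suc n) * h i                            ∎
        where
        z = x ^ suc (toℕ i) * y ^ (n ∸ toℕ i)
        c = (suc n C suc (toℕ i)) ℕ./ suc n
      middle : sum {n} (g ∘ toℕ) ≈ ι (+ suc n) * sum h
      middle = trans (sum-cong-≋ term) (sym (*-distribˡ-sum (ι (+ suc n)) h))

  -- Two uses shape the statement. In characteristic p only the factor `ι (+ p)` matters; in ℤ[ζ]
  -- the cofactor must be recognised as an element of the subring, so its integer coefficients and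
  -- exponents are exhibited, independently of x and y.
  [x+y]^p : ∀ {p} → Prime p →
    ∃[ n ] Σ[ c ∈ (Fin n → ℤ) ] Σ[ k ∈ (Fin n → ℕ) ] Σ[ l ∈ (Fin n → ℕ) ]
      (∀ x y → (x + y) ^ p ≈ x ^ p + y ^ p + ι (+ p) * sum λ i → ι (c i) * (x ^ k i * y ^ l i))
  [x+y]^p {suc n} p-prime =
    n , (λ i → + ((suc n C suc (toℕ i)) ℕ./ suc n)) , (λ i → suc (toℕ i)) , (λ i → n ∸ toℕ i) , [x+y]^p′ p-prime

-- Rings with a p-th root of unity, and elimination modulo p

record RootOfUnity (p : ℕ) (a ℓ : Level) : Set (Level.suc (a ⊔ ℓ)) where
  field
    commutativeRing : CommutativeRing a ℓ

  open CommutativeRing commutativeRing public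
  open IntegerMultiples commutativeRing using (ι)
  open Algebra.Properties.CommutativeSemiring.Exp commutativeSemiring using (_^_)

  -- A constructively usable form of: an integral domain of characteristic 0.
  field
    cancel : ∀ {x y} → ¬ x ≈ 0# → x * y ≈ 0# → y ≈ 0#
    char-0 : ∀ {z} → ι z ≈ 0# → z ≡ + 0
    ζ      : Carrier
    ζ^p≈1  : ζ ^ p ≈ 1#
    ζ≉1    : ¬ ζ ≈ 1#

module Cyclotomic {p : ℕ} (p-prime : Prime p) {a ℓ} (U : RootOfUnity p a ℓ) where

  open RootOfUnity U
  open IntegerMultiples commutativeRing public
  open Solver
  open Algebra.Properties.Semiring.Sum semiring
  open Algebra.Properties.CommutativeSemiring.Exp commutativeSemiring
  open MonoidSums +-commutativeMonoid
  open Congruence p-prime public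
  open import Relation.Binary.Reasoning.Setoid setoid

  cancelˡ : ∀ {x y z} → ¬ x ≈ 0# → x * y ≈ x * z → y ≈ z
  cancelˡ {x} {y} {z} x≉0 xy≈xz = begin
    y             ≈⟨ solve 2 (λ y z → y := (y :- z) :+ z) refl y z ⟩
    (y - z) + z   ≈⟨ +-congʳ (cancel x≉0 x[y-z]≈0) ⟩
    0# + z        ≈⟨ +-identityˡ z ⟩
    z             ∎
    where
    x[y-z]≈0 : x * (y - z) ≈ 0#
    x[y-z]≈0 = begin
      x * (y - z)     ≈⟨ solve 3 (λ x y z → x :* (y :- z) := x :* y :- x :* z) refl x y z ⟩
      x * y - x * z   ≈⟨ +-congʳ xy≈xz ⟩
      x * z - x * z   ≈⟨ -‿inverseʳ _ ⟩
      0#              ∎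

  ι-injective : ∀ {y z} → ι y ≈ ι z → y ≡ z
  ι-injective {y} {z} ιy≈ιz = ℤ.i-j≡0⇒i≡j y z (char-0 (begin
    ι (y ℤ.- z)   ≈⟨ ι-homo-sub y z ⟩
    ι y - ι z     ≈⟨ +-congʳ ιy≈ιz ⟩
    ι z - ι z     ≈⟨ -‿inverseʳ _ ⟩
    0#            ∎))

  p∤⇒ι≉0 : ∀ {z} → ¬ p∣ z → ¬ ι z ≈ 0#
  p∤⇒ι≉0 p∤z ιz≈0 = p∤z (divides (+ 0) (char-0 ιz≈0))

  +p≢0 : + p ≢ + 0
  +p≢0 +p≡0 = ℕ.≢-nonZero⁻¹ p (ℤ.+-injective +p≡0)

  ιp≉0 : ¬ ι (+ p) ≈ 0#
  ιp≉0 ιp≈0 = +p≢0 (char-0 ιp≈0)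

  1≉0 : ¬ 1# ≈ 0#
  1≉0 1≈0 with () ← char-0 {+ 1} 1≈0

  -- Eliminating the first unknown preserves the shape of the system, so no
  -- determinants are needed.
  nakayama : ∀ {k} (D : Fin k → ℤ) (E : Fin k → Fin k → ℤ) (v : Fin k → Carrier) →
             (∀ i → ¬ p∣ D i) →
             (∀ i → ι (D i) * v i ≈ sum λ j → ι (+ p ℤ.* E i j) * v j) →
             ∀ i → v i ≈ 0#
  nakayama {zero}  D E v p∤D system ()
  nakayama {suc k} D E v p∤D system = λ where
      Fin.zero    → cancel (p∤⇒ι≉0 p∤d) (trans eliminate (sum-ε _ λ j → trans (*-congˡ (rest j)) (zeroʳ _)))
      (Fin.suc i) → rest i
    where
    d : ℤ
    d = D Fin.zero ℤ.- + p ℤ.* E Fin.zero Fin.zero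
    S : Carrier
    S = sum λ j → ι (+ p ℤ.* E Fin.zero (Fin.suc j)) * v (Fin.suc j)
    p∤d : ¬ p∣ d
    p∤d p∣d = p∤D Fin.zero (ℤ∣.∣m+n∣n⇒∣m p∣d (ℤ∣.∣m⇒∣-m (p∣p*m _)))
    eliminate : ι d * v Fin.zero ≈ S
    eliminate = begin
      ι d * v₀                                ≈⟨ *-congʳ (ι-homo-sub (D Fin.zero) pE₀₀) ⟩
      (ι (D Fin.zero) - ι pE₀₀) * v₀          ≈⟨ solve 3 (λ x y z → (x :- y) :* z := x :* z :- y :* z) refl _ _ _ ⟩
      ι (D Fin.zero) * v₀ - ι pE₀₀ * v₀       ≈⟨ +-congʳ (system Fin.zero) ⟩
      (ι pE₀₀ * v₀ + S) - ι pE₀₀ * v₀         ≈⟨ solve 2 (λ x y → (x :+ y) :- x := y) refl _ _ ⟩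
      S                                       ∎
      where
      v₀ = v Fin.zero
      pE₀₀ = + p ℤ.* E Fin.zero Fin.zero
    -- Row i + 1 is multiplied by d, and d v₀ is replaced by S. The right side keeps its factor p,
    -- and the new diagonal entry `d * D (suc i)` is still prime to p.
    E′ : Fin k → Fin k → ℤ
    E′ i j = E (Fin.suc i) Fin.zero ℤ.* (+ p ℤ.* E Fin.zero (Fin.suc j)) ℤ.+ d ℤ.* E (Fin.suc i) (Fin.suc j)
    system′ : ∀ i → ι (d ℤ.* D (Fin.suc i)) * v (Fin.suc i) ≈ sum λ j → ι (+ p ℤ.* E′ i j) * v (Fin.suc j)
    system′ i = begin
      ι (d ℤ.* D (Fin.suc i)) * v (Fin.suc i)
        ≈⟨ trans (*-congʳ (ι-homo-* d _)) (*-assoc _ _ _) ⟩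
      ι d * (ι (D (Fin.suc i)) * v (Fin.suc i))
        ≈⟨ *-congˡ (system (Fin.suc i)) ⟩
      ι d * (ι (+ p ℤ.* e) * v Fin.zero + sum g)
        ≈⟨ solve 4 (λ d e v g → d :* (e :* v :+ g) := e :* (d :* v) :+ d :* g) refl _ _ _ _ ⟩
      ι (+ p ℤ.* e) * (ι d * v Fin.zero) + ι d * sum g
        ≈⟨ +-cong (*-congˡ eliminate) (*-distribˡ-sum (ι d) g) ⟩
      ι (+ p ℤ.* e) * S + sum (λ j → ι d * g j)
        ≈⟨ +-congʳ (*-distribˡ-sum (ι (+ p ℤ.* e)) λ j → ι (+ p ℤ.* E Fin.zero (Fin.suc j)) * v (Fin.suc j)) ⟩
      sum (λ j → ι (+ p ℤ.* e) * (ι (+ p ℤ.* E Fin.zero (Fin.suc j)) * v (Fin.suc j))) + sum (λ j → ι d * g j)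
        ≈⟨ ∑-distrib-+ _ (λ j → ι d * g j) ⟨
      sum (λ j → ι (+ p ℤ.* e) * (ι (+ p ℤ.* E Fin.zero (Fin.suc j)) * v (Fin.suc j)) + ι d * g j)
        ≈⟨ sum-cong-≋ combine ⟩
      sum (λ j → ι (+ p ℤ.* E′ i j) * v (Fin.suc j)) ∎
      where
      e = E (Fin.suc i) Fin.zero
      g : Fin k → Carrier
      g j = ι (+ p ℤ.* E (Fin.suc i) (Fin.suc j)) * v (Fin.suc j)
      combine : ∀ j → ι (+ p ℤ.* e) * (ι (+ p ℤ.* E Fin.zero (Fin.suc j)) * v (Fin.suc j)) + ι d * g j ≈
                      ι (+ p ℤ.* E′ i j) * v (Fin.suc j)
      combine j = begin
        ι (+ p ℤ.* e) * (ι b * w) + ι d * (ι c * w)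
          ≈⟨ solve 5 (λ pe b w d c → pe :* (b :* w) :+ d :* (c :* w) := (pe :* b :+ d :* c) :* w) refl _ _ _ _ _ ⟩
        (ι (+ p ℤ.* e) * ι b + ι d * ι c) * w
          ≈⟨ *-congʳ (+-cong (ι-homo-* (+ p ℤ.* e) b) (ι-homo-* d c)) ⟨
        (ι (+ p ℤ.* e ℤ.* b) + ι (d ℤ.* c)) * w
          ≈⟨ *-congʳ (ι-homo-+ (+ p ℤ.* e ℤ.* b) (d ℤ.* c)) ⟨
        ι (+ p ℤ.* e ℤ.* b ℤ.+ d ℤ.* c) * w
          ≡⟨ ≡.cong (λ z → ι z * w) (lemma (+ p) e b d (E (Fin.suc i) (Fin.suc j))) ⟩
        ι (+ p ℤ.* E′ i j) * w ∎
        where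
        w = v (Fin.suc j)
        b = + p ℤ.* E Fin.zero (Fin.suc j)
        c = + p ℤ.* E (Fin.suc i) (Fin.suc j)
        lemma : ∀ p e b d f → p ℤ.* e ℤ.* b ℤ.+ d ℤ.* (p ℤ.* f) ≡ p ℤ.* (e ℤ.* b ℤ.+ d ℤ.* f)
        lemma = solve-∀
    rest : ∀ i → v (Fin.suc i) ≈ 0#
    rest = nakayama (λ i → d ℤ.* D (Fin.suc i)) E′ (v ∘ Fin.suc)
      (λ i p∣dD → Sum.[ p∤d , p∤D (Fin.suc i) ] (p∣m*n d (D (Fin.suc i)) p∣dD)) system′

  -- Powers of ζ as a character of the integers modulo p

  ζ^[k+tp] : ∀ k t → ζ ^ (k ℕ.+ t ℕ.* p) ≈ ζ ^ k
  ζ^[k+tp] k t = begin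
    ζ ^ (k ℕ.+ t ℕ.* p)       ≈⟨ ^-homo-* ζ k (t ℕ.* p) ⟩
    ζ ^ k * ζ ^ (t ℕ.* p)     ≈⟨ *-congˡ (trans (^-congʳ ζ (ℕ.*-comm t p)) (sym (^-assocʳ ζ p t))) ⟩
    ζ ^ k * (ζ ^ p) ^ t       ≈⟨ *-congˡ (trans (^-congˡ t ζ^p≈1) (1^n≈1 t)) ⟩
    ζ ^ k * 1#                ≈⟨ *-identityʳ _ ⟩
    ζ ^ k                     ∎

  -- The exponent is reduced exactly as in `Walsh.ζ^_`, so that over the complex numbers the two
  -- agree by computation.
  e : ℤ → Carrier
  e k = ζ ^ (k %ℕ p)

  e-cong : ∀ {u v} → u ≅ v → e u ≈ e v
  e-cong u≅v = ^-congʳ ζ (%-cong u≅v)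

  e-ℕ : ∀ k → e (+ k) ≈ ζ ^ k
  e-ℕ k = sym (trans (^-congʳ ζ (ℕ.m≡m%n+[m/n]*n k p)) (ζ^[k+tp] (k ℕ.% p) (k ℕ./ p)))

  e-+ : ∀ u v → e (u ℤ.+ v) ≈ e u * e v
  e-+ u v = begin
    e (u ℤ.+ v)                        ≈⟨ e-cong (≅-+ (%-≅ u) (%-≅ v)) ⟨
    e (+ (u %ℕ p) ℤ.+ + (v %ℕ p))      ≈⟨ e-ℕ (u %ℕ p ℕ.+ v %ℕ p) ⟩
    ζ ^ (u %ℕ p ℕ.+ v %ℕ p)            ≈⟨ ^-homo-* ζ (u %ℕ p) (v %ℕ p) ⟩
    e u * e v                          ∎

  e-0 : e (+ 0) ≈ 1#
  e-0 = e-ℕ 0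

  e-1 : e (+ 1) ≈ ζ
  e-1 = trans (e-ℕ 1) (*-identityʳ ζ)

  e-inverse : ∀ u → e u * e (ℤ.- u) ≈ 1#
  e-inverse u = trans (sym (e-+ u (ℤ.- u))) (trans (reflexive (≡.cong e (ℤ.+-inverseʳ u))) e-0)

  e≉0 : ∀ u → ¬ e u ≈ 0#
  e≉0 u eu≈0 = 1≉0 (trans (sym (e-inverse u)) (trans (*-congʳ eu≈0) (zeroˡ _)))

  e-multiple : ∀ {u} → e u ≈ 1# → ∀ k → e (k ℤ.* u) ≈ 1#
  e-multiple {u} eu≈1 = λ where
      (+ n)    → natural n
      -[1+ n ] → begin
        e (-[1+ n ] ℤ.* u)                        ≡⟨ ≡.cong e (ℤ.neg-distribˡ-* (+ suc n) u) ⟨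
        e (ℤ.- (+ suc n ℤ.* u))                   ≈⟨ *-identityˡ _ ⟨
        1# * e (ℤ.- (+ suc n ℤ.* u))              ≈⟨ *-congʳ (natural (suc n)) ⟨
        e (+ suc n ℤ.* u) * e (ℤ.- (+ suc n ℤ.* u)) ≈⟨ e-inverse (+ suc n ℤ.* u) ⟩
        1#                                        ∎
    where
    natural : ∀ n → e (+ n ℤ.* u) ≈ 1#
    natural zero    = trans (reflexive (≡.cong e (ℤ.*-zeroˡ u))) e-0
    natural (suc n) = begin
      e (+ suc n ℤ.* u)         ≡⟨ ≡.cong e (ℤ.suc-* (+ n) u) ⟩
      e (u ℤ.+ + n ℤ.* u)       ≈⟨ e-+ u (+ n ℤ.* u) ⟩
      e u * e (+ n ℤ.* u)       ≈⟨ *-cong eu≈1 (natural n) ⟩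
      1# * 1#                   ≈⟨ *-identityˡ 1# ⟩
      1#                        ∎

  -- Otherwise u has an inverse α modulo p, and ζ = e (α u) would be a power of e u = 1. This is
  -- where primality makes a nontrivial root primitive.
  e≈1⇒p∣ : ∀ {u} → e u ≈ 1# → p∣ u
  e≈1⇒p∣ {u} eu≈1 with + p ℤ∣.∣? u
  ... | yes p∣u = p∣u
  ... | no  p∤u with bezout u p∤u
  ... | α , αu≅1 = contradiction (trans (sym e-1) (trans (e-cong (≅-sym αu≅1)) (e-multiple eu≈1 α))) ζ≉1

  e-injective : ∀ {u v} → e u ≈ e v → u ≅ v
  e-injective {u} {v} eu≈ev = congruent (e≈1⇒p∣ (begin
    e (u ℤ.- v)           ≈⟨ e-+ u (ℤ.- v) ⟩
    e u * e (ℤ.- v)       ≈⟨ *-congʳ eu≈ev ⟩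
    e v * e (ℤ.- v)       ≈⟨ e-inverse v ⟩
    1#                    ∎))

  -- The element ζ - 1

  π : Carrier
  π = ζ - 1#

  π≉0 : ¬ π ≈ 0#
  π≉0 π≈0 = ζ≉1 (begin
    ζ             ≈⟨ solve 1 (λ z → z := (z :- con (+ 1)) :+ con (+ 1)) refl ζ ⟩
    π + 1#        ≈⟨ +-congʳ π≈0 ⟩
    0# + 1#       ≈⟨ +-identityˡ 1# ⟩
    1#            ∎)

  sum-shift : ∀ (f : ℕ → Carrier) → f p ≈ f 0 → sum {p} (f ∘ suc ∘ toℕ) ≈ sum {p} (f ∘ toℕ)
  sum-shift f fp≈f0 = begin
    sum {p} (f ∘ suc ∘ toℕ)                     ≈⟨ solve 2 (λ s x → s := (x :+ s) :- x) refl _ (f 0) ⟩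
    (f 0 + sum {p} (f ∘ suc ∘ toℕ)) - f 0       ≈⟨ +-congʳ (sum-snoc p f) ⟩
    (sum {p} (f ∘ toℕ) + f p) - f 0             ≈⟨ +-congʳ (+-congˡ fp≈f0) ⟩
    (sum {p} (f ∘ toℕ) + f 0) - f 0             ≈⟨ solve 2 (λ s x → (s :+ x) :- x := s) refl _ (f 0) ⟩
    sum {p} (f ∘ toℕ)                           ∎

  ∑ζ^≈0 : sum {p} (λ j → ζ ^ toℕ j) ≈ 0#
  ∑ζ^≈0 = cancel π≉0 (begin
    π * Φ                                 ≈⟨ solve 2 (λ z x → (z :- con (+ 1)) :* x := z :* x :- x) refl ζ Φ ⟩
    ζ * Φ - Φ                             ≈⟨ +-congʳ (*-distribˡ-sum {p} ζ (λ j → ζ ^ toℕ j)) ⟩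
    sum {p} (λ j → ζ ^ suc (toℕ j)) - Φ   ≈⟨ +-congʳ (sum-shift (ζ ^_) ζ^p≈1) ⟩
    Φ - Φ                                 ≈⟨ -‿inverseʳ Φ ⟩
    0#                                    ∎)
    where Φ = sum {p} (λ j → ζ ^ toℕ j)

  T : Carrier
  T = sum {p} λ j → ι (+ toℕ j) * ζ ^ toℕ j

  -- Since Σ ζ^j = 0, the product ζ T equals Σ (j + 1) ζ^(j+1). This is T without its zero first
  -- term and with the new last term p ζ^p = p. So `T` is the cofactor of π in p.
  πT≈ιp : π * T ≈ ι (+ p)
  πT≈ιp = begin
    π * T
      ≈⟨ solve 3 (λ z x y → (z :- con (+ 1)) :* x := (z :* x :+ z :* y) :- z :* y :- x) refl ζ T Φ ⟩
    (ζ * T + ζ * Φ) - ζ * Φ - T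
      ≈⟨ +-congʳ (+-cong (+-cong (*-distribˡ-sum {p} ζ _) (*-distribˡ-sum {p} ζ (λ j → ζ ^ toℕ j)))
                         (-‿cong (trans (*-congˡ ∑ζ^≈0) (zeroʳ ζ)))) ⟩
    (sum {p} (λ j → ζ * (ι (+ toℕ j) * ζ ^ toℕ j)) + sum {p} (λ j → ζ * ζ ^ toℕ j)) - 0# - T
      ≈⟨ +-congʳ (+-congʳ (∑-distrib-+ {p} (λ j → ζ * (ι (+ toℕ j) * ζ ^ toℕ j)) (λ j → ζ * ζ ^ toℕ j))) ⟨
    sum {p} (λ j → ζ * (ι (+ toℕ j) * ζ ^ toℕ j) + ζ * ζ ^ toℕ j) - 0# - T
      ≈⟨ +-congʳ (+-congʳ (sum-cong-≋ {p} λ j → term (toℕ j))) ⟩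
    sum {p} (λ j → f (suc (toℕ j))) - 0# - T
      ≈⟨ solve 3 (λ s x t → s :- con (+ 0) :- t := (con (+ 0) :* con (+ 1) :+ s) :- t) refl _ ζ T ⟩
    (f 0 + sum {p} (λ j → f (suc (toℕ j)))) - T
      ≈⟨ +-congʳ (sum-snoc p f) ⟩
    (T + f p) - T
      ≈⟨ solve 2 (λ t x → (t :+ x) :- t := x) refl T (f p) ⟩
    f p
      ≈⟨ trans (*-congˡ ζ^p≈1) (*-identityʳ _) ⟩
    ι (+ p) ∎
    where
    Φ = sum {p} (λ j → ζ ^ toℕ j)
    f : ℕ → Carrier
    f j = ι (+ j) * ζ ^ j
    term : ∀ j → ζ * (ι (+ j) * ζ ^ j) + ζ * ζ ^ j ≈ f (suc j)
    term j = begin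
      ζ * (ι (+ j) * ζ ^ j) + ζ * ζ ^ j
        ≈⟨ solve 3 (λ z n w → z :* (n :* w) :+ z :* w := (con (+ 1) :+ n) :* (z :* w)) refl ζ (ι (+ j)) (ζ ^ j) ⟩
      (1# + ι (+ j)) * (ζ * ζ ^ j)
        ≈⟨ *-congʳ (ι-homo-+ (+ 1) (+ j)) ⟨
      f (suc j) ∎

  -- Formal integer combinations of powers

  -- A list of pairs (w , u) stands for the element Σ w x^u of ℤ[x, x⁻¹].

  ev : (ℤ → Carrier) → List (ℤ × ℤ) → Carrier
  ev φ []            = 0#
  ev φ ((w , u) ∷ l) = ι w * φ u + ev φ l

  ev-++ : ∀ φ l l′ → ev φ (l ++ l′) ≈ ev φ l + ev φ l′
  ev-++ φ []            l′ = sym (+-identityˡ _)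
  ev-++ φ ((w , u) ∷ l) l′ = trans (+-congˡ (ev-++ φ l l′)) (sym (+-assoc _ _ _))

  ev-tabulate : ∀ φ {n} (f : Fin n → ℤ × ℤ) →
                ev φ (List.tabulate f) ≈ sum λ i → ι (proj₁ (f i)) * φ (proj₂ (f i))
  ev-tabulate φ {zero}  f = refl
  ev-tabulate φ {suc n} f = +-congˡ (ev-tabulate φ (f ∘ Fin.suc))

  Multiplicative : (ℤ → Carrier) → Set ℓ
  Multiplicative φ = ∀ u v → φ (u ℤ.+ v) ≈ φ u * φ v

  scale : ℤ × ℤ → List (ℤ × ℤ) → List (ℤ × ℤ)
  scale (w , u) = List.map λ (w′ , u′) → w ℤ.* w′ , u ℤ.+ u′

  ev-scale : ∀ {φ} → Multiplicative φ → ∀ w u l → ev φ (scale (w , u) l) ≈ (ι w * φ u) * ev φ l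
  ev-scale φ-+ w u []              = sym (zeroʳ _)
  ev-scale {φ} φ-+ w u ((w′ , u′) ∷ l) = begin
    ι (w ℤ.* w′) * φ (u ℤ.+ u′) + ev φ (scale (w , u) l)
      ≈⟨ +-cong (*-cong (ι-homo-* w w′) (φ-+ u u′)) (ev-scale φ-+ w u l) ⟩
    (ι w * ι w′) * (φ u * φ u′) + (ι w * φ u) * ev φ l
      ≈⟨ solve 5 (λ a b c d e → (a :* b) :* (c :* d) :+ (a :* c) :* e := (a :* c) :* (b :* d :+ e)) refl _ _ _ _ _ ⟩
    (ι w * φ u) * (ι w′ * φ u′ + ev φ l) ∎

  _⊗_ : List (ℤ × ℤ) → List (ℤ × ℤ) → List (ℤ × ℤ)
  []      ⊗ l′ = []
  (t ∷ l) ⊗ l′ = scale t l′ ++ (l ⊗ l′)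

  ev-⊗ : ∀ {φ} → Multiplicative φ → ∀ l l′ → ev φ (l ⊗ l′) ≈ ev φ l * ev φ l′
  ev-⊗ φ-+ []            l′ = sym (zeroˡ _)
  ev-⊗ {φ} φ-+ ((w , u) ∷ l) l′ = begin
    ev φ (scale (w , u) l′ ++ (l ⊗ l′))             ≈⟨ ev-++ φ (scale (w , u) l′) (l ⊗ l′) ⟩
    ev φ (scale (w , u) l′) + ev φ (l ⊗ l′)         ≈⟨ +-cong (ev-scale φ-+ w u l′) (ev-⊗ φ-+ l l′) ⟩
    (ι w * φ u) * ev φ l′ + ev φ l * ev φ l′        ≈⟨ distribʳ _ _ _ ⟨
    (ι w * φ u + ev φ l) * ev φ l′                  ∎

  -- The subring ℤ[ζ] and coefficients modulo x^p - 1

  ∈ℤ[ζ] : Carrier → Set ℓ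
  ∈ℤ[ζ] x = ∃[ l ] x ≈ ev e l

  ∈-resp : ∀ {x y} → x ≈ y → ∈ℤ[ζ] x → ∈ℤ[ζ] y
  ∈-resp x≈y (l , x≈l) = l , trans (sym x≈y) x≈l

  ∈-+ : ∀ {x y} → ∈ℤ[ζ] x → ∈ℤ[ζ] y → ∈ℤ[ζ] (x + y)
  ∈-+ (l , x≈l) (l′ , y≈l′) = l ++ l′ , trans (+-cong x≈l y≈l′) (sym (ev-++ e l l′))

  ∈-* : ∀ {x y} → ∈ℤ[ζ] x → ∈ℤ[ζ] y → ∈ℤ[ζ] (x * y)
  ∈-* (l , x≈l) (l′ , y≈l′) = l ⊗ l′ , trans (*-cong x≈l y≈l′) (sym (ev-⊗ e-+ l l′))

  ∈-monomial : ∀ w u → ∈ℤ[ζ] (ι w * e u)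
  ∈-monomial w u = (w , u) ∷ [] , sym (+-identityʳ _)

  ∈-ι : ∀ w → ∈ℤ[ζ] (ι w)
  ∈-ι w = ∈-resp (trans (*-congˡ e-0) (*-identityʳ _)) (∈-monomial w (+ 0))

  ∈-neg : ∀ {x} → ∈ℤ[ζ] x → ∈ℤ[ζ] (- x)
  ∈-neg {x} x∈ = ∈-resp (solve 1 (λ x → con (ℤ.- + 1) :* x := :- x) refl x) (∈-* (∈-ι (ℤ.- + 1)) x∈)

  ∈-^ : ∀ {x} → ∈ℤ[ζ] x → ∀ n → ∈ℤ[ζ] (x ^ n)
  ∈-^ x∈ zero    = ∈-ι (+ 1)
  ∈-^ x∈ (suc n) = ∈-* x∈ (∈-^ x∈ n)

  ∈-ζ : ∈ℤ[ζ] ζ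
  ∈-ζ = ∈-resp (trans (*-identityˡ _) e-1) (∈-monomial (+ 1) (+ 1))

  ∈-sum : ∀ {n} (f : Fin n → Carrier) → (∀ i → ∈ℤ[ζ] (f i)) → ∈ℤ[ζ] (sum f)
  ∈-sum {zero}  f f∈ = ∈-ι (+ 0)
  ∈-sum {suc n} f f∈ = ∈-+ (f∈ Fin.zero) (∈-sum (f ∘ Fin.suc) (f∈ ∘ Fin.suc))

  ∈-π : ∈ℤ[ζ] π
  ∈-π = ∈-+ ∈-ζ (∈-neg (∈-ι (+ 1)))

  -- Exponents are reduced modulo p: these are coefficients in ℤ[x]/(x^p - 1), where they are well
  -- defined, whereas in ℤ[ζ] they are determined only up to a common constant.
  termCoef : ℕ → ℤ × ℤ → ℤ
  termCoef j (w , u) with u %ℕ p ℕ.≟ j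
  ... | yes _ = w
  ... | no  _ = + 0

  coef : ℕ → List (ℤ × ℤ) → ℤ
  coef j []      = + 0
  coef j (t ∷ l) = termCoef j t ℤ.+ coef j l

  termCoef-≡ : ∀ w {u j} → u %ℕ p ≡ j → termCoef j (w , u) ≡ w
  termCoef-≡ w {u} {j} eq with u %ℕ p ℕ.≟ j
  ... | yes _ = ≡.refl
  ... | no neq = contradiction eq neq

  termCoef-≢ : ∀ w {u j} → u %ℕ p ≢ j → termCoef j (w , u) ≡ + 0
  termCoef-≢ w {u} {j} neq with u %ℕ p ℕ.≟ j
  ... | yes eq = contradiction eq neq
  ... | no _ = ≡.refl

  -- The function φ is left general because three choices occur: `e` itself, its conjugates u ↦ e (c
  -- u), and the constant 1, which yields the sum of the coefficients.
  ev-coef : ∀ {φ} → (∀ {u v} → u ≅ v → φ u ≈ φ v) → ∀ l →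
            ev φ l ≈ sum {p} λ j → ι (coef (toℕ j) l) * φ (+ toℕ j)
  ev-coef φ-cong []            = sym (sum-ε {p} _ λ j → zeroˡ _)
  ev-coef {φ} φ-cong ((w , u) ∷ l) = begin
    ι w * φ u + ev φ l
      ≈⟨ +-cong monomial (ev-coef φ-cong l) ⟩
    sum {p} (λ j → ι (termCoef (toℕ j) (w , u)) * φ (+ toℕ j)) + sum {p} (λ j → ι (coef (toℕ j) l) * φ (+ toℕ j))
      ≈⟨ ∑-distrib-+ {p} _ _ ⟨
    sum {p} (λ j → ι (termCoef (toℕ j) (w , u)) * φ (+ toℕ j) + ι (coef (toℕ j) l) * φ (+ toℕ j))
      ≈⟨ sum-cong-≋ {p} (λ j → trans (sym (distribʳ _ _ _)) (*-congʳ (sym (ι-homo-+ (termCoef (toℕ j) (w , u)) (coef (toℕ j) l))))) ⟩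
    sum {p} (λ j → ι (coef (toℕ j) ((w , u) ∷ l)) * φ (+ toℕ j)) ∎
    where
    r : Fin p
    r = Fin.fromℕ< (ℤ.n%ℕd<d u p)
    toℕ-r : toℕ r ≡ u %ℕ p
    toℕ-r = Fin.toℕ-fromℕ< _
    monomial : ι w * φ u ≈ sum {p} (λ j → ι (termCoef (toℕ j) (w , u)) * φ (+ toℕ j))
    monomial = sym (begin
      sum {p} (λ j → ι (termCoef (toℕ j) (w , u)) * φ (+ toℕ j))
        ≈⟨ sum-only {p} _ r (λ j j≢r → trans (*-congʳ (ι-cong (termCoef-≢ w {u} λ eq →
             j≢r (Fin.toℕ-injective (≡.trans (≡.sym eq) (≡.sym toℕ-r)))))) (zeroˡ _)) ⟩
      ι (termCoef (toℕ r) (w , u)) * φ (+ toℕ r)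
        ≈⟨ *-cong (ι-cong (termCoef-≡ w {u} (≡.sym toℕ-r))) (φ-cong (≡.subst (λ k → + k ≅ u) (≡.sym toℕ-r) (%-≅ u))) ⟩
      ι w * φ u ∎)

  -- p and ζ - 1 are not units of ℤ[ζ]

  -- If p y = 1, then each ζ^i = p (ζ^i y) is p times an integer combination of the powers of ζ.
  -- Nakayama with unit diagonal makes all ζ^i vanish, yet they are invertible.
  p-nonunit : ∀ {y} → ∈ℤ[ζ] y → ¬ ι (+ p) * y ≈ 1#
  p-nonunit {y} (l , y≈l) py≈1 = e≉0 (+ toℕ r) (v≈0 r)
    where
    r : Fin p
    r = Fin.fromℕ< (ℕ.<-trans (ℕ.s≤s ℕ.z≤n) 1<p)
    v : Fin p → Carrier
    v i = e (+ toℕ i)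
    E : Fin p → Fin p → ℤ
    E i j = coef (toℕ j) (scale (+ 1 , + toℕ i) l)
    v≈0 : ∀ i → v i ≈ 0#
    v≈0 = nakayama (λ _ → + 1) E v (λ _ → p∤1) λ i → begin
      1# * v i
        ≈⟨ *-congʳ py≈1 ⟨
      (ι (+ p) * y) * v i
        ≈⟨ solve 3 (λ p y v → (p :* y) :* v := p :* ((con (+ 1) :* v) :* y)) refl (ι (+ p)) y (v i) ⟩
      ι (+ p) * ((1# * v i) * y)
        ≈⟨ *-congˡ (trans (*-congˡ y≈l) (sym (ev-scale e-+ (+ 1) (+ toℕ i) l))) ⟩
      ι (+ p) * ev e (scale (+ 1 , + toℕ i) l)
        ≈⟨ *-congˡ (ev-coef e-cong (scale (+ 1 , + toℕ i) l)) ⟩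
      ι (+ p) * sum {p} (λ j → ι (E i j) * v j)
        ≈⟨ *-distribˡ-sum {p} (ι (+ p)) (λ j → ι (E i j) * v j) ⟩
      sum {p} (λ j → ι (+ p) * (ι (E i j) * v j))
        ≈⟨ sum-cong-≋ {p} (λ j → trans (sym (*-assoc _ _ _)) (*-congʳ (sym (ι-homo-* (+ p) (E i j))))) ⟩
      sum {p} (λ j → ι (+ p ℤ.* E i j) * v j) ∎

  -- Expand (π + 1)^p = ζ^p = 1 and subtract 1: all that remains besides π^p carries the factor p.
  π^p∈pℤ[ζ] : ∃[ w ] ∈ℤ[ζ] w × π ^ p ≈ ι (+ p) * w
  π^p∈pℤ[ζ] = isolate (Freshman.[x+y]^p commutativeRing p-prime)
    where
    rearrange : ∀ x y z → x + 1# + y * z ≈ 1# → x ≈ y * (- z)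
    rearrange x y z eq = begin
      x                           ≈⟨ solve 3 (λ x y z → x := (x :+ con (+ 1) :+ y :* z) :- con (+ 1) :+ y :* (:- z)) refl x y z ⟩
      (x + 1# + y * z) - 1# + y * (- z)   ≈⟨ +-congʳ (trans (+-congʳ eq) (-‿inverseʳ 1#)) ⟩
      0# + y * (- z)              ≈⟨ +-identityˡ _ ⟩
      y * (- z)                   ∎
    isolate : _ → ∃[ w ] ∈ℤ[ζ] w × π ^ p ≈ ι (+ p) * w
    isolate (n , c , k , l , expand) = - w , ∈-neg w∈ , rearrange (π ^ p) (ι (+ p)) w (begin
      π ^ p + 1# + ι (+ p) * w          ≈⟨ +-congʳ (+-congˡ (1^n≈1 p)) ⟨
      π ^ p + 1# ^ p + ι (+ p) * w      ≈⟨ expand π 1# ⟨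
      (π + 1#) ^ p                      ≈⟨ ^-congˡ p (solve 1 (λ z → z :- con (+ 1) :+ con (+ 1) := z) refl ζ) ⟩
      ζ ^ p                             ≈⟨ ζ^p≈1 ⟩
      1#                                ∎)
      where
      w : Carrier
      w = sum λ i → ι (c i) * (π ^ k i * 1# ^ l i)
      w∈ : ∈ℤ[ζ] w
      w∈ = ∈-sum _ λ i → ∈-* (∈-ι (c i)) (∈-* (∈-^ ∈-π (k i)) (∈-^ (∈-ι (+ 1)) (l i)))

  -- The p-th power of an inverse of π would produce an inverse of p, since p divides π^p.
  π-nonunit : ∀ {x} → ∈ℤ[ζ] x → ¬ π * x ≈ 1#
  π-nonunit {x} x∈ πx≈1 = contradict π^p∈pℤ[ζ]
    where
    contradict : ¬ (∃[ w ] ∈ℤ[ζ] w × π ^ p ≈ ι (+ p) * w)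
    contradict (w , w∈ , π^p≈pw) = p-nonunit (∈-* w∈ (∈-^ x∈ p)) (begin
      ι (+ p) * (w * x ^ p)     ≈⟨ *-assoc _ _ _ ⟨
      (ι (+ p) * w) * x ^ p     ≈⟨ *-congʳ π^p≈pw ⟨
      π ^ p * x ^ p             ≈⟨ ^-distrib-* π x p ⟨
      (π * x) ^ p               ≈⟨ ^-congˡ p πx≈1 ⟩
      1# ^ p                    ≈⟨ 1^n≈1 p ⟩
      1#                        ∎)

  T∈ : ∈ℤ[ζ] T
  T∈ = ∈-sum {p} _ λ j → ∈-* (∈-ι (+ toℕ j)) (∈-^ ∈-ζ (toℕ j))

  -- If p does not divide u, some integers give α u - β p = 1. Both u and p = π T are multiples of
  -- π, so π would be a unit.
  π∣⇒p∣ : ∀ {u x} → ∈ℤ[ζ] x → ι u ≈ π * x → p∣ u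
  π∣⇒p∣ {u} {x} x∈ ιu≈πx with + p ℤ∣.∣? u
  ... | yes p∣u = p∣u
  ... | no  p∤u with bezout u p∤u
  ... | α , congruent (divides β αu-1≡βp) = contradiction (begin
    π * (ι α * x + - (ι β * T))       ≈⟨ solve 5 (λ π a x b t → π :* (a :* x :+ :- (b :* t)) := a :* (π :* x) :- b :* (π :* t)) refl π (ι α) x (ι β) T ⟩
    ι α * (π * x) - ι β * (π * T)     ≈⟨ +-cong (*-congˡ (sym ιu≈πx)) (-‿cong (*-congˡ πT≈ιp)) ⟩
    ι α * ι u - ι β * ι (+ p)         ≈⟨ +-cong (ι-homo-* α u) (-‿cong (ι-homo-* β (+ p))) ⟨
    ι (α ℤ.* u) - ι (β ℤ.* + p)       ≈⟨ ι-homo-sub (α ℤ.* u) (β ℤ.* + p) ⟨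
    ι (α ℤ.* u ℤ.- β ℤ.* + p)         ≡⟨ ≡.cong (λ z → ι (α ℤ.* u ℤ.- z)) αu-1≡βp ⟨
    ι (α ℤ.* u ℤ.- (α ℤ.* u ℤ.- + 1)) ≡⟨ ≡.cong ι (lemma (α ℤ.* u)) ⟩
    1#                                ∎)
    (π-nonunit (∈-+ (∈-* (∈-ι α) x∈) (∈-neg (∈-* (∈-ι β) T∈))))
    where
    lemma : ∀ z → z ℤ.- (z ℤ.- + 1) ≡ + 1
    lemma = solve-∀

  -- Linear relations between the powers of ζ

  -- The p coefficients are continued periodically to all of ℕ, so that shifts and differences need
  -- no wrap-around.
  record Relation (a : ℕ → ℤ) : Set ℓ where
    constructor relation
    field
      periodic : ∀ j → a (j ℕ.+ p) ≡ a j
      vanishes : sum {p} (λ j → ι (a (toℕ j)) * ζ ^ toℕ j) ≈ 0#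

  open Relation

  -- Multiplying by the unit ζ turns the shifted sum into the original one with its summands
  -- cyclically permuted.
  relation-shift : ∀ {a} → Relation a → Relation (a ∘ suc)
  relation-shift {a} rel .periodic j = periodic rel (suc j)
  relation-shift {a} rel .vanishes = cancel ζ≉0 (begin
    ζ * sum {p} (λ j → ι (a (suc (toℕ j))) * ζ ^ toℕ j)
      ≈⟨ *-distribˡ-sum {p} ζ (λ j → ι (a (suc (toℕ j))) * ζ ^ toℕ j) ⟩
    sum {p} (λ j → ζ * (ι (a (suc (toℕ j))) * ζ ^ toℕ j))
      ≈⟨ sum-cong-≋ {p} (λ j → solve 3 (λ z a w → z :* (a :* w) := a :* (z :* w)) refl ζ (ι (a (suc (toℕ j)))) (ζ ^ toℕ j)) ⟩
    sum {p} (f ∘ suc ∘ toℕ)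
      ≈⟨ sum-shift f (*-cong (ι-cong (periodic rel 0)) ζ^p≈1) ⟩
    sum {p} (f ∘ toℕ)
      ≈⟨ vanishes rel ⟩
    0# ∎)
    where
    f : ℕ → Carrier
    f j = ι (a j) * ζ ^ j
    ζ≉0 : ¬ ζ ≈ 0#
    ζ≉0 ζ≈0 = e≉0 (+ 1) (trans e-1 ζ≈0)

  relation-Δ : ∀ {a} → Relation a → Relation (Δ a)
  relation-Δ {a} rel .periodic j = ≡.cong₂ ℤ._-_ (periodic rel (suc j)) (periodic rel j)
  relation-Δ {a} rel .vanishes = begin
    sum {p} (λ j → ι (Δ a (toℕ j)) * ζ ^ toℕ j)
      ≈⟨ solve 2 (λ s t → s := (s :+ t) :- t) refl _ S ⟩
    (sum {p} (λ j → ι (Δ a (toℕ j)) * ζ ^ toℕ j) + S) - S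
      ≈⟨ +-congʳ (∑-distrib-+ {p} (λ j → ι (Δ a (toℕ j)) * ζ ^ toℕ j) _) ⟨
    sum {p} (λ j → ι (Δ a (toℕ j)) * ζ ^ toℕ j + ι (a (toℕ j)) * ζ ^ toℕ j) - S
      ≈⟨ +-cong (sum-cong-≋ {p} (λ j → trans (sym (distribʳ _ _ _)) (*-congʳ (undo (toℕ j))))) (-‿cong (vanishes rel)) ⟩
    sum {p} (λ j → ι (a (suc (toℕ j))) * ζ ^ toℕ j) - 0#
      ≈⟨ +-congʳ (vanishes (relation-shift rel)) ⟩
    0# - 0#
      ≈⟨ -‿inverseʳ 0# ⟩
    0# ∎
    where
    S = sum {p} (λ j → ι (a (toℕ j)) * ζ ^ toℕ j)
    lemma : ∀ x y → (x ℤ.- y) ℤ.+ y ≡ x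
    lemma = solve-∀
    undo : ∀ j → ι (Δ a j) + ι (a j) ≈ ι (a (suc j))
    undo j = trans (sym (ι-homo-+ (Δ a j) (a j))) (ι-cong (lemma (a (suc j)) (a j)))

  ∑-combination : ∀ (c : ℤ) (f g : ℕ → ℤ) →
    sum {p} (λ j → ι (f (toℕ j) ℤ.+ c ℤ.* g (toℕ j)) * ζ ^ toℕ j) ≈
    sum {p} (λ j → ι (f (toℕ j)) * ζ ^ toℕ j) + ι c * sum {p} (λ j → ι (g (toℕ j)) * ζ ^ toℕ j)
  ∑-combination c f g = begin
    sum {p} (λ j → ι (f (toℕ j) ℤ.+ c ℤ.* g (toℕ j)) * ζ ^ toℕ j)
      ≈⟨ sum-cong-≋ {p} (λ j → term (toℕ j)) ⟩
    sum {p} (λ j → ι (f (toℕ j)) * ζ ^ toℕ j + ι c * (ι (g (toℕ j)) * ζ ^ toℕ j))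
      ≈⟨ ∑-distrib-+ {p} _ _ ⟩
    sum {p} (λ j → ι (f (toℕ j)) * ζ ^ toℕ j) + sum {p} (λ j → ι c * (ι (g (toℕ j)) * ζ ^ toℕ j))
      ≈⟨ +-congˡ (*-distribˡ-sum {p} (ι c) (λ j → ι (g (toℕ j)) * ζ ^ toℕ j)) ⟨
    sum {p} (λ j → ι (f (toℕ j)) * ζ ^ toℕ j) + ι c * sum {p} (λ j → ι (g (toℕ j)) * ζ ^ toℕ j) ∎
    where
    term : ∀ j → ι (f j ℤ.+ c ℤ.* g j) * ζ ^ j ≈ ι (f j) * ζ ^ j + ι c * (ι (g j) * ζ ^ j)
    term j = begin
      ι (f j ℤ.+ c ℤ.* g j) * ζ ^ j           ≈⟨ *-congʳ (trans (ι-homo-+ (f j) (c ℤ.* g j)) (+-congˡ (ι-homo-* c (g j)))) ⟩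
      (ι (f j) + ι c * ι (g j)) * ζ ^ j       ≈⟨ solve 4 (λ f c g z → (f :+ c :* g) :* z := f :* z :+ c :* (g :* z)) refl _ _ _ _ ⟩
      ι (f j) * ζ ^ j + ι c * (ι (g j) * ζ ^ j) ∎

  -- Modulo p such a sequence is affine, say g₀ + j u.  Since Σ ζ^j = 0 and
  -- π Σ j ζ^j = p, the vanishing of Σ g_j ζ^j forces π to divide u.
  Δ²≅0⇒Δ≅0 : ∀ {g} → Relation g → (∀ j → p∣ Δ (Δ g) j) → ∀ j → p∣ Δ g j
  Δ²≅0⇒Δ≅0 {g} rel p∣Δ² j = p∣-resp-≅ (≅-sym (Δg≅u j)) p∣u
    where
    u : ℤ
    u = Δ g 0
    Δg≅u : ∀ j → Δ g j ≅ u
    Δg≅u zero    = ≡⇒≅ ≡.refl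
    Δg≅u (suc j) = ≅-trans (congruent (p∣Δ² j)) (Δg≅u j)
    affine : ∀ j → g j ≅ g 0 ℤ.+ u ℤ.* + j
    affine zero    = ≡⇒≅ (lemma (g 0) u)
      where lemma : ∀ x u → x ≡ x ℤ.+ u ℤ.* + 0
            lemma = solve-∀
    affine (suc j) = ≅-trans (≡⇒≅ (lemma₁ (g (suc j)) (g j)))
      (≅-trans (≅-+ (Δg≅u j) (affine j)) (≡⇒≅ (lemma₂ (g 0) u (+ j))))
      where lemma₁ : ∀ x y → x ≡ (x ℤ.- y) ℤ.+ y
            lemma₁ = solve-∀
            lemma₂ : ∀ x u j → u ℤ.+ (x ℤ.+ u ℤ.* j) ≡ x ℤ.+ u ℤ.* (+ 1 ℤ.+ j)
            lemma₂ = solve-∀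
    h : ℕ → ℤ
    h j = ℤ∣.quotient (difference (affine j))
    g≡ : ∀ j → g j ≡ (g 0 ℤ.+ u ℤ.* + j) ℤ.+ + p ℤ.* h j
    g≡ j = ≡.trans (lemma (g j) (g 0 ℤ.+ u ℤ.* + j))
             (≡.cong (λ z → (g 0 ℤ.+ u ℤ.* + j) ℤ.+ z)
               (≡.trans (ℤ∣._∣_.equality (difference (affine j))) (ℤ.*-comm (h j) (+ p))))
      where lemma : ∀ x y → x ≡ y ℤ.+ (x ℤ.- y)
            lemma = solve-∀
    H : Carrier
    H = sum {p} λ j → ι (h (toℕ j)) * ζ ^ toℕ j
    uT+pH≈0 : ι u * T + ι (+ p) * H ≈ 0#
    uT+pH≈0 = begin
      ι u * T + ι (+ p) * H
        ≈⟨ +-congʳ (trans (+-congʳ (trans (sym (*-distribˡ-sum {p} (ι (g 0)) (λ j → ζ ^ toℕ j))) (trans (*-congˡ ∑ζ^≈0) (zeroʳ _)))) (+-identityˡ _)) ⟨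
      (sum {p} (λ j → ι (g 0) * ζ ^ toℕ j) + ι u * T) + ι (+ p) * H
        ≈⟨ +-congʳ (∑-combination u (λ _ → g 0) (+_)) ⟨
      sum {p} (λ j → ι (g 0 ℤ.+ u ℤ.* + toℕ j) * ζ ^ toℕ j) + ι (+ p) * H
        ≈⟨ ∑-combination (+ p) (λ j → g 0 ℤ.+ u ℤ.* + j) h ⟨
      sum {p} (λ j → ι ((g 0 ℤ.+ u ℤ.* + toℕ j) ℤ.+ + p ℤ.* h (toℕ j)) * ζ ^ toℕ j)
        ≈⟨ sum-cong-≋ {p} (λ j → *-congʳ (ι-cong (≡.sym (g≡ (toℕ j))))) ⟩
      sum {p} (λ j → ι (g (toℕ j)) * ζ ^ toℕ j)
        ≈⟨ vanishes rel ⟩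
      0# ∎
    -- Multiplying by π trades T for p. Then p occurs in both terms and can be cancelled, which
    -- leaves u = -π H.
    p[u+πH]≈0 : ι (+ p) * (ι u + π * H) ≈ 0#
    p[u+πH]≈0 = begin
      ι (+ p) * (ι u + π * H)                     ≈⟨ distribˡ _ _ _ ⟩
      ι (+ p) * ι u + ι (+ p) * (π * H)           ≈⟨ +-congʳ (*-congʳ πT≈ιp) ⟨
      (π * T) * ι u + ι (+ p) * (π * H)           ≈⟨ solve 5 (λ π t u p h → (π :* t) :* u :+ p :* (π :* h) := π :* (u :* t :+ p :* h)) refl π T (ι u) (ι (+ p)) H ⟩
      π * (ι u * T + ι (+ p) * H)                 ≈⟨ *-congˡ uT+pH≈0 ⟩
      π * 0#                                      ≈⟨ zeroʳ π ⟩
      0#                                          ∎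
    p∣u : p∣ u
    p∣u = π∣⇒p∣ (∈-neg (∈-sum {p} _ λ j → ∈-* (∈-ι (h (toℕ j))) (∈-^ ∈-ζ (toℕ j)))) (begin
      ι u                             ≈⟨ solve 3 (λ u π h → u := (u :+ π :* h) :+ π :* (:- h)) refl (ι u) π H ⟩
      (ι u + π * H) + π * (- H)       ≈⟨ +-congʳ (cancel ιp≉0 p[u+πH]≈0) ⟩
      0# + π * (- H)                  ≈⟨ +-identityˡ _ ⟩
      π * (- H)                       ∎)

  -- The induction hypothesis for the relation `Δ a` gives second differences divisible by p, and
  -- `Δ²≅0⇒Δ≅0` removes one more order.
  p∣Δ^⇒p∣Δ : ∀ k {a} → Relation a → (∀ j → p∣ Δ^ (suc k) a j) → ∀ j → p∣ Δ a j
  p∣Δ^⇒p∣Δ zero    rel p∣Δ^ = p∣Δ^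
  p∣Δ^⇒p∣Δ (suc k) rel p∣Δ^ = Δ²≅0⇒Δ≅0 rel (p∣Δ^⇒p∣Δ k (relation-Δ rel) p∣Δ^)

  -- Periodicity makes the p-th differences vanish modulo p, which is where the descent to first
  -- differences starts.
  relation-mod-p : ∀ {a} → Relation a → ∀ j → a j ≅ a 0
  relation-mod-p {a} rel = constant
    where
    p∣Δ : ∀ j → p∣ Δ a j
    p∣Δ = p∣Δ^⇒p∣Δ (ℕ.pred p) rel λ j → ≡.subst (λ k → p∣ Δ^ k a j) (≡.sym (ℕ.suc-pred p))
                                          (Δ^p-divisible p-prime a (periodic rel) j)
    constant : ∀ j → a j ≅ a 0
    constant zero    = ≡⇒≅ ≡.refl
    constant (suc j) = ≅-trans (congruent (p∣Δ j)) (constant j)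

  -- The constant part a 0 contributes nothing because Σ ζ^j = 0; the rest is p times a sum, and p
  -- can be cancelled. Iterating this yields the congruences modulo every power of p.
  relation-quotient : ∀ {a} → Relation a → ∃[ b ] Relation b × (∀ j → a j ≡ a 0 ℤ.+ + p ℤ.* b j)
  relation-quotient {a} rel = b , relation b-periodic b-vanishes , b≡
    where
    b : ℕ → ℤ
    b j = ℤ∣.quotient (difference (relation-mod-p rel j))
    b≡ : ∀ j → a j ≡ a 0 ℤ.+ + p ℤ.* b j
    b≡ j = ≡.trans (lemma (a j) (a 0))
             (≡.cong (λ z → a 0 ℤ.+ z)
               (≡.trans (ℤ∣._∣_.equality (difference (relation-mod-p rel j))) (ℤ.*-comm (b j) (+ p))))
      where lemma : ∀ x y → x ≡ y ℤ.+ (x ℤ.- y)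
            lemma = solve-∀
    b-periodic : ∀ j → b (j ℕ.+ p) ≡ b j
    b-periodic j = ℤ.*-cancelˡ-≡ (+ p) _ _
      (∙-cancelˡ (a 0) _ _ (≡.trans (≡.sym (b≡ (j ℕ.+ p))) (≡.trans (periodic rel j) (b≡ j))))
      where open Algebra.Properties.Group (CommutativeRing.+-group ℤ.+-*-commutativeRing) using (∙-cancelˡ)
    S : Carrier
    S = sum {p} (λ j → ι (b (toℕ j)) * ζ ^ toℕ j)
    b-vanishes : S ≈ 0#
    b-vanishes = cancel ιp≉0 (begin
      ι (+ p) * S
        ≈⟨ +-identityˡ _ ⟨
      0# + ι (+ p) * S
        ≈⟨ +-congʳ (trans (sym (*-distribˡ-sum {p} (ι (a 0)) (λ j → ζ ^ toℕ j))) (trans (*-congˡ ∑ζ^≈0) (zeroʳ _))) ⟨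
      sum {p} (λ j → ι (a 0) * ζ ^ toℕ j) + ι (+ p) * S
        ≈⟨ ∑-combination (+ p) (λ _ → a 0) b ⟨
      sum {p} (λ j → ι (a 0 ℤ.+ + p ℤ.* b (toℕ j)) * ζ ^ toℕ j)
        ≈⟨ sum-cong-≋ {p} (λ j → *-congʳ (ι-cong (≡.sym (b≡ (toℕ j))))) ⟩
      sum {p} (λ j → ι (a (toℕ j)) * ζ ^ toℕ j)
        ≈⟨ vanishes rel ⟩
      0# ∎)

  relation-mod-p^ : ∀ k {a} → Relation a → ∀ j → + (p ℕ.^ k) ℤ∣.∣ a j ℤ.- a 0
  relation-mod-p^ zero    {a} rel j = divides (a j ℤ.- a 0) (≡.sym (ℤ.*-identityʳ _))
  relation-mod-p^ (suc k) {a} rel j with relation-quotient rel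
  ... | b , rel′ , b≡ with relation-mod-p^ k rel′ j
  ... | divides q eq = divides q (≡.trans (≡.cong₂ ℤ._-_ (b≡ j) (b≡ 0)) (≡.trans (lemma₁ (a 0) (+ p) (b j) (b 0))
          (≡.trans (≡.cong (+ p ℤ.*_) eq) (≡.trans (lemma₂ (+ p) q (+ (p ℕ.^ k)))
            (≡.cong (q ℤ.*_) (≡.sym (ℤ.pos-* p (p ℕ.^ k))))))))
    where
    lemma₁ : ∀ a p x y → (a ℤ.+ p ℤ.* x) ℤ.- (a ℤ.+ p ℤ.* y) ≡ p ℤ.* (x ℤ.- y)
    lemma₁ = solve-∀
    lemma₂ : ∀ p q k → p ℤ.* (q ℤ.* k) ≡ q ℤ.* (p ℤ.* k)
    lemma₂ = solve-∀

  relation-constant : ∀ {a} → Relation a → ∀ j → a j ≡ a 0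
  relation-constant {a} rel j = ℤ.i-j≡0⇒i≡j (a j) (a 0) (p^-divisible⇒≡0 _ λ k → relation-mod-p^ k rel j)

  -- Replacing ζ by ζ^c in a relation

  coef-constant : ∀ l → ev e l ≈ 0# → ∀ {j} → j ℕ.< p → coef j l ≡ coef 0 l
  coef-constant l l≈0 {j} j<p = ≡.trans (≡.cong (λ k → coef k l) (≡.sym (ℕ.m<n⇒m%n≡m j<p)))
    (≡.trans (relation-constant (relation b-periodic b-vanishes) j)
      (≡.cong (λ k → coef k l) (ℕ.m<n⇒m%n≡m (ℕ.<-trans (ℕ.s≤s ℕ.z≤n) 1<p))))
    where
    -- `coef` is 0 at indices from p on, so the index is reduced modulo p to obtain a periodic
    -- sequence.
    b : ℕ → ℤ
    b j = coef (j ℕ.% p) l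
    b-periodic : ∀ j → b (j ℕ.+ p) ≡ b j
    b-periodic j = ≡.cong (λ k → coef k l) (ℕ.[m+n]%n≡m%n j p)
    b-vanishes : sum {p} (λ j → ι (b (toℕ j)) * ζ ^ toℕ j) ≈ 0#
    b-vanishes = begin
      sum {p} (λ j → ι (b (toℕ j)) * ζ ^ toℕ j)
        ≈⟨ sum-cong-≋ {p} (λ j → *-cong (ι-cong (≡.cong (λ k → coef k l) (ℕ.m<n⇒m%n≡m (Fin.toℕ<n j)))) (sym (e-ℕ (toℕ j)))) ⟩
      sum {p} (λ j → ι (coef (toℕ j) l) * e (+ toℕ j))
        ≈⟨ ev-coef e-cong l ⟨
      ev e l
        ≈⟨ l≈0 ⟩
      0# ∎

  ∑e[c*]≈0 : ∀ {c} → ¬ p∣ c → sum {p} (λ j → e (c ℤ.* + toℕ j)) ≈ 0#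
  ∑e[c*]≈0 {c} p∤c = cancel ec-1≉0 (begin
    (e c - 1#) * S
      ≈⟨ solve 2 (λ x s → (x :- con (+ 1)) :* s := x :* s :- s) refl (e c) S ⟩
    e c * S - S
      ≈⟨ +-congʳ (trans (*-distribˡ-sum {p} (e c) (λ j → e (c ℤ.* + toℕ j)))
           (sum-cong-≋ {p} λ j → trans (sym (e-+ c (c ℤ.* + toℕ j))) (reflexive (≡.cong e (lemma c (+ toℕ j)))))) ⟩
    sum {p} (λ j → e (c ℤ.* + suc (toℕ j))) - S
      ≈⟨ +-congʳ (sum-shift (λ j → e (c ℤ.* + j)) (e-cong (≅-*ˡ c (p∣⇒≅0 (divides (+ 1) (≡.sym (ℤ.*-identityˡ (+ p)))))))) ⟩
    S - S
      ≈⟨ -‿inverseʳ S ⟩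
    0# ∎)
    where
    S : Carrier
    S = sum {p} (λ j → e (c ℤ.* + toℕ j))
    lemma : ∀ c j → c ℤ.+ c ℤ.* j ≡ c ℤ.* (+ 1 ℤ.+ j)
    lemma = solve-∀
    ec-1≉0 : ¬ e c - 1# ≈ 0#
    ec-1≉0 ec-1≈0 = p∤c (e≈1⇒p∣ (begin
      e c                     ≈⟨ solve 1 (λ x → x := (x :- con (+ 1)) :+ con (+ 1)) refl (e c) ⟩
      (e c - 1#) + 1#         ≈⟨ +-congʳ ec-1≈0 ⟩
      0# + 1#                 ≈⟨ +-identityˡ 1# ⟩
      1#                      ∎))

  -- A vanishing combination has equal coefficients modulo x^p - 1, so it is a multiple of Σ ζ^j.
  -- Its conjugate is the same multiple of Σ ζ^(c j), which vanishes as well.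
  galois : ∀ {c} → ¬ p∣ c → ∀ l → ev e l ≈ 0# → ev (λ u → e (c ℤ.* u)) l ≈ 0#
  galois {c} p∤c l l≈0 = begin
    ev (λ u → e (c ℤ.* u)) l
      ≈⟨ ev-coef (λ u≅v → e-cong (≅-*ˡ c u≅v)) l ⟩
    sum {p} (λ j → ι (coef (toℕ j) l) * e (c ℤ.* + toℕ j))
      ≈⟨ sum-cong-≋ {p} (λ j → *-congʳ (ι-cong (coef-constant l l≈0 (Fin.toℕ<n j)))) ⟩
    sum {p} (λ j → ι (coef 0 l) * e (c ℤ.* + toℕ j))
      ≈⟨ *-distribˡ-sum {p} (ι (coef 0 l)) (λ j → e (c ℤ.* + toℕ j)) ⟨
    ι (coef 0 l) * sum {p} (λ j → e (c ℤ.* + toℕ j))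
      ≈⟨ trans (*-congˡ (∑e[c*]≈0 p∤c)) (zeroʳ _) ⟩
    0# ∎

-- Sums over the elements of a finite field

module FiniteSums {q a ℓ} (K : FiniteField q a ℓ) {c ℓ′} (M : CommutativeMonoid c ℓ′) where
  open FiniteField K using (Carrier; _≈_; element; enumeration; sym; trans)
  private module M = CommutativeMonoid M
  open Algebra.Properties.CommutativeMonoid.Sum M

  index : Carrier → Fin q
  index = Inverse.from enumeration

  element-index : ∀ x → element (index x) ≈ x
  element-index = Inverse.strictlyInverseˡ enumeration

  index-cong : ∀ {x y} → x ≈ y → index x ≡ index y
  index-cong = Inverse.from-cong enumeration

  index-element : ∀ i → index (element i) ≡ i
  index-element = Inverse.strictlyInverseʳ enumeration

  reindex : ∀ {g g⁻¹ : Carrier → Carrier} →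
            (∀ {x y} → x ≈ y → g x ≈ g y) → (∀ {x y} → x ≈ y → g⁻¹ x ≈ g⁻¹ y) →
            (∀ x → g (g⁻¹ x) ≈ x) → (∀ x → g⁻¹ (g x) ≈ x) →
            ∀ (f : Carrier → M.Carrier) → (∀ {x y} → x ≈ y → f x M.≈ f y) →
            sum (f ∘ element) M.≈ sum (f ∘ g ∘ element)
  reindex {g} {g⁻¹} g-cong g⁻¹-cong gg⁻¹ g⁻¹g f f-cong =
    M.trans (sum-permute (f ∘ element)
              (permutation (index ∘ g ∘ element) (index ∘ g⁻¹ ∘ element)
                (λ i → ≡.trans (index-cong (trans (g-cong (element-index _)) (gg⁻¹ _))) (index-element i))
                (λ i → ≡.trans (index-cong (trans (g⁻¹-cong (element-index _)) (g⁻¹g _))) (index-element i))))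
            (sum-cong-≋ λ i → f-cong (element-index (g (element i))))

  sum-only-element : ∀ (f : Carrier → M.Carrier) → (∀ {x y} → x ≈ y → f x M.≈ f y) →
                     ∀ x → (∀ y → ¬ y ≈ x → f y M.≈ M.ε) → sum (f ∘ element) M.≈ f x
  sum-only-element f f-cong x others =
    M.trans (MonoidSums.sum-only M (f ∘ element) (index x)
              λ j j≢ → others (element j) λ j≈x → j≢ (≡.trans (≡.sym (index-element j)) (index-cong j≈x)))
            (f-cong (element-index x))

-- Polynomial functions and their roots

module PolynomialFunctions {q a ℓ} (K : FiniteField q a ℓ) where
  open FiniteField K hiding (sum; _^_)
  open IntegerMultiples commutativeRing
  open Solver
  open Algebra.Properties.Semiring.Sum semiring
  open Algebra.Properties.CommutativeSemiring.Exp commutativeSemiring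
  open import Relation.Binary.Reasoning.Setoid setoid

  no-zero-divisors : ∀ {x y} → ¬ x ≈ 0# → x * y ≈ 0# → y ≈ 0#
  no-zero-divisors {x} {y} x≉0 xy≈0 = invert (inverse x x≉0)
    where
    invert : ∃[ z ] x * z ≈ 1# → y ≈ 0#
    invert (z , xz≈1) = begin
      y             ≈⟨ *-identityˡ y ⟨
      1# * y        ≈⟨ *-congʳ xz≈1 ⟨
      (x * z) * y   ≈⟨ solve 3 (λ x z y → (x :* z) :* y := z :* (x :* y)) refl x z y ⟩
      z * (x * y)   ≈⟨ *-congˡ xy≈0 ⟩
      z * 0#        ≈⟨ zeroʳ z ⟩
      0#            ∎

  x-y≈0⇒x≈y : ∀ {x y} → x - y ≈ 0# → x ≈ y
  x-y≈0⇒x≈y {x} {y} x-y≈0 = begin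
    x             ≈⟨ solve 2 (λ x y → x := (x :- y) :+ y) refl x y ⟩
    (x - y) + y   ≈⟨ +-congʳ x-y≈0 ⟩
    0# + y        ≈⟨ +-identityˡ y ⟩
    y             ∎

  -- Functions with a chosen presentation take the place of polynomials. Over a finite field one
  -- function has many presentations; the root count needs only that some presentation of the given
  -- degree exists.
  DegreeBelow : ℕ → (Carrier → Carrier) → Set (a ⊔ ℓ)
  DegreeBelow zero    f = ∀ x → f x ≈ 0#
  DegreeBelow (suc d) f = ∃[ c ] ∃[ g ] DegreeBelow d g × (∀ x → f x ≈ c * x ^ d + g x)

  Monic : ℕ → (Carrier → Carrier) → Set (a ⊔ ℓ)
  Monic d f = ∃[ g ] DegreeBelow d g × (∀ x → f x ≈ x ^ d + g x)

  below-cong : ∀ d {f g} → (∀ x → f x ≈ g x) → DegreeBelow d f → DegreeBelow d g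
  below-cong zero    f≈g f≈0              = λ x → trans (sym (f≈g x)) (f≈0 x)
  below-cong (suc d) f≈g (c , h , h< , f≈) = c , h , h< , λ x → trans (sym (f≈g x)) (f≈ x)

  below-0 : ∀ d → DegreeBelow d (λ _ → 0#)
  below-0 zero    = λ _ → refl
  below-0 (suc d) = 0# , _ , below-0 d , λ x → solve 1 (λ y → con (+ 0) := con (+ 0) :* y :+ con (+ 0)) refl (x ^ d)

  below-+ : ∀ d {f g} → DegreeBelow d f → DegreeBelow d g → DegreeBelow d (λ x → f x + g x)
  below-+ zero f≈0 g≈0 = λ x → trans (+-cong (f≈0 x) (g≈0 x)) (+-identityˡ 0#)
  below-+ (suc d) (c , f′ , f′< , f≈) (c′ , g′ , g′< , g≈) =
    c + c′ , _ , below-+ d f′< g′< , λ x → trans (+-cong (f≈ x) (g≈ x))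
      (solve 5 (λ c c′ y f g → (c :* y :+ f) :+ (c′ :* y :+ g) := (c :+ c′) :* y :+ (f :+ g)) refl c c′ (x ^ d) (f′ x) (g′ x))

  below-* : ∀ d c {f} → DegreeBelow d f → DegreeBelow d (λ x → c * f x)
  below-* zero    c f≈0 = λ x → trans (*-congˡ (f≈0 x)) (zeroʳ c)
  below-* (suc d) c (c′ , f′ , f′< , f≈) =
    c * c′ , _ , below-* d c f′< , λ x → trans (*-congˡ (f≈ x))
      (solve 4 (λ c c′ y f → c :* (c′ :* y :+ f) := (c :* c′) :* y :+ c :* f) refl c c′ (x ^ d) (f′ x))

  below-x* : ∀ d {f} → DegreeBelow d f → DegreeBelow (suc d) (λ x → x * f x)
  below-x* zero    f≈0 = 0# , _ , below-0 0 , λ x → trans (*-congˡ (f≈0 x))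
    (solve 1 (λ x → x :* con (+ 0) := con (+ 0) :* con (+ 1) :+ con (+ 0)) refl x)
  below-x* (suc d) (c , f′ , f′< , f≈) = c , _ , below-x* d f′< , λ x → trans (*-congˡ (f≈ x))
    (solve 4 (λ c x y f → x :* (c :* y :+ f) := c :* (x :* y) :+ x :* f) refl c x (x ^ d) (f′ x))

  below-suc : ∀ d {f} → DegreeBelow d f → DegreeBelow (suc d) f
  below-suc d {f} f< = 0# , f , f< , λ x → solve 2 (λ y f → f := con (+ 0) :* y :+ f) refl (x ^ d) (f x)

  below-≤ : ∀ {d e f} → d ℕ.≤ e → DegreeBelow d f → DegreeBelow e f
  below-≤ {d} {e} {f} d≤e f< = go (ℕ.≤⇒≤′ d≤e)
    where
    go : ∀ {e} → d ℕ.≤′ e → DegreeBelow e f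
    go ℕ.≤′-refl        = f<
    go (ℕ.≤′-step d≤′e) = below-suc _ (go d≤′e)

  monic-x^ : ∀ d → Monic d (_^ d)
  monic-x^ d = _ , below-0 d , λ x → sym (+-identityʳ _)

  monic⇒below : ∀ d {f} → Monic d f → DegreeBelow (suc d) f
  monic⇒below d (g , g< , f≈) = 1# , g , g< , λ x → trans (f≈ x) (+-congʳ (sym (*-identityˡ _)))

  below-x^ : ∀ {k d} → k ℕ.< d → DegreeBelow d (_^ k)
  below-x^ {k} k<d = below-≤ k<d (monic⇒below k (monic-x^ k))

  monic-+ : ∀ d {f g} → Monic d f → DegreeBelow d g → Monic d (λ x → f x + g x)
  monic-+ d {f} {g} (f′ , f′< , f≈) g< =
    _ , below-+ d f′< g< , λ x → trans (+-congʳ (f≈ x)) (+-assoc _ _ _)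

  monic-x* : ∀ d {f} → Monic d f → Monic (suc d) (λ x → x * f x)
  monic-x* d (f′ , f′< , f≈) = _ , below-x* d f′< , λ x → trans (*-congˡ (f≈ x)) (distribˡ _ _ _)

  -- Dividing f - f r instead of f keeps the notion additive in f, so quotients can be built
  -- monomial by monomial, before r is known to be a root.
  Quotient : (Carrier → Carrier) → Carrier → (Carrier → Carrier) → Set (a ⊔ ℓ)
  Quotient f r h = ∀ x → f x - f r ≈ (x - r) * h x

  x^-quotient : ∀ d r → ∃[ h ] Monic d h × Quotient (_^ suc d) r h
  x^-quotient zero    r = _ , monic-x^ 0 , λ x →
    solve 2 (λ x r → x :* con (+ 1) :- r :* con (+ 1) := (x :- r) :* con (+ 1)) refl x r
  x^-quotient (suc d) r = extend (x^-quotient d r)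
    where
    extend : ∃[ h ] Monic d h × Quotient (_^ suc d) r h → ∃[ h ] Monic (suc d) h × Quotient (_^ suc (suc d)) r h
    extend (h , h-monic , h-quot) = (λ x → x * h x + r ^ suc d * x ^ 0)
      , monic-+ (suc d) (monic-x* d h-monic) (below-* (suc d) (r ^ suc d) (below-x^ (ℕ.s≤s ℕ.z≤n)))
      , λ x → begin
        x * x ^ suc d - r * r ^ suc d
          ≈⟨ solve 4 (λ x u r v → x :* u :- r :* v := x :* (u :- v) :+ (x :- r) :* v) refl x (x ^ suc d) r (r ^ suc d) ⟩
        x * (x ^ suc d - r ^ suc d) + (x - r) * r ^ suc d
          ≈⟨ +-congʳ (*-congˡ (h-quot x)) ⟩
        x * ((x - r) * h x) + (x - r) * r ^ suc d
          ≈⟨ solve 4 (λ x r h v → x :* ((x :- r) :* h) :+ (x :- r) :* v := (x :- r) :* (x :* h :+ v :* con (+ 1))) refl x r (h x) (r ^ suc d) ⟩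
        (x - r) * (x * h x + r ^ suc d * x ^ 0) ∎

  below-quotient : ∀ d {f} → DegreeBelow (suc d) f → ∀ r → ∃[ h ] DegreeBelow d h × Quotient f r h
  below-quotient zero {f} (c , f′ , f′≈0 , f≈) r = _ , below-0 0 , λ x → begin
    f x - f r                                 ≈⟨ +-cong (f≈ x) (-‿cong (f≈ r)) ⟩
    (c * 1# + f′ x) - (c * 1# + f′ r)         ≈⟨ +-cong (+-congˡ (f′≈0 x)) (-‿cong (+-congˡ (f′≈0 r))) ⟩
    (c * 1# + 0#) - (c * 1# + 0#)             ≈⟨ solve 2 (λ u y → u :- u := y :* con (+ 0)) refl (c * 1# + 0#) (x - r) ⟩
    (x - r) * 0#                              ∎
  below-quotient (suc d) {f} (c , f′ , f′< , f≈) r = combine (x^-quotient d r) (below-quotient d f′< r)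
    where
    combine : ∃[ h ] Monic d h × Quotient (_^ suc d) r h → ∃[ h ] DegreeBelow d h × Quotient f′ r h →
              ∃[ h ] DegreeBelow (suc d) h × Quotient f r h
    combine (h , h-monic , h-quot) (h′ , h′< , h′-quot) =
      _ , below-+ (suc d) (below-* (suc d) c (monic⇒below d h-monic)) (below-suc d h′<) , λ x → begin
        f x - f r
          ≈⟨ +-cong (f≈ x) (-‿cong (f≈ r)) ⟩
        (c * x ^ suc d + f′ x) - (c * r ^ suc d + f′ r)
          ≈⟨ solve 5 (λ c u f v g → (c :* u :+ f) :- (c :* v :+ g) := c :* (u :- v) :+ (f :- g)) refl c (x ^ suc d) (f′ x) (r ^ suc d) (f′ r) ⟩
        c * (x ^ suc d - r ^ suc d) + (f′ x - f′ r)
          ≈⟨ +-cong (*-congˡ (h-quot x)) (h′-quot x) ⟩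
        c * ((x - r) * h x) + (x - r) * h′ x
          ≈⟨ solve 4 (λ c y h h′ → c :* (y :* h) :+ y :* h′ := y :* (c :* h :+ h′)) refl c (x - r) (h x) (h′ x) ⟩
        (x - r) * (c * h x + h′ x) ∎

  monic-quotient : ∀ d {f} → Monic (suc d) f → ∀ r → ∃[ h ] Monic d h × Quotient f r h
  monic-quotient d {f} (f′ , f′< , f≈) r = combine (x^-quotient d r) (below-quotient d f′< r)
    where
    combine : ∃[ h ] Monic d h × Quotient (_^ suc d) r h → ∃[ h ] DegreeBelow d h × Quotient f′ r h →
              ∃[ h ] Monic d h × Quotient f r h
    combine (h , h-monic , h-quot) (h′ , h′< , h′-quot) = _ , monic-+ d h-monic h′< , λ x → begin
      f x - f r
        ≈⟨ +-cong (f≈ x) (-‿cong (f≈ r)) ⟩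
      (x ^ suc d + f′ x) - (r ^ suc d + f′ r)
        ≈⟨ solve 4 (λ u f v g → (u :+ f) :- (v :+ g) := (u :- v) :+ (f :- g)) refl (x ^ suc d) (f′ x) (r ^ suc d) (f′ r) ⟩
      (x ^ suc d - r ^ suc d) + (f′ x - f′ r)
        ≈⟨ +-cong (h-quot x) (h′-quot x) ⟩
      (x - r) * h x + (x - r) * h′ x
        ≈⟨ distribˡ _ _ _ ⟨
      (x - r) * (h x + h′ x) ∎

  too-many-roots : ∀ d {f} → Monic d f → (r : Fin (suc d) → Carrier) → (∀ {i j} → r i ≈ r j → i ≡ j) →
                   ¬ (∀ i → f (r i) ≈ 0#)
  too-many-roots zero {f} (f′ , f′≈0 , f≈) r r-injective roots = 0≉1 (begin
    0#                          ≈⟨ roots Fin.zero ⟨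
    f (r Fin.zero)              ≈⟨ f≈ _ ⟩
    1# + f′ (r Fin.zero)        ≈⟨ +-congˡ (f′≈0 _) ⟩
    1# + 0#                     ≈⟨ +-identityʳ 1# ⟩
    1#                          ∎)
  too-many-roots (suc d) {f} f-monic r r-injective roots = descend (monic-quotient d f-monic (r Fin.zero))
    where
    descend : ¬ (∃[ h ] Monic d h × Quotient f (r Fin.zero) h)
    descend (h , h-monic , quot) = too-many-roots d h-monic (r ∘ Fin.suc) (Fin.suc-injective ∘ r-injective) λ i →
      no-zero-divisors (λ diff≈0 → contradiction (r-injective (x-y≈0⇒x≈y diff≈0)) λ ()) (begin
        (r (Fin.suc i) - r Fin.zero) * h (r (Fin.suc i))    ≈⟨ quot (r (Fin.suc i)) ⟨
        f (r (Fin.suc i)) - f (r Fin.zero)                  ≈⟨ +-cong (roots (Fin.suc i)) (-‿cong (roots Fin.zero)) ⟩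
        0# - 0#                                             ≈⟨ -‿inverseʳ 0# ⟩
        0#                                                  ∎)

-- Characteristic, Frobenius map and prime field of a field with p^n elements

module PrimePowerField {p : ℕ} (p-prime : Prime p) (n : ℕ) {a ℓ} (K : FiniteField (p ℕ.^ n) a ℓ) where
  open FiniteField K hiding (sum; _^_)
  open PolynomialFunctions K
  open IntegerMultiples commutativeRing
  open Solver
  open Algebra.Properties.Semiring.Sum semiring
  open Algebra.Properties.CommutativeSemiring.Exp commutativeSemiring
  open MonoidSums +-commutativeMonoid using (sum-snoc)
  open Congruence p-prime
  open Trace p n K
  open import Relation.Binary.Reasoning.Setoid setoid

  private
    module Additive = FiniteSums K +-commutativeMonoid
    module Multiplicative where
      open FiniteSums K *-commutativeMonoid public
      open Algebra.Properties.CommutativeMonoid.Sum *-commutativeMonoid public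
        renaming (sum to ∏; ∑-distrib-+ to ∏-distrib-*; sum-cong-≋ to ∏-cong; sum-replicate to ∏-const)

  cancel-+ : ∀ {x y} → x ≈ x + y → y ≈ 0#
  cancel-+ {x} {y} x≈x+y = begin
    y             ≈⟨ solve 2 (λ x y → y := (x :+ y) :- x) refl x y ⟩
    (x + y) - x   ≈⟨ +-congʳ x≈x+y ⟨
    x - x         ≈⟨ -‿inverseʳ x ⟩
    0#            ∎

  -- Adding 1 permutes the elements, so the sum of all elements is unchanged although it grows by q
  -- times 1.
  ι[q]≈0 : ι (+ (p ℕ.^ n)) ≈ 0#
  ι[q]≈0 = begin
    ι (+ (p ℕ.^ n))                   ≈⟨ *-identityʳ _ ⟨
    ι (+ (p ℕ.^ n)) * 1#              ≈⟨ sum-const (p ℕ.^ n) 1# ⟨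
    sum {p ℕ.^ n} (λ _ → 1#)          ≈⟨ cancel-+ (trans shift (∑-distrib-+ element (λ _ → 1#))) ⟩
    0#                                ∎
    where
    shift : sum element ≈ sum (λ i → element i + 1#)
    shift = Additive.reindex {_+ 1#} {_- 1#} +-congʳ +-congʳ
      (solve 1 (λ x → x :- con (+ 1) :+ con (+ 1) := x) refl)
      (solve 1 (λ x → x :+ con (+ 1) :- con (+ 1) := x) refl) id id

  ι-ℕ^ : ∀ k → ι (+ (p ℕ.^ k)) ≈ ι (+ p) ^ k
  ι-ℕ^ zero    = refl
  ι-ℕ^ (suc k) = trans (ι-cong (ℤ.pos-* p (p ℕ.^ k))) (trans (ι-homo-* (+ p) (+ (p ℕ.^ k))) (*-congˡ (ι-ℕ^ k)))

  x^k≈0⇒x≈0 : ∀ {x} k → x ^ k ≈ 0# → x ≈ 0#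
  x^k≈0⇒x≈0 zero 1≈0 = contradiction (sym 1≈0) 0≉1
  x^k≈0⇒x≈0 {x} (suc k) x^[1+k]≈0 with x ≟ 0#
  ... | yes x≈0 = x≈0
  ... | no  x≉0 = x^k≈0⇒x≈0 k (no-zero-divisors x≉0 x^[1+k]≈0)

  ι[p]≈0 : ι (+ p) ≈ 0#
  ι[p]≈0 = x^k≈0⇒x≈0 n (trans (sym (ι-ℕ^ n)) ι[q]≈0)

  p∣⇒ι≈0 : ∀ {z} → p∣ z → ι z ≈ 0#
  p∣⇒ι≈0 (divides t ≡.refl) = trans (ι-homo-* t (+ p)) (trans (*-congˡ ι[p]≈0) (zeroʳ _))

  ι-≅ : ∀ {y z} → y ≅ z → ι y ≈ ι z
  ι-≅ {y} {z} y≅z = x-y≈0⇒x≈y (trans (sym (ι-homo-sub y z)) (p∣⇒ι≈0 (difference y≅z)))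

  ι≈0⇒p∣ : ∀ {z} → ι z ≈ 0# → p∣ z
  ι≈0⇒p∣ {z} ιz≈0 with + p ℤ∣.∣? z
  ... | yes p∣z = p∣z
  ... | no  p∤z with bezout z p∤z
  ... | α , αz≅1 = contradiction (begin
    0#                ≈⟨ zeroʳ (ι α) ⟨
    ι α * 0#          ≈⟨ *-congˡ ιz≈0 ⟨
    ι α * ι z         ≈⟨ ι-homo-* α z ⟨
    ι (α ℤ.* z)       ≈⟨ ι-≅ αz≅1 ⟩
    1#                ∎) 0≉1

  ι-≅⁻¹ : ∀ {y z} → ι y ≈ ι z → y ≅ z
  ι-≅⁻¹ {y} {z} ιy≈ιz = congruent (ι≈0⇒p∣ (trans (ι-homo-sub y z) (trans (+-congʳ ιy≈ιz) (-‿inverseʳ _))))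

  1≤n : 1 ℕ.≤ n
  1≤n = ℕ.n≢0⇒n>0 λ n≡0 → 0≉1 (begin
    0#                          ≈⟨ Additive.element-index 0# ⟨
    element (Additive.index 0#) ≡⟨ ≡.cong element (all-equal (≡.cong (p ℕ.^_) n≡0) _ _) ⟩
    element (Additive.index 1#) ≈⟨ Additive.element-index 1# ⟩
    1#                          ∎)
    where
    all-equal : ∀ {m} → m ≡ 1 → (i j : Fin m) → i ≡ j
    all-equal ≡.refl Fin.zero Fin.zero = ≡.refl

  -- Multiplying all elements by x ≉ 0 permutes the nonzero ones; replacing the
  -- factor 0 by 1 makes the product P of all elements invertible.
  x^q≈x : ∀ x → x ^ (p ℕ.^ n) ≈ x
  x^q≈x x with x ≟ 0#
  ... | yes x≈0 = trans (^-congˡ (p ℕ.^ n) x≈0) (trans (0^ (ℕ.m^n>0 p n)) (sym x≈0))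
    where
    0^ : ∀ {k} → 1 ℕ.≤ k → 0# ^ k ≈ 0#
    0^ (ℕ.s≤s _) = zeroˡ _
  ... | no  x≉0 = x-y≈0⇒x≈y (no-zero-divisors P≉0 (begin
    P * (x ^ (p ℕ.^ n) - x)             ≈⟨ solve 3 (λ P y x → P :* (y :- x) := y :* P :- P :* x) refl P _ x ⟩
    x ^ (p ℕ.^ n) * P - P * x           ≈⟨ +-congʳ (trans (*-congʳ (sym (∏-const (p ℕ.^ n)))) (sym (∏-distrib-* (λ _ → x) (g ∘ element)))) ⟩
    ∏ (λ i → x * g (element i)) - P * x ≈⟨ +-congʳ (∏-cong λ i → pointwise (element i)) ⟩
    ∏ (λ i → g (x * element i) * [ element i ]) - P * x
                                        ≈⟨ +-congʳ (∏-distrib-* (λ i → g (x * element i)) ([_] ∘ element)) ⟩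
    ∏ (λ i → g (x * element i)) * ∏ ([_] ∘ element) - P * x
                                        ≈⟨ +-congʳ (*-cong (sym permuted) ∏[]≈x) ⟩
    P * x - P * x                       ≈⟨ -‿inverseʳ _ ⟩
    0#                                  ∎))
    where
    open Multiplicative using (∏; ∏-distrib-*; ∏-cong; ∏-const)
    -- For y ≠ 0, multiplication by x commutes with `g`. At y = 0 the two sides differ by the factor
    -- x. `[ y ]` is this correction factor, so the product of all corrections is x.
    g [_] : Carrier → Carrier
    g y with y ≟ 0#
    ... | yes _ = 1#
    ... | no  _ = y
    [ y ] with y ≟ 0#
    ... | yes _ = x
    ... | no  _ = 1#
    g-0 : ∀ {y} → y ≈ 0# → g y ≈ 1#
    g-0 {y} y≈0 with y ≟ 0#
    ... | yes _   = refl
    ... | no  y≉0 = contradiction y≈0 y≉0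
    g-≉0 : ∀ {y} → ¬ y ≈ 0# → g y ≈ y
    g-≉0 {y} y≉0 with y ≟ 0#
    ... | yes y≈0 = contradiction y≈0 y≉0
    ... | no  _   = refl
    []-0 : ∀ {y} → y ≈ 0# → [ y ] ≈ x
    []-0 {y} y≈0 with y ≟ 0#
    ... | yes _   = refl
    ... | no  y≉0 = contradiction y≈0 y≉0
    []-≉0 : ∀ {y} → ¬ y ≈ 0# → [ y ] ≈ 1#
    []-≉0 {y} y≉0 with y ≟ 0#
    ... | yes y≈0 = contradiction y≈0 y≉0
    ... | no  _   = refl
    g-cong : ∀ {y z} → y ≈ z → g y ≈ g z
    g-cong {y} {z} y≈z with y ≟ 0#
    ... | yes y≈0 = sym (g-0 (trans (sym y≈z) y≈0))
    ... | no  y≉0 = trans y≈z (sym (g-≉0 (y≉0 ∘ trans y≈z)))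
    []-cong : ∀ {y z} → y ≈ z → [ y ] ≈ [ z ]
    []-cong {y} {z} y≈z with y ≟ 0#
    ... | yes y≈0 = sym ([]-0 (trans (sym y≈z) y≈0))
    ... | no  y≉0 = sym ([]-≉0 (y≉0 ∘ trans y≈z))
    g≉0 : ∀ y → ¬ g y ≈ 0#
    g≉0 y with y ≟ 0#
    ... | yes _   = 0≉1 ∘ sym
    ... | no  y≉0 = y≉0
    P : Carrier
    P = ∏ (g ∘ element)
    ∏≉0 : ∀ {k} (f : Fin k → Carrier) → (∀ i → ¬ f i ≈ 0#) → ¬ ∏ f ≈ 0#
    ∏≉0 {zero}  f f≉0 = 0≉1 ∘ sym
    ∏≉0 {suc k} f f≉0 = ∏≉0 (f ∘ Fin.suc) (f≉0 ∘ Fin.suc) ∘ no-zero-divisors (f≉0 Fin.zero)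
    P≉0 : ¬ P ≈ 0#
    P≉0 = ∏≉0 (g ∘ element) (g≉0 ∘ element)
    ∏[]≈x : ∏ ([_] ∘ element) ≈ x
    ∏[]≈x = trans (Multiplicative.sum-only-element [_] []-cong 0# λ y → []-≉0) ([]-0 refl)
    pointwise : ∀ y → x * g y ≈ g (x * y) * [ y ]
    pointwise y with y ≟ 0#
    ... | yes y≈0 = trans (*-comm x 1#) (*-congʳ (sym (g-0 (trans (*-congˡ y≈0) (zeroʳ x)))))
    ... | no  y≉0 = trans (sym (g-≉0 (y≉0 ∘ no-zero-divisors x≉0))) (sym (*-identityʳ _))
    x⁻¹ : Carrier
    x⁻¹ = proj₁ (inverse x x≉0)
    xx⁻¹≈1 : x * x⁻¹ ≈ 1#
    xx⁻¹≈1 = proj₂ (inverse x x≉0)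
    permuted : P ≈ ∏ (λ i → g (x * element i))
    permuted = Multiplicative.reindex {x *_} {x⁻¹ *_} *-congˡ *-congˡ
      (λ y → trans (sym (*-assoc x x⁻¹ y)) (trans (*-congʳ xx⁻¹≈1) (*-identityˡ y)))
      (λ y → trans (sym (*-assoc x⁻¹ x y)) (trans (*-congʳ (trans (*-comm x⁻¹ x) xx⁻¹≈1)) (*-identityˡ y)))
      g g-cong

  frobenius : ∀ x y → (x + y) ^ p ≈ x ^ p + y ^ p
  frobenius x y with Freshman.[x+y]^p commutativeRing p-prime
  ... | _ , _ , _ , _ , expand =
    trans (expand x y) (trans (+-congˡ (trans (*-congʳ ι[p]≈0) (zeroˡ _))) (+-identityʳ _))

  0^p≈0 : 0# ^ p ≈ 0#
  0^p≈0 = cancel-+ (trans (sym (^-congˡ p (+-identityˡ 0#))) (frobenius 0# 0#))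

  frobenius^ : ∀ k x y → (x + y) ^ (p ℕ.^ k) ≈ x ^ (p ℕ.^ k) + y ^ (p ℕ.^ k)
  frobenius^ zero    x y = solve 2 (λ x y → (x :+ y) :* con (+ 1) := x :* con (+ 1) :+ y :* con (+ 1)) refl x y
  frobenius^ (suc k) x y = begin
    (x + y) ^ (p ℕ.* p ℕ.^ k)                       ≈⟨ ^-assocʳ (x + y) p (p ℕ.^ k) ⟨
    ((x + y) ^ p) ^ (p ℕ.^ k)                       ≈⟨ ^-congˡ (p ℕ.^ k) (frobenius x y) ⟩
    (x ^ p + y ^ p) ^ (p ℕ.^ k)                     ≈⟨ frobenius^ k (x ^ p) (y ^ p) ⟩
    (x ^ p) ^ (p ℕ.^ k) + (y ^ p) ^ (p ℕ.^ k)       ≈⟨ +-cong (^-assocʳ x p (p ℕ.^ k)) (^-assocʳ y p (p ℕ.^ k)) ⟩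
    x ^ (p ℕ.^ suc k) + y ^ (p ℕ.^ suc k)           ∎

  frobenius-sum : ∀ {k} (f : Fin k → Carrier) → sum f ^ p ≈ sum (λ i → f i ^ p)
  frobenius-sum {zero}  f = 0^p≈0
  frobenius-sum {suc k} f = trans (frobenius _ _) (+-congˡ (frobenius-sum (f ∘ Fin.suc)))

  -- The absolute trace

  Tr-cong : ∀ {x y} → x ≈ y → Tr x ≈ Tr y
  Tr-cong x≈y = sum-cong-≋ {n} λ i → ^-congˡ (p ℕ.^ toℕ i) x≈y

  Tr-+ : ∀ x y → Tr (x + y) ≈ Tr x + Tr y
  Tr-+ x y = trans (sum-cong-≋ {n} λ i → frobenius^ (toℕ i) x y) (∑-distrib-+ {n} _ _)

  -- Raising to the p-th power moves each summand to the next one, and x^(p^n) = x closes the cycle.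
  Tr^p≈Tr : ∀ x → Tr x ^ p ≈ Tr x
  Tr^p≈Tr x = begin
    Tr x ^ p                                      ≈⟨ frobenius-sum {n} _ ⟩
    sum {n} (λ i → (x ^ (p ℕ.^ toℕ i)) ^ p)       ≈⟨ sum-cong-≋ {n} (λ i → trans (^-assocʳ x (p ℕ.^ toℕ i) p) (^-congʳ x (ℕ.*-comm (p ℕ.^ toℕ i) p))) ⟩
    sum {n} (λ i → f (suc (toℕ i)))               ≈⟨ solve 2 (λ s y → s := (y :+ s) :- y) refl _ (f 0) ⟩
    (f 0 + sum {n} (λ i → f (suc (toℕ i)))) - f 0 ≈⟨ +-congʳ (sum-snoc n f) ⟩
    (Tr x + f n) - f 0                            ≈⟨ +-cong (+-congˡ (x^q≈x x)) (-‿cong (*-identityʳ x)) ⟩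
    (Tr x + x) - x                                ≈⟨ solve 2 (λ t x → (t :+ x) :- x := t) refl _ x ⟩
    Tr x                                          ∎
    where
    f : ℕ → Carrier
    f k = x ^ (p ℕ.^ k)

  -- Were y none of the p multiples of 1, then y and these multiples would be p + 1 distinct roots
  -- of X^p - X.
  prime-subfield : ∀ y → y ^ p ≈ y → ∃[ j ] ι (+ toℕ {p} j) ≈ y
  prime-subfield y y^p≈y with Fin.any? {n = p} (λ j → ι (+ toℕ j) ≟ y)
  ... | yes found = found
  ... | no  none  = contradiction (λ where
          Fin.zero    → root y y^p≈y
          (Fin.suc j) → root _ (ι^p≈ι (toℕ j)))
        (too-many-roots p X^p-X-monic r r-injective)
    where
    X^p-X-monic : Monic p (λ x → x ^ p + ι (ℤ.- + 1) * x ^ 1)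
    X^p-X-monic = monic-+ p (monic-x^ p) (below-* p _ (below-x^ 1<p))
    r : Fin (suc p) → Carrier
    r Fin.zero    = y
    r (Fin.suc j) = ι (+ toℕ j)
    r-injective : ∀ {i j} → r i ≈ r j → i ≡ j
    r-injective {Fin.zero}  {Fin.zero}  _ = ≡.refl
    r-injective {Fin.zero}  {Fin.suc j} y≈ιj = contradiction (j , sym y≈ιj) none
    r-injective {Fin.suc i} {Fin.zero}  ιi≈y = contradiction (i , ιi≈y) none
    r-injective {Fin.suc i} {Fin.suc j} ιi≈ιj = ≡.cong Fin.suc (Fin.toℕ-injective
      (residue-unique (Fin.toℕ<n i) (Fin.toℕ<n j) (ι-≅⁻¹ ιi≈ιj)))
    ι^p≈ι : ∀ k → ι (+ k) ^ p ≈ ι (+ k)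
    ι^p≈ι zero    = 0^p≈0
    ι^p≈ι (suc k) = begin
      ι (+ suc k) ^ p           ≈⟨ ^-congˡ p (ι-homo-+ (+ 1) (+ k)) ⟩
      (1# + ι (+ k)) ^ p        ≈⟨ frobenius 1# (ι (+ k)) ⟩
      1# ^ p + ι (+ k) ^ p      ≈⟨ +-cong (1^n≈1 p) (ι^p≈ι k) ⟩
      1# + ι (+ k)              ≈⟨ ι-homo-+ (+ 1) (+ k) ⟨
      ι (+ suc k)               ∎
    root : ∀ z → z ^ p ≈ z → z ^ p + ι (ℤ.- + 1) * z ^ 1 ≈ 0#
    root z z^p≈z = trans (+-congʳ z^p≈z)
      (solve 1 (λ z → z :+ con (ℤ.- + 1) :* (z :* con (+ 1)) := con (+ 0)) refl z)

  ·1≈ι : ∀ k → k · 1# ≈ ι (+ k)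
  ·1≈ι k = Algebra.Properties.Semiring.Mult.TCOptimised.×ᵤ≈× semiring k 1#

  -- The default branch of `tr` is excluded, because the trace is fixed by the Frobenius map and
  -- thus lies in the prime field.
  ι[tr]≈Tr : ∀ x → ι (+ tr x) ≈ Tr x
  ι[tr]≈Tr x with Fin.any? {n = p} (λ j → toℕ j · 1# ≟ Tr x)
  ... | yes (j , j·1≈Tr) = trans (sym (·1≈ι (toℕ j))) j·1≈Tr
  ... | no  none         = contradiction (found (prime-subfield (Tr x) (Tr^p≈Tr x))) none
    where
    found : ∃[ j ] ι (+ toℕ {p} j) ≈ Tr x → ∃[ j ] toℕ {p} j · 1# ≈ Tr x
    found (j , ιj≈Tr) = j , trans (·1≈ι (toℕ j)) ιj≈Tr

  tr-cong : ∀ {x y} → x ≈ y → + tr x ≅ + tr y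
  tr-cong {x} {y} x≈y = ι-≅⁻¹ (trans (ι[tr]≈Tr x) (trans (Tr-cong x≈y) (sym (ι[tr]≈Tr y))))

  tr-+ : ∀ x y → + tr (x + y) ≅ + tr x ℤ.+ + tr y
  tr-+ x y = ι-≅⁻¹ (begin
    ι (+ tr (x + y))              ≈⟨ ι[tr]≈Tr (x + y) ⟩
    Tr (x + y)                    ≈⟨ Tr-+ x y ⟩
    Tr x + Tr y                   ≈⟨ +-cong (ι[tr]≈Tr x) (ι[tr]≈Tr y) ⟨
    ι (+ tr x) + ι (+ tr y)       ≈⟨ ι-homo-+ (+ tr x) (+ tr y) ⟨
    ι (+ tr x ℤ.+ + tr y)         ∎)

  tr-0 : + tr 0# ≅ + 0
  tr-0 = ι-≅⁻¹ (trans (ι[tr]≈Tr 0#) (cancel-+ (trans (Tr-cong (sym (+-identityˡ 0#))) (Tr-+ 0# 0#))))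

  tr-ι* : ∀ k z → + tr (ι (+ k) * z) ≅ + k ℤ.* + tr z
  tr-ι* zero    z = ≅-trans (tr-cong (zeroˡ z)) (≅-trans tr-0 (≡⇒≅ (≡.sym (ℤ.*-zeroˡ (+ tr z)))))
  tr-ι* (suc k) z = ≅-trans (tr-cong (trans (*-congʳ (ι-homo-+ (+ 1) (+ k))) (trans (distribʳ z 1# _) (+-congʳ (*-identityˡ z)))))
    (≅-trans (tr-+ z (ι (+ k) * z))
      (≅-trans (≅-+ (≡⇒≅ {+ tr z} ≡.refl) (tr-ι* k z)) (≡⇒≅ (≡.sym (ℤ.suc-* (+ k) (+ tr z))))))

  -- The number of summands is separated from n, which is tied to the size of K and does not admit
  -- induction.
  partial-trace : ℕ → Carrier → Carrier
  partial-trace k x = sum {k} λ i → x ^ (p ℕ.^ toℕ i)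

  partial-trace-below : ∀ k {d} → (∀ {i} → i ℕ.< k → p ℕ.^ i ℕ.< d) → DegreeBelow d (partial-trace k)
  partial-trace-below zero    {d} small = below-0 d
  partial-trace-below (suc k) {d} small =
    below-cong d (λ x → sym (sum-snoc k (λ i → x ^ (p ℕ.^ i))))
      (below-+ d (partial-trace-below k (small ∘ ℕ.m<n⇒m<1+n)) (below-x^ (small ℕ.≤-refl)))

  partial-trace-monic : ∀ k → Monic (p ℕ.^ k) (partial-trace (suc k))
  partial-trace-monic k = partial-trace k , partial-trace-below k (ℕ.^-monoʳ-< p 1<p) , λ x →
    trans (sum-snoc k (λ i → x ^ (p ℕ.^ i))) (+-comm _ _)

  -- The trace is a monic polynomial function of degree p^(n-1), too small to vanish at all p^n
  -- elements.
  Tr≉0 : ¬ (∀ x → Tr x ≈ 0#)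
  Tr≉0 Tr≈0 = too-many-roots (p ℕ.^ k) (partial-trace-monic k) root root-injective
    λ i → trans (reflexive (≡.cong (λ m → partial-trace m (root i)) (ℕ.suc-pred n))) (Tr≈0 (root i))
    where
    instance
      n-nonZero : ℕ.NonZero n
      n-nonZero = ℕ.>-nonZero 1≤n
    k : ℕ
    k = ℕ.pred n
    enough : suc (p ℕ.^ k) ℕ.≤ p ℕ.^ n
    enough = ℕ.^-monoʳ-< p 1<p (ℕ.≤-reflexive (ℕ.suc-pred n))
    root : Fin (suc (p ℕ.^ k)) → Carrier
    root i = element (Fin.inject≤ i enough)
    root-injective : ∀ {i j} → root i ≈ root j → i ≡ j
    root-injective {i} {j} eq = Fin.inject≤-injective enough enough i j
      (≡.trans (≡.sym (Additive.index-element _)) (≡.trans (Additive.index-cong eq) (Additive.index-element _)))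

  -- An element x with Tr x ≠ 0 is found by search, and b = x z⁻¹ does it.
  tr-nondegenerate : ∀ {z} → ¬ z ≈ 0# → ∃[ b ] ¬ p∣ + tr (b * z)
  tr-nondegenerate {z} z≉0 with Fin.any? (λ i → ¬? (Tr (element i) ≟ 0#))
  ... | yes (i , Tr≉0) = element i * z⁻¹ , λ p∣tr → Tr≉0 (begin
    Tr (element i)                ≈⟨ Tr-cong undo ⟨
    Tr ((element i * z⁻¹) * z)    ≈⟨ ι[tr]≈Tr _ ⟨
    ι (+ tr ((element i * z⁻¹) * z)) ≈⟨ p∣⇒ι≈0 p∣tr ⟩
    0#                            ∎)
    where
    z⁻¹ : Carrier
    z⁻¹ = proj₁ (inverse z z≉0)
    undo : (element i * z⁻¹) * z ≈ element i
    undo = trans (*-assoc _ _ _) (trans (*-congˡ (trans (*-comm z⁻¹ z) (proj₂ (inverse z z≉0)))) (*-identityʳ _))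
  ... | no  none = contradiction (λ x → trans (Tr-cong (sym (Additive.element-index x)))
      (decidable-stable (Tr (element (Additive.index x)) ≟ 0#) λ Tr≉0 → none (_ , Tr≉0))) Tr≉0

-- Counting with indicator functions

𝟙 : ∀ {ℓ} {P : Set ℓ} → Dec P → ℤ
𝟙 (yes _) = + 1
𝟙 (no  _) = + 0

count-∷ : ∀ {ℓ₁ ℓ₂} {X : Set ℓ₁} {P : Pred X ℓ₂} (P? : Decidable P) x {k} (xs : Vec X k) →
          + count P? (x Vec.∷ xs) ≡ 𝟙 (P? x) ℤ.+ + count P? xs
count-∷ P? x xs with P? x
... | yes _ = ≡.refl
... | no  _ = ≡.refl

-- The second equation compares two coefficients of a vanishing combination, the first one adds up
-- all p of them. The constant term d drops out and B cancels, which leaves a relation between the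
-- multiplicities alone.
eliminate-deficit : ∀ {B N₀ N₁ p d q} → B ≢ + 0 → p ℤ.* (B ℤ.* N₁) ≡ d ℤ.+ q ℤ.* B →
                    d ℤ.+ B ℤ.* N₀ ≡ B ℤ.* N₁ → N₀ ℤ.+ (p ℤ.- + 1) ℤ.* N₁ ≡ q
eliminate-deficit {B} {N₀} {N₁} {p} {d} {q} B≢0 eq₁ eq₂ = ℤ.*-cancelˡ-≡ B _ _ {{ℤ.≢-nonZero B≢0}} (begin
  B ℤ.* (N₀ ℤ.+ (p ℤ.- + 1) ℤ.* N₁)                                   ≡⟨ lemma₁ B N₀ N₁ p d ⟩
  (d ℤ.+ B ℤ.* N₀) ℤ.- B ℤ.* N₁ ℤ.+ p ℤ.* (B ℤ.* N₁) ℤ.- d            ≡⟨ ≡.cong₂ (λ x y → x ℤ.- B ℤ.* N₁ ℤ.+ y ℤ.- d) eq₂ eq₁ ⟩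
  B ℤ.* N₁ ℤ.- B ℤ.* N₁ ℤ.+ (d ℤ.+ q ℤ.* B) ℤ.- d                     ≡⟨ lemma₂ B N₁ d q ⟩
  B ℤ.* q                                                             ∎)
  where
  open ≡-Reasoning
  lemma₁ : ∀ B N₀ N₁ p d → B ℤ.* (N₀ ℤ.+ (p ℤ.- + 1) ℤ.* N₁) ≡ (d ℤ.+ B ℤ.* N₀) ℤ.- B ℤ.* N₁ ℤ.+ p ℤ.* (B ℤ.* N₁) ℤ.- d
  lemma₁ = solve-∀
  lemma₂ : ∀ B N₁ d q → B ℤ.* N₁ ℤ.- B ℤ.* N₁ ℤ.+ (d ℤ.+ q ℤ.* B) ℤ.- d ≡ B ℤ.* q
  lemma₂ = solve-∀

-- Character sums and the sizes of the fibres

module CharacterSums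
  {p : ℕ} (p-prime : Prime p) {c ℓ} (U : RootOfUnity p c ℓ) (n m : ℕ)
  {a ℓ₁ b ℓ₂} (K : FiniteField (p ℕ.^ n) a ℓ₁) (L : FiniteField (p ℕ.^ m) b ℓ₂)
  (F : Func (FiniteField.setoid K) (FiniteField.setoid L)) where

  open RootOfUnity U
  open Cyclotomic p-prime U
  open Solver
  open Algebra.Properties.Semiring.Sum semiring
  open MonoidSums +-commutativeMonoid
  open import Relation.Binary.Reasoning.Setoid setoid
  private
    module K = FiniteField K
    module L = FiniteField L
    module L-sums = FiniteSums L +-commutativeMonoid
    module Lᵖ = PrimePowerField p-prime m L
    module Lι = IntegerMultiples L.commutativeRing

  qᴷ qᴸ : ℕ
  qᴷ = p ℕ.^ n
  qᴸ = p ℕ.^ m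

  f : K.Carrier → L.Carrier
  f = Func.to F

  tr : L.Carrier → ℤ
  tr z = + Trace.tr p m L z

  -- The Walsh transform at a = 0, with the trace of 0 left out of the exponent.
  V : L.Carrier → Carrier
  V y = sum {qᴷ} λ i → e (tr (y L.* f (K.element i)))

  V-0 : ∀ {y} → y L.≈ L.0# → V y ≈ ι (+ qᴷ)
  V-0 {y} y≈0 = begin
    V y                       ≈⟨ sum-cong-≋ {qᴷ} (λ i → trans (e-cong (≅-trans (Lᵖ.tr-cong (L.trans (L.*-congʳ y≈0) (L.zeroˡ _))) Lᵖ.tr-0)) e-0) ⟩
    sum {qᴷ} (λ _ → 1#)       ≈⟨ sum-const qᴷ 1# ⟩
    ι (+ qᴷ) * 1#             ≈⟨ *-identityʳ _ ⟩
    ι (+ qᴷ)                  ∎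

  sum-𝟙 : ∀ {ℓ₃ ℓ₄} {X : Set ℓ₃} {P : Pred X ℓ₄} (P? : Decidable P) (w : ℤ) {k} (x : Fin k → X) →
          sum (λ i → ι (w ℤ.* 𝟙 (P? (x i)))) ≈ ι (w ℤ.* + count P? (Vec.tabulate x))
  sum-𝟙 P? w {zero}  x = ι-cong (≡.sym (ℤ.*-zeroʳ w))
  sum-𝟙 P? w {suc k} x = begin
    ι (w ℤ.* 𝟙 (P? x₀)) + sum (λ i → ι (w ℤ.* 𝟙 (P? (x (Fin.suc i)))))    ≈⟨ +-congˡ (sum-𝟙 P? w (x ∘ Fin.suc)) ⟩
    ι (w ℤ.* 𝟙 (P? x₀)) + ι (w ℤ.* + count P? xs)                         ≈⟨ ι-homo-+ (w ℤ.* 𝟙 (P? x₀)) (w ℤ.* + count P? xs) ⟨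
    ι (w ℤ.* 𝟙 (P? x₀) ℤ.+ w ℤ.* + count P? xs)                           ≡⟨ ≡.cong ι (ℤ.*-distribˡ-+ w (𝟙 (P? x₀)) (+ count P? xs)) ⟨
    ι (w ℤ.* (𝟙 (P? x₀) ℤ.+ + count P? xs))                               ≡⟨ ≡.cong (λ z → ι (w ℤ.* z)) (count-∷ P? x₀ xs) ⟨
    ι (w ℤ.* + count P? (x₀ Vec.∷ xs))                                    ∎
    where
    x₀ = x Fin.zero
    xs = Vec.tabulate (x ∘ Fin.suc)

  tr-sub : ∀ b z z′ → tr (b L.* z) ℤ.- tr (b L.* z′) ≅ tr (b L.* (z L.- z′))
  tr-sub b z z′ = ≅-trans (≅-sub (≅-trans (Lᵖ.tr-cong split) (Lᵖ.tr-+ _ _)) (≡⇒≅ {tr (b L.* z′)} ≡.refl))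
                          (≡⇒≅ (lemma (tr (b L.* (z L.- z′))) (tr (b L.* z′))))
    where
    split : b L.* z L.≈ b L.* (z L.- z′) L.+ b L.* z′
    split = Lι.Solver.solve 3 (λ b z z′ → b Lι.Solver.:* z Lι.Solver.:= b Lι.Solver.:* (z Lι.Solver.:- z′) Lι.Solver.:+ b Lι.Solver.:* z′) L.refl b z z′
    lemma : ∀ x y → (x ℤ.+ y) ℤ.- y ≡ x
    lemma = solve-∀

  -- For z ≠ z′ some b₀ has p ∤ tr (b₀ (z - z′)). Translating the summation variable by b₀
  -- multiplies the sum by a root of unity other than 1, so the sum is 0.
  orthogonality : ∀ z z′ → sum (λ i → e (tr (L.element i L.* z) ℤ.- tr (L.element i L.* z′))) ≈
                           ι (+ qᴸ ℤ.* 𝟙 (z L.≟ z′))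
  orthogonality z z′ with z L.≟ z′
  ... | yes z≈z′ = begin
    sum (λ i → e (tr (L.element i L.* z) ℤ.- tr (L.element i L.* z′)))
      ≈⟨ sum-cong-≋ (λ i → trans (e-cong (≅-trans (≅-sub (Lᵖ.tr-cong (L.*-congˡ z≈z′)) (≡⇒≅ {tr (L.element i L.* z′)} ≡.refl))
                                                  (≡⇒≅ (ℤ.+-inverseʳ (tr (L.element i L.* z′)))))) e-0) ⟩
    sum {qᴸ} (λ _ → 1#)       ≈⟨ sum-const qᴸ 1# ⟩
    ι (+ qᴸ) * 1#             ≈⟨ ι-homo-* (+ qᴸ) (+ 1) ⟨
    ι (+ qᴸ ℤ.* + 1)          ∎
  ... | no  z≉z′ = trans (vanish (Lᵖ.tr-nondegenerate (z≉z′ ∘ PolynomialFunctions.x-y≈0⇒x≈y L))) (ι-cong (≡.sym (ℤ.*-zeroʳ (+ qᴸ))))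
    where
    g : L.Carrier → Carrier
    g b = e (tr (b L.* z) ℤ.- tr (b L.* z′))
    g-cong : ∀ {b b′} → b L.≈ b′ → g b ≈ g b′
    g-cong b≈b′ = e-cong (≅-sub (Lᵖ.tr-cong (L.*-congʳ b≈b′)) (Lᵖ.tr-cong (L.*-congʳ b≈b′)))
    S : Carrier
    S = sum (g ∘ L.element)
    g-+ : ∀ b b₀ → g (b L.+ b₀) ≈ g b₀ * g b
    g-+ b b₀ = trans (e-cong (≅-trans (≅-sub (≅-trans (Lᵖ.tr-cong (L.distribʳ z b b₀)) (Lᵖ.tr-+ _ _))
                                             (≅-trans (Lᵖ.tr-cong (L.distribʳ z′ b b₀)) (Lᵖ.tr-+ _ _)))
                                      (≡⇒≅ (lemma (tr (b L.* z)) (tr (b₀ L.* z)) (tr (b L.* z′)) (tr (b₀ L.* z′))))))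
                     (e-+ (tr (b₀ L.* z) ℤ.- tr (b₀ L.* z′)) (tr (b L.* z) ℤ.- tr (b L.* z′)))
      where lemma : ∀ x x₀ y y₀ → (x ℤ.+ x₀) ℤ.- (y ℤ.+ y₀) ≡ (x₀ ℤ.- y₀) ℤ.+ (x ℤ.- y)
            lemma = solve-∀
    vanish : ∃[ b₀ ] ¬ p∣ tr (b₀ L.* (z L.- z′)) → S ≈ 0#
    vanish (b₀ , p∤tr) = cancel ω-1≉0 (begin
      (g b₀ - 1#) * S                       ≈⟨ solve 2 (λ w s → (w :- con (+ 1)) :* s := w :* s :- s) refl (g b₀) S ⟩
      g b₀ * S - S                          ≈⟨ +-congʳ (trans (*-distribˡ-sum (g b₀) (g ∘ L.element)) (sum-cong-≋ λ i → sym (g-+ (L.element i) b₀))) ⟩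
      sum (λ i → g (L.element i L.+ b₀)) - S ≈⟨ +-congʳ (L-sums.reindex {L._+ b₀} {L._- b₀} L.+-congʳ L.+-congʳ undo₁ undo₂ g g-cong) ⟨
      S - S                                 ≈⟨ -‿inverseʳ S ⟩
      0#                                    ∎)
      where
      undo₁ : ∀ x → (x L.- b₀) L.+ b₀ L.≈ x
      undo₁ x = L.trans (L.+-assoc _ _ _) (L.trans (L.+-congˡ (L.-‿inverseˡ b₀)) (L.+-identityʳ x))
      undo₂ : ∀ x → (x L.+ b₀) L.- b₀ L.≈ x
      undo₂ x = L.trans (L.+-assoc _ _ _) (L.trans (L.+-congˡ (L.-‿inverseʳ b₀)) (L.+-identityʳ x))
      ω-1≉0 : ¬ g b₀ - 1# ≈ 0#
      ω-1≉0 ω-1≈0 = p∤tr (p∣-resp-≅ (tr-sub b₀ z z′) (e≈1⇒p∣ (begin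
        g b₀                    ≈⟨ solve 1 (λ x → x := (x :- con (+ 1)) :+ con (+ 1)) refl (g b₀) ⟩
        (g b₀ - 1#) + 1#        ≈⟨ +-congʳ ω-1≈0 ⟩
        0# + 1#                 ≈⟨ +-identityˡ 1# ⟩
        1#                      ∎)))

  fibre : L.Carrier → ℕ
  fibre y = K.card (λ x → f x L.≟ y)

  fibre-sum : ∀ y → ι (+ qᴸ ℤ.* + fibre y) ≈
                    sum λ j → e (ℤ.- tr (L.element j L.* y)) * V (L.element j)
  fibre-sum y = begin
    ι (+ qᴸ ℤ.* + fibre y)
      ≈⟨ sum-𝟙 (λ x → f x L.≟ y) (+ qᴸ) K.element ⟨
    sum (λ i → ι (+ qᴸ ℤ.* 𝟙 (f (K.element i) L.≟ y)))
      ≈⟨ sum-cong-≋ (λ i → sym (orthogonality (f (K.element i)) y)) ⟩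
    sum (λ i → sum λ j → e (tr (L.element j L.* f (K.element i)) ℤ.- tr (L.element j L.* y)))
      ≈⟨ ∑-comm (λ i j → e (tr (L.element j L.* f (K.element i)) ℤ.- tr (L.element j L.* y))) ⟩
    sum (λ j → sum λ i → e (tr (L.element j L.* f (K.element i)) ℤ.- tr (L.element j L.* y)))
      ≈⟨ sum-cong-≋ (λ j → sum-cong-≋ λ i → trans (e-+ (tr (L.element j L.* f (K.element i))) (ℤ.- tr (L.element j L.* y))) (*-comm _ _)) ⟩
    sum (λ j → sum λ i → e (ℤ.- tr (L.element j L.* y)) * e (tr (L.element j L.* f (K.element i))))
      ≈⟨ sum-cong-≋ (λ j → sym (*-distribˡ-sum (e (ℤ.- tr (L.element j L.* y))) (λ i → e (tr (L.element j L.* f (K.element i)))))) ⟩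
    sum (λ j → e (ℤ.- tr (L.element j L.* y)) * V (L.element j)) ∎

  -- Values with a common factor A: an integer multiple of A

  module FixedPhase
    (A : Carrier) (σ : ℤ) (σ≢0 : σ ≢ + 0) (A²≈σpⁿ : A * A ≈ ι (σ ℤ.* + qᴷ))
    (phase : L.Carrier → ℤ) (V≈ : ∀ y → ¬ y L.≈ L.0# → V y ≈ A * e (phase y)) where

    A≉0 : ¬ A ≈ 0#
    A≉0 A≈0 = Sum.[ σ≢0 , (λ qᴷ≡0 → ℕ.≢-nonZero⁻¹ qᴷ {{ℕ.m^n≢0 p n}} (ℤ.+-injective qᴷ≡0)) ] (ℤ.i*j≡0⇒i≡0∨j≡0 σ (char-0 (begin
      ι (σ ℤ.* + qᴷ)    ≈⟨ A²≈σpⁿ ⟨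
      A * A             ≈⟨ *-congʳ A≈0 ⟩
      0# * A            ≈⟨ zeroˡ A ⟩
      0#                ∎)))

    t : Fin qᴷ → ℤ
    t i = tr (f (K.element i))

    r : ℤ
    r = phase L.1#

    -- The conjugate of `S (+ 1)` under ζ ↦ ζ^k, and at the same time, by `S≈V`, the value of `V` at
    -- a scalar of the prime field. Comparing the two readings is the point.
    S : ℤ → Carrier
    S k = sum {qᴷ} λ i → e (k ℤ.* t i)

    S≈V : ∀ k → S (+ k) ≈ V (Lι.ι (+ k))
    S≈V k = sum-cong-≋ {qᴷ} λ i → e-cong (≅-sym (Lᵖ.tr-ι* k (f (K.element i))))

    S1≈ : S (+ 1) ≈ A * e r
    S1≈ = trans (S≈V 1) (V≈ L.1# (L.0≉1 ∘ L.sym))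

    -- `l₂` encodes S(1)² - A² ζ^(2r) with A² written as the integer σ p^n, which replacing ζ by ζ^c
    -- does not touch.
    l₁ l₂ : List (ℤ × ℤ)
    l₁ = List.tabulate λ i → + 1 , t i
    l₂ = (l₁ ⊗ l₁) ++ ((ℤ.- (σ ℤ.* + qᴷ) , r ℤ.+ r) ∷ [])

    ev-l₂ : ∀ {φ} → Multiplicative φ → ev φ l₂ ≈ sum (φ ∘ t) * sum (φ ∘ t) - (A * A) * φ (r ℤ.+ r)
    ev-l₂ {φ} φ-+ = begin
      ev φ l₂
        ≈⟨ ev-++ φ (l₁ ⊗ l₁) _ ⟩
      ev φ (l₁ ⊗ l₁) + (ι (ℤ.- (σ ℤ.* + qᴷ)) * φ (r ℤ.+ r) + 0#)
        ≈⟨ +-cong (trans (ev-⊗ φ-+ l₁ l₁) (*-cong ev-l₁ ev-l₁))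
                  (trans (+-identityʳ _) (*-congʳ (trans (ι-homo-neg (σ ℤ.* + qᴷ)) (-‿cong (sym A²≈σpⁿ))))) ⟩
      sum (φ ∘ t) * sum (φ ∘ t) + (- (A * A)) * φ (r ℤ.+ r)
        ≈⟨ solve 3 (λ s x y → s :+ (:- x) :* y := s :- x :* y) refl _ (A * A) (φ (r ℤ.+ r)) ⟩
      sum (φ ∘ t) * sum (φ ∘ t) - (A * A) * φ (r ℤ.+ r) ∎
      where
      ev-l₁ : ev φ l₁ ≈ sum (φ ∘ t)
      ev-l₁ = trans (ev-tabulate φ (λ i → + 1 , t i)) (sum-cong-≋ {qᴷ} λ i → *-identityˡ _)

    l₂≈0 : ev e l₂ ≈ 0#
    l₂≈0 = begin
      ev e l₂
        ≈⟨ ev-l₂ e-+ ⟩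
      sum (e ∘ t) * sum (e ∘ t) - (A * A) * e (r ℤ.+ r)
        ≈⟨ +-cong (*-cong S1 S1) (-‿cong (*-congˡ (e-+ r r))) ⟩
      (A * e r) * (A * e r) - (A * A) * (e r * e r)
        ≈⟨ solve 2 (λ a x → (a :* x) :* (a :* x) :- (a :* a) :* (x :* x) := con (+ 0)) refl A (e r) ⟩
      0# ∎
      where
      S1 : sum (e ∘ t) ≈ A * e r
      S1 = trans (sum-cong-≋ {qᴷ} λ i → reflexive (≡.cong e (≡.sym (ℤ.*-identityˡ (t i))))) S1≈

    S²≈ : ∀ {k} → ¬ p∣ k → S k * S k ≈ (A * A) * e (k ℤ.* (r ℤ.+ r))
    S²≈ {k} p∤k = begin
      S k * S k                                     ≈⟨ solve 2 (λ x y → x := (x :- y) :+ y) refl _ _ ⟩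
      (S k * S k - (A * A) * e (k ℤ.* (r ℤ.+ r))) + (A * A) * e (k ℤ.* (r ℤ.+ r))
                                                    ≈⟨ +-congʳ (trans (sym (ev-l₂ twisted)) (galois p∤k l₂ l₂≈0)) ⟩
      0# + (A * A) * e (k ℤ.* (r ℤ.+ r))            ≈⟨ +-identityˡ _ ⟩
      (A * A) * e (k ℤ.* (r ℤ.+ r))                 ∎
      where
      twisted : Multiplicative (λ u → e (k ℤ.* u))
      twisted u v = trans (reflexive (≡.cong e (ℤ.*-distribˡ-+ k u v))) (e-+ (k ℤ.* u) (k ℤ.* v))

    -- Squaring loses the sign of S k, but −1 is not a power of ζ for odd p,
    -- and for p = 2 only k = 1 occurs.
    S≈ : ∀ {k} → 1 ℕ.≤ k → k ℕ.< p → S (+ k) ≈ A * e (+ k ℤ.* r)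
    S≈ {1} _ _ = trans S1≈ (*-congˡ (reflexive (≡.cong e (≡.sym (ℤ.*-identityˡ r)))))
    S≈ {k@(suc (suc _))} 1≤k k<p = trans Sk≈ (*-congˡ (e-cong r′≅kr))
      where
      p∤k : ¬ p∣ + k
      p∤k p∣k with () ← small-multiple k<p p∣k
      r′ : ℤ
      r′ = phase (Lι.ι (+ k))
      Sk≈ : S (+ k) ≈ A * e r′
      Sk≈ = trans (S≈V k) (V≈ _ (p∤k ∘ Lᵖ.ι≈0⇒p∣))
      doubled : r′ ℤ.+ r′ ≅ + k ℤ.* (r ℤ.+ r)
      doubled = e-injective (cancelˡ A≉0 (cancelˡ A≉0 (begin
        A * (A * e (r′ ℤ.+ r′))               ≈⟨ *-congˡ (*-congˡ (e-+ r′ r′)) ⟩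
        A * (A * (e r′ * e r′))               ≈⟨ solve 2 (λ a x → a :* (a :* (x :* x)) := (a :* x) :* (a :* x)) refl A (e r′) ⟩
        (A * e r′) * (A * e r′)               ≈⟨ *-cong Sk≈ Sk≈ ⟨
        S (+ k) * S (+ k)                     ≈⟨ S²≈ p∤k ⟩
        (A * A) * e (+ k ℤ.* (r ℤ.+ r))       ≈⟨ *-assoc _ _ _ ⟩
        A * (A * e (+ k ℤ.* (r ℤ.+ r)))       ∎)))
      lemma : ∀ r′ k r → (r′ ℤ.+ r′) ℤ.- k ℤ.* (r ℤ.+ r) ≡ + 2 ℤ.* (r′ ℤ.- k ℤ.* r)
      lemma = solve-∀
      p∤2 : ¬ p∣ + 2
      p∤2 p∣2 with () ← small-multiple (ℕ.≤-<-trans (ℕ.s≤s (ℕ.s≤s ℕ.z≤n)) k<p) p∣2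
      r′≅kr : r′ ≅ + k ℤ.* r
      r′≅kr = Sum.[ (λ p∣2 → contradiction p∣2 p∤2) , congruent ]′
        (p∣m*n (+ 2) (r′ ℤ.- + k ℤ.* r) (≡.subst p∣_ (lemma r′ (+ k) r) (difference doubled)))

    IsInteger : Carrier → Set ℓ
    IsInteger x = ∃[ z ] x ≈ ι z

    integer-sum : ∀ {k} (g : Fin k → Carrier) → (∀ i → IsInteger (g i)) → IsInteger (sum g)
    integer-sum {zero}  g g∈ = + 0 , refl
    integer-sum {suc k} g g∈ = add (g∈ Fin.zero) (integer-sum (g ∘ Fin.suc) (g∈ ∘ Fin.suc))
      where
      add : IsInteger (g Fin.zero) → IsInteger (sum (g ∘ Fin.suc)) → IsInteger (sum g)
      add (y , y≈) (z , z≈) = y ℤ.+ z , trans (+-cong y≈ z≈) (sym (ι-homo-+ y z))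

    ∑e-integer : ∀ d → IsInteger (sum {p} λ j → e (d ℤ.* + toℕ j))
    ∑e-integer d with + p ℤ∣.∣? d
    ... | no  p∤d = + 0 , ∑e[c*]≈0 p∤d
    ... | yes p∣d = + p , (begin
      sum {p} (λ j → e (d ℤ.* + toℕ j))   ≈⟨ sum-cong-≋ {p} (λ j → trans (e-cong (p∣⇒≅0 (ℤ∣.∣m⇒∣m*n (+ toℕ j) p∣d))) e-0) ⟩
      sum {p} (λ _ → 1#)                  ≈⟨ sum-const p 1# ⟩
      ι (+ p) * 1#                        ≈⟨ *-identityʳ _ ⟩
      ι (+ p)                             ∎)

    [p-1]A-integer : IsInteger (ι (+ ℕ.pred p) * A)
    [p-1]A-integer = isolate (integer-sum (λ i → sum {p} λ j → e ((t i ℤ.- r) ℤ.* + toℕ j)) (λ i → ∑e-integer (t i ℤ.- r)))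
      where
      G : ℕ → Carrier
      G k = e (ℤ.- (+ k ℤ.* r)) * S (+ k)
      -- The term k = 0 is p^n and not A, so only p - 1 copies of A enter the sum.
      G0≈ : G 0 ≈ ι (+ qᴷ)
      G0≈ = begin
        e (ℤ.- (+ 0 ℤ.* r)) * S (+ 0)   ≈⟨ *-cong (trans (reflexive (≡.cong (e ∘ ℤ.-_) (ℤ.*-zeroˡ r))) e-0)
                                                  (trans (S≈V 0) (V-0 L.refl)) ⟩
        1# * ι (+ qᴷ)                   ≈⟨ *-identityˡ _ ⟩
        ι (+ qᴷ)                        ∎
      G≈ : ∀ {k} → 1 ℕ.≤ k → k ℕ.< p → G k ≈ A
      G≈ {k} 1≤k k<p = begin
        e (ℤ.- (+ k ℤ.* r)) * S (+ k)                   ≈⟨ *-congˡ (S≈ 1≤k k<p) ⟩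
        e (ℤ.- (+ k ℤ.* r)) * (A * e (+ k ℤ.* r))       ≈⟨ solve 3 (λ x a y → x :* (a :* y) := a :* (y :* x)) refl _ A _ ⟩
        A * (e (+ k ℤ.* r) * e (ℤ.- (+ k ℤ.* r)))       ≈⟨ *-congˡ (e-inverse (+ k ℤ.* r)) ⟩
        A * 1#                                          ≈⟨ *-identityʳ A ⟩
        A                                               ∎
      ∑G≈ : ∀ p′ → suc p′ ≡ p → sum {suc p′} (G ∘ toℕ) ≈ ι (+ qᴷ) + ι (+ p′) * A
      ∑G≈ p′ 1+p′≡p = +-cong G0≈ (trans
        (sum-cong-≋ {p′} λ j → G≈ (ℕ.s≤s ℕ.z≤n) (≡.subst (suc (toℕ j) ℕ.<_) 1+p′≡p (ℕ.s<s (Fin.toℕ<n j))))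
        (sum-const p′ A))
      ∑G-double : sum {p} (G ∘ toℕ) ≈ sum λ i → sum {p} λ j → e ((t i ℤ.- r) ℤ.* + toℕ j)
      ∑G-double = begin
        sum {p} (G ∘ toℕ)
          ≈⟨ sum-cong-≋ {p} (λ j → *-distribˡ-sum (e (ℤ.- (+ toℕ j ℤ.* r))) (λ i → e (+ toℕ j ℤ.* t i))) ⟩
        sum {p} (λ j → sum λ i → e (ℤ.- (+ toℕ j ℤ.* r)) * e (+ toℕ j ℤ.* t i))
          ≈⟨ sum-cong-≋ {p} (λ j → sum-cong-≋ λ i → trans (sym (e-+ (ℤ.- (+ toℕ j ℤ.* r)) (+ toℕ j ℤ.* t i)))
                                                        (reflexive (≡.cong e (lemma (+ toℕ j) r (t i))))) ⟩
        sum {p} (λ j → sum λ i → e ((t i ℤ.- r) ℤ.* + toℕ j))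
          ≈⟨ ∑-comm {p} (λ j i → e ((t i ℤ.- r) ℤ.* + toℕ j)) ⟩
        sum (λ i → sum {p} λ j → e ((t i ℤ.- r) ℤ.* + toℕ j)) ∎
        where
        lemma : ∀ j r t → ℤ.- (j ℤ.* r) ℤ.+ j ℤ.* t ≡ (t ℤ.- r) ℤ.* j
        lemma = solve-∀
      isolate : IsInteger (sum λ i → sum {p} λ j → e ((t i ℤ.- r) ℤ.* + toℕ j)) → IsInteger (ι (+ ℕ.pred p) * A)
      isolate (z , ∑≈z) = z ℤ.- + qᴷ , (begin
        ι (+ ℕ.pred p) * A
          ≈⟨ solve 2 (λ x y → y := (x :+ y) :- x) refl (ι (+ qᴷ)) _ ⟩
        (ι (+ qᴷ) + ι (+ ℕ.pred p) * A) - ι (+ qᴷ)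
          ≈⟨ +-congʳ (∑G≈ (ℕ.pred p) (ℕ.suc-pred p)) ⟨
        sum {suc (ℕ.pred p)} (G ∘ toℕ) - ι (+ qᴷ)
          ≡⟨ ≡.cong (λ k → sum {k} (G ∘ toℕ) - ι (+ qᴷ)) (ℕ.suc-pred p) ⟩
        sum {p} (G ∘ toℕ) - ι (+ qᴷ)
          ≈⟨ +-congʳ (trans ∑G-double ∑≈z) ⟩
        ι z - ι (+ qᴷ)
          ≈⟨ ι-homo-sub z (+ qᴷ) ⟨
        ι (z ℤ.- + qᴷ) ∎)

    -- Squaring leaves an equation between integers, from which the sign σ and the parity of n can
    -- be read off. The factor p - 1 stays, because so far only (p - 1) A is known to be an integer.
    square-relation : ∃[ z ] (ι (+ ℕ.pred p) * A ≈ ι z) × z ℤ.* z ≡ (+ ℕ.pred p ℤ.* + ℕ.pred p) ℤ.* (σ ℤ.* + qᴷ)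
    square-relation = square [p-1]A-integer
      where
      square : IsInteger (ι (+ ℕ.pred p) * A) → ∃[ z ] (ι (+ ℕ.pred p) * A ≈ ι z) × z ℤ.* z ≡ (+ ℕ.pred p ℤ.* + ℕ.pred p) ℤ.* (σ ℤ.* + qᴷ)
      square (z , x≈z) = z , x≈z , ι-injective (begin
        ι (z ℤ.* z)                                   ≈⟨ ι-homo-* z z ⟩
        ι z * ι z                                     ≈⟨ *-cong x≈z x≈z ⟨
        (ι k * A) * (ι k * A)                         ≈⟨ solve 2 (λ k a → (k :* a) :* (k :* a) := (k :* k) :* (a :* a)) refl (ι k) A ⟩
        (ι k * ι k) * (A * A)                         ≈⟨ *-cong (sym (ι-homo-* k k)) A²≈σpⁿ ⟩
        ι (k ℤ.* k) * ι (σ ℤ.* + qᴷ)                  ≈⟨ ι-homo-* (k ℤ.* k) (σ ℤ.* + qᴷ) ⟨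
        ι ((k ℤ.* k) ℤ.* (σ ℤ.* + qᴷ))                ∎)
        where k = + ℕ.pred p

    -- A an integer: distribution of the exponents over the residues

    module IntegerPhase (B : ℤ) (A≈B : A ≈ ι B) where

      B≢0 : B ≢ + 0
      B≢0 B≡0 = A≉0 (trans A≈B (ι-cong B≡0))

      s : L.Carrier → L.Carrier → ℤ
      s y b = phase b ℤ.- tr (b L.* y)

      InLevel : L.Carrier → ℕ → Pred L.Carrier ℓ₂
      InLevel y j b = ¬ b L.≈ L.0# × s y b %ℕ p ≡ j

      inLevel? : ∀ y j → Decidable (InLevel y j)
      inLevel? y j b = ¬? (b L.≟ L.0#) ×-dec (s y b %ℕ p ℕ.≟ j)

      N : L.Carrier → ℕ → ℕ
      N y j = L.card (inLevel? y j)

      -- The element b = 0 is kept with coefficient 0, so that the list can run through the whole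
      -- enumeration of the field.
      term : L.Carrier → L.Carrier → ℤ × ℤ
      term y b = B ℤ.* 𝟙 (¬? (b L.≟ L.0#)) , s y b

      -- By Fourier inversion this is minus the sum of the terms with b ≠ 0. Placed at the exponent
      -- 0, it completes them to a vanishing combination.
      deficit : L.Carrier → ℤ
      deficit y = + qᴷ ℤ.- + qᴸ ℤ.* + fibre y

      l : L.Carrier → List (ℤ × ℤ)
      l y = (deficit y , + 0) ∷ List.tabulate (term y ∘ L.element)

      termCoef-𝟙 : ∀ {ℓ₃} {P : Set ℓ₃} (d : Dec P) u j →
                   termCoef j (B ℤ.* 𝟙 d , u) ≡ B ℤ.* 𝟙 (d ×-dec (u %ℕ p ℕ.≟ j))
      termCoef-𝟙 d u j with u %ℕ p ℕ.≟ j
      termCoef-𝟙 (yes _) u j | yes _ = ≡.refl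
      termCoef-𝟙 (no  _) u j | yes _ = ≡.refl
      termCoef-𝟙 (yes _) u j | no  _ = ≡.sym (ℤ.*-zeroʳ B)
      termCoef-𝟙 (no  _) u j | no  _ = ≡.sym (ℤ.*-zeroʳ B)

      coef-terms : ∀ y j {k} (x : Fin k → L.Carrier) →
                   coef j (List.tabulate (term y ∘ x)) ≡ B ℤ.* + count (inLevel? y j) (Vec.tabulate x)
      coef-terms y j {zero}  x = ≡.sym (ℤ.*-zeroʳ B)
      coef-terms y j {suc k} x =
        ≡.trans (≡.cong₂ ℤ._+_ (termCoef-𝟙 (¬? (x Fin.zero L.≟ L.0#)) (s y (x Fin.zero)) j) (coef-terms y j (x ∘ Fin.suc)))
          (≡.trans (≡.sym (ℤ.*-distribˡ-+ B (𝟙 (inLevel? y j (x Fin.zero))) (+ count (inLevel? y j) (Vec.tabulate (x ∘ Fin.suc)))))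
            (≡.cong (B ℤ.*_) (≡.sym (count-∷ (inLevel? y j) (x Fin.zero) (Vec.tabulate (x ∘ Fin.suc))))))

      sum-at-0 : ∀ w → sum {qᴸ} (λ i → ι (w ℤ.* 𝟙 (L.element i L.≟ L.0#))) ≈ ι w
      sum-at-0 w = trans (L-sums.sum-only-element g g-cong L.0# (λ y → g-≉0)) (g-0 L.refl)
        where
        g : L.Carrier → Carrier
        g b = ι (w ℤ.* 𝟙 (b L.≟ L.0#))
        g-0 : ∀ {b} → b L.≈ L.0# → g b ≈ ι w
        g-0 {b} b≈0 with b L.≟ L.0#
        ... | yes _   = ι-cong (ℤ.*-identityʳ w)
        ... | no  b≉0 = contradiction b≈0 b≉0
        g-≉0 : ∀ {b} → ¬ b L.≈ L.0# → g b ≈ 0#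
        g-≉0 {b} b≉0 with b L.≟ L.0#
        ... | yes b≈0 = contradiction b≈0 b≉0
        ... | no  _   = ι-cong (ℤ.*-zeroʳ w)
        g-cong : ∀ {b b′} → b L.≈ b′ → g b ≈ g b′
        g-cong {b} {b′} b≈b′ with b′ L.≟ L.0#
        ... | yes b′≈0 = trans (g-0 (L.trans b≈b′ b′≈0)) (ι-cong (≡.sym (ℤ.*-identityʳ w)))
        ... | no  b′≉0 = trans (g-≉0 (b′≉0 ∘ L.trans (L.sym b≈b′))) (ι-cong (≡.sym (ℤ.*-zeroʳ w)))

      split-V : ∀ y b → e (ℤ.- tr (b L.* y)) * V b ≈
                ι (proj₁ (term y b)) * e (s y b) + ι (+ qᴷ ℤ.* 𝟙 (b L.≟ L.0#))
      split-V y b with b L.≟ L.0#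
      ... | yes b≈0 = begin
        e (ℤ.- tr (b L.* y)) * V b
          ≈⟨ *-cong (trans (e-cong (≅-neg (≅-trans (Lᵖ.tr-cong (L.trans (L.*-congʳ b≈0) (L.zeroˡ y))) Lᵖ.tr-0))) e-0) (V-0 b≈0) ⟩
        1# * ι (+ qᴷ)
          ≈⟨ solve 2 (λ x y → con (+ 1) :* x := con (+ 0) :* y :+ x) refl (ι (+ qᴷ)) (e (s y b)) ⟩
        0# * e (s y b) + ι (+ qᴷ)
          ≈⟨ +-cong (*-congʳ (ι-cong (ℤ.*-zeroʳ B))) (ι-cong (ℤ.*-identityʳ (+ qᴷ))) ⟨
        ι (B ℤ.* + 0) * e (s y b) + ι (+ qᴷ ℤ.* + 1) ∎
      ... | no  b≉0 = begin
        e (ℤ.- tr (b L.* y)) * V b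
          ≈⟨ *-congˡ (trans (V≈ b b≉0) (*-congʳ A≈B)) ⟩
        e (ℤ.- tr (b L.* y)) * (ι B * e (phase b))
          ≈⟨ solve 3 (λ x b y → x :* (b :* y) := b :* (y :* x) :+ con (+ 0)) refl _ (ι B) (e (phase b)) ⟩
        ι B * (e (phase b) * e (ℤ.- tr (b L.* y))) + 0#
          ≈⟨ +-cong (*-cong (ι-cong (≡.sym (ℤ.*-identityʳ B))) (sym (e-+ (phase b) (ℤ.- tr (b L.* y))))) (ι-cong (≡.sym (ℤ.*-zeroʳ (+ qᴷ)))) ⟩
        ι (B ℤ.* + 1) * e (s y b) + ι (+ qᴷ ℤ.* + 0) ∎

      l≈0 : ∀ y → ev e (l y) ≈ 0#
      l≈0 y = begin
        ι (deficit y) * e (+ 0) + ev e (List.tabulate (term y ∘ L.element))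
          ≈⟨ +-cong (trans (*-congˡ e-0) (trans (*-identityʳ _) (ι-homo-sub (+ qᴷ) (+ qᴸ ℤ.* + fibre y)))) (ev-tabulate e (term y ∘ L.element)) ⟩
        (ι (+ qᴷ) - ι (+ qᴸ ℤ.* + fibre y)) + T′
          ≈⟨ +-congʳ (+-congˡ (-‿cong fibre≈)) ⟩
        (ι (+ qᴷ) - (T′ + ι (+ qᴷ))) + T′
          ≈⟨ solve 2 (λ q t → (q :- (t :+ q)) :+ t := con (+ 0)) refl (ι (+ qᴷ)) T′ ⟩
        0# ∎
        where
        g : Fin qᴸ → Carrier
        g i = ι (proj₁ (term y (L.element i))) * e (s y (L.element i))
        T′ : Carrier
        T′ = sum g
        fibre≈ : ι (+ qᴸ ℤ.* + fibre y) ≈ T′ + ι (+ qᴷ)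
        fibre≈ = begin
          ι (+ qᴸ ℤ.* + fibre y)
            ≈⟨ fibre-sum y ⟩
          sum (λ i → e (ℤ.- tr (L.element i L.* y)) * V (L.element i))
            ≈⟨ sum-cong-≋ {qᴸ} (λ i → split-V y (L.element i)) ⟩
          sum (λ i → g i + ι (+ qᴷ ℤ.* 𝟙 (L.element i L.≟ L.0#)))
            ≈⟨ ∑-distrib-+ g (λ i → ι (+ qᴷ ℤ.* 𝟙 (L.element i L.≟ L.0#))) ⟩
          T′ + sum {qᴸ} (λ i → ι (+ qᴷ ℤ.* 𝟙 (L.element i L.≟ L.0#)))
            ≈⟨ +-congˡ (sum-at-0 (+ qᴷ)) ⟩
          T′ + ι (+ qᴷ) ∎

      -- The residue 1 represents all nonzero residues: the deficit sits at the residue 0 only.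
      coef-l-1 : ∀ y → coef 1 (l y) ≡ B ℤ.* + N y 1
      coef-l-1 y = ≡.trans (≡.cong₂ ℤ._+_ (termCoef-≢ (deficit y) {+ 0} 0≢1) (coef-terms y 1 L.element)) (ℤ.+-identityˡ _)
        where
        0≢1 : + 0 %ℕ p ≢ 1
        0≢1 eq with () ← ≡.trans (≡.sym (%-small {0} {+ 0} (ℕ.<-trans (ℕ.s≤s ℕ.z≤n) 1<p) (≡⇒≅ ≡.refl))) eq

      coef-l-0 : ∀ y → coef 0 (l y) ≡ deficit y ℤ.+ B ℤ.* + N y 0
      coef-l-0 y = ≡.cong₂ ℤ._+_ (termCoef-≡ (deficit y) {+ 0} (%-small {0} {+ 0} (ℕ.<-trans (ℕ.s≤s ℕ.z≤n) 1<p) (≡⇒≅ ≡.refl)))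
                                 (coef-terms y 0 L.element)

      -- The coefficients of l y all agree, so their sum is p times the
      -- coefficient of ζ; the sum is also the value of l y at ζ = 1.
      fibre-equation : ∀ y → + p ℤ.* (B ℤ.* + N y 1) ≡ deficit y ℤ.+ (+ qᴸ ℤ.- + 1) ℤ.* B
      fibre-equation y = ι-injective (begin
        ι (+ p ℤ.* (B ℤ.* + N y 1))
          ≈⟨ ι-homo-* (+ p) (B ℤ.* + N y 1) ⟩
        ι (+ p) * ι (B ℤ.* + N y 1)
          ≈⟨ sum-const p _ ⟨
        sum {p} (λ _ → ι (B ℤ.* + N y 1))
          ≈⟨ sum-cong-≋ {p} (λ j → trans (ι-cong (≡.trans (≡.sym (coef-l-1 y))
               (≡.trans (coef-constant (l y) (l≈0 y) 1<p) (≡.sym (coef-constant (l y) (l≈0 y) (Fin.toℕ<n j)))))) (sym (*-identityʳ _))) ⟩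
        sum {p} (λ j → ι (coef (toℕ j) (l y)) * 1#)
          ≈⟨ ev-coef (λ _ → refl) (l y) ⟨
        ι (deficit y) * 1# + ev (λ _ → 1#) (List.tabulate (term y ∘ L.element))
          ≈⟨ +-cong (*-identityʳ _) (ev-tabulate (λ _ → 1#) (term y ∘ L.element)) ⟩
        ι (deficit y) + sum {qᴸ} (λ i → ι (proj₁ (term y (L.element i))) * 1#)
          -- At ζ = 1 every element contributes B except b = 0. Adding and subtracting the missing B
          -- produces the factor q - 1.
          ≈⟨ +-congˡ (begin
            sum {qᴸ} (λ i → ι (proj₁ (term y (L.element i))) * 1#)
              ≈⟨ solve 2 (λ x b → x := (x :+ b) :- b) refl _ (ι B) ⟩
            (sum {qᴸ} (λ i → ι (proj₁ (term y (L.element i))) * 1#) + ι B) - ι B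
              ≈⟨ +-congʳ (+-congˡ (sum-at-0 B)) ⟨
            (sum {qᴸ} (λ i → ι (proj₁ (term y (L.element i))) * 1#) + sum {qᴸ} (λ i → ι (B ℤ.* 𝟙 (L.element i L.≟ L.0#)))) - ι B
              ≈⟨ +-congʳ (∑-distrib-+ {qᴸ} _ _) ⟨
            sum {qᴸ} (λ i → ι (proj₁ (term y (L.element i))) * 1# + ι (B ℤ.* 𝟙 (L.element i L.≟ L.0#))) - ι B
              ≈⟨ +-congʳ (sum-cong-≋ {qᴸ} (λ i → complement (L.element i))) ⟩
            sum {qᴸ} (λ _ → ι B) - ι B
              ≈⟨ +-congʳ (sum-const qᴸ (ι B)) ⟩
            ι (+ qᴸ) * ι B - ι B
              ≈⟨ solve 2 (λ q b → q :* b :- b := (q :- con (+ 1)) :* b) refl (ι (+ qᴸ)) (ι B) ⟩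
            (ι (+ qᴸ) - 1#) * ι B
              ≈⟨ *-congʳ (ι-homo-sub (+ qᴸ) (+ 1)) ⟨
            ι (+ qᴸ ℤ.- + 1) * ι B
              ≈⟨ ι-homo-* (+ qᴸ ℤ.- + 1) B ⟨
            ι ((+ qᴸ ℤ.- + 1) ℤ.* B) ∎) ⟩
        ι (deficit y) + ι ((+ qᴸ ℤ.- + 1) ℤ.* B)
          ≈⟨ ι-homo-+ (deficit y) ((+ qᴸ ℤ.- + 1) ℤ.* B) ⟨
        ι (deficit y ℤ.+ (+ qᴸ ℤ.- + 1) ℤ.* B) ∎)
        where
        complement : ∀ b → ι (B ℤ.* 𝟙 (¬? (b L.≟ L.0#))) * 1# + ι (B ℤ.* 𝟙 (b L.≟ L.0#)) ≈ ι B
        complement b with b L.≟ L.0#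
        ... | yes _ = trans (+-cong (trans (*-identityʳ _) (ι-cong (ℤ.*-zeroʳ B))) (ι-cong (ℤ.*-identityʳ B))) (+-identityˡ _)
        ... | no  _ = trans (+-cong (trans (*-identityʳ _) (ι-cong (ℤ.*-identityʳ B))) (ι-cong (ℤ.*-zeroʳ B))) (+-identityʳ _)

      -- The q - 1 nonzero elements split into those at the residue 0 and p - 1 classes of the
      -- common size `N y 1`. It results from eliminating the fibre size out of two equations
      -- between coefficients.
      count-equation : ∀ y → + N y 0 ℤ.+ (+ p ℤ.- + 1) ℤ.* + N y 1 ≡ + qᴸ ℤ.- + 1
      count-equation y = eliminate-deficit {B} {+ N y 0} {+ N y 1} {+ p} {deficit y} {+ qᴸ ℤ.- + 1} B≢0 (fibre-equation y)
        (≡.trans (≡.sym (coef-l-0 y)) (≡.trans (≡.sym (coef-constant (l y) (l≈0 y) 1<p)) (coef-l-1 y)))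

-- Arithmetic of the resulting integer equations

square-injective : ∀ {m n} → m ℕ.* m ≡ n ℕ.* n → m ≡ n
square-injective {m} {n} m²≡n² with ℕ.<-cmp m n
... | tri< m<n _ _ = contradiction m²≡n² (ℕ.<⇒≢ (ℕ.*-mono-< m<n m<n))
... | tri≈ _ m≡n _ = m≡n
... | tri> _ _ n<m = contradiction (≡.sym m²≡n²) (ℕ.<⇒≢ (ℕ.*-mono-< n<m n<m))

module Arithmetic {p : ℕ} (p-prime : Prime p) where
  open Congruence p-prime

  -- As long as p divides w², it divides w, so factors p leave the right side in pairs. The cofactor
  -- k will be p - 1.
  square-p^-even : ∀ {k} → ¬ p ℕ∣.∣ k → ∀ n {w} → w ℕ.* w ≡ k ℕ.* k ℕ.* p ℕ.^ n →
                   ∃[ h ] n ≡ h ℕ.+ h × w ≡ k ℕ.* p ℕ.^ h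
  square-p^-even {k} p∤k zero {w} w²≡ =
    0 , ≡.refl , ≡.trans (square-injective (≡.trans w²≡ (ℕ.*-identityʳ (k ℕ.* k)))) (≡.sym (ℕ.*-identityʳ k))
  square-p^-even {k} p∤k (suc n) {w} w²≡
    with Sum.[ id , id ]′ (euclidsLemma w w p-prime (ℕ∣.divides (k ℕ.* k ℕ.* p ℕ.^ n) (≡.trans w²≡ (lemma k p (p ℕ.^ n)))))
    where
    lemma : ∀ k p x → k ℕ.* k ℕ.* (p ℕ.* x) ≡ k ℕ.* k ℕ.* x ℕ.* p
    lemma = ℕ-Solver.solve-∀
  ... | ℕ∣.divides v ≡.refl = descend n (ℕ.*-cancelʳ-≡ _ _ p (≡.trans (lemma₁ v p) (≡.trans w²≡ (lemma₂ k p (p ℕ.^ n)))))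
    where
    lemma₁ : ∀ v p → v ℕ.* v ℕ.* p ℕ.* p ≡ v ℕ.* p ℕ.* (v ℕ.* p)
    lemma₁ = ℕ-Solver.solve-∀
    lemma₂ : ∀ k p x → k ℕ.* k ℕ.* (p ℕ.* x) ≡ k ℕ.* k ℕ.* x ℕ.* p
    lemma₂ = ℕ-Solver.solve-∀
    descend : ∀ n → v ℕ.* v ℕ.* p ≡ k ℕ.* k ℕ.* p ℕ.^ n → ∃[ h ] suc n ≡ h ℕ.+ h × v ℕ.* p ≡ k ℕ.* p ℕ.^ h
    -- A single remaining factor p would have to divide k².
    descend zero eq = contradiction
      (Sum.[ id , id ]′ (euclidsLemma k k p-prime (ℕ∣.divides (v ℕ.* v) (≡.trans (≡.sym (ℕ.*-identityʳ (k ℕ.* k))) (≡.sym eq))))) p∤k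
    descend (suc n) eq with square-p^-even p∤k n {v} (ℕ.*-cancelʳ-≡ _ _ p (≡.trans eq (lemma₂ k p (p ℕ.^ n))))
    ... | h , n≡h+h , v≡ = suc h , ≡.cong suc (≡.trans (≡.cong suc n≡h+h) (≡.sym (ℕ.+-suc h h)))
                         , ≡.trans (≡.cong (ℕ._* p) v≡) (lemma₃ k p (p ℕ.^ h))
      where
      lemma₃ : ∀ k p x → k ℕ.* x ℕ.* p ≡ k ℕ.* (p ℕ.* x)
      lemma₃ = ℕ-Solver.solve-∀

  p∤p-1 : ¬ p ℕ∣.∣ ℕ.pred p
  p∤p-1 p∣p-1 = ℕ.<⇒≱ (ℕ.≤-reflexive (ℕ.suc-pred p)) (ℕ∣.∣⇒≤ {{ℕ.>-nonZero (ℕ.pred-mono-≤ 1<p)}} p∣p-1)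

  integer-square-root : ∀ n {σ z} → σ ≡ + 1 ⊎ σ ≡ ℤ.- + 1 →
    z ℤ.* z ≡ (+ ℕ.pred p ℤ.* + ℕ.pred p) ℤ.* (σ ℤ.* + (p ℕ.^ n)) →
    σ ≡ + 1 × ∃[ h ] n ≡ h ℕ.+ h × ∃[ τ ] (τ ≡ + 1 ⊎ τ ≡ ℤ.- + 1) × z ≡ + ℕ.pred p ℤ.* (τ ℤ.* + (p ℕ.^ h))
  integer-square-root n {σ} {z} σ≡±1 z²≡ = sign σ≡±1
    where
    open ≡-Reasoning
    k = ℕ.pred p
    lemma : ∀ k x → (k ℤ.* k) ℤ.* ((ℤ.- + 1) ℤ.* x) ≡ ℤ.- (k ℤ.* k ℤ.* x)
    lemma = solve-∀
    lemma′ : ∀ k x → (k ℤ.* k) ℤ.* (+ 1 ℤ.* x) ≡ k ℤ.* k ℤ.* x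
    lemma′ = solve-∀
    pos : + k ℤ.* + k ℤ.* + (p ℕ.^ n) ≡ + (k ℕ.* k ℕ.* p ℕ.^ n)
    pos = ≡.trans (≡.cong (λ z → z ℤ.* + (p ℕ.^ n)) (≡.sym (ℤ.pos-* k k))) (≡.sym (ℤ.pos-* (k ℕ.* k) (p ℕ.^ n)))
    ∣z∣² : ∀ z → z ℤ.* z ≡ + (ℤ.∣ z ∣ ℕ.* ℤ.∣ z ∣)
    ∣z∣² (+ a)    = ≡.sym (ℤ.pos-* a a)
    ∣z∣² -[1+ a ] = ≡.refl
    root : ∀ z {x} → ℤ.∣ z ∣ ≡ k ℕ.* x → ∃[ τ ] (τ ≡ + 1 ⊎ τ ≡ ℤ.- + 1) × z ≡ + k ℤ.* (τ ℤ.* + x)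
    root (+ a)    {x} eq = + 1 , inj₁ ≡.refl , ≡.trans (≡.cong +_ eq) (≡.trans (ℤ.pos-* k x) (lemma₁ (+ k) (+ x)))
      where lemma₁ : ∀ k x → k ℤ.* x ≡ k ℤ.* (+ 1 ℤ.* x)
            lemma₁ = solve-∀
    root -[1+ a ] {x} eq = ℤ.- + 1 , inj₂ ≡.refl , ≡.trans (≡.cong (λ y → ℤ.- + y) eq) (≡.trans (≡.cong ℤ.-_ (ℤ.pos-* k x)) (lemma₁ (+ k) (+ x)))
      where lemma₁ : ∀ k x → ℤ.- (k ℤ.* x) ≡ k ℤ.* ((ℤ.- + 1) ℤ.* x)
            lemma₁ = solve-∀
    instance
      k-nonZero : ℕ.NonZero k
      k-nonZero = ℕ.>-nonZero (ℕ.pred-mono-≤ 1<p)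
    sign : σ ≡ + 1 ⊎ σ ≡ ℤ.- + 1 → σ ≡ + 1 × ∃[ h ] n ≡ h ℕ.+ h × ∃[ τ ] (τ ≡ + 1 ⊎ τ ≡ ℤ.- + 1) × z ≡ + k ℤ.* (τ ℤ.* + (p ℕ.^ h))
    sign (inj₁ ≡.refl) = ≡.refl , assemble (square-p^-even p∤p-1 n
        (ℤ.+-injective (≡.trans (≡.sym (∣z∣² z)) (≡.trans z²≡ (≡.trans (lemma′ (+ k) (+ (p ℕ.^ n))) pos)))))
      where
      assemble : ∃[ h ] n ≡ h ℕ.+ h × ℤ.∣ z ∣ ≡ k ℕ.* p ℕ.^ h → ∃[ h ] n ≡ h ℕ.+ h × ∃[ τ ] (τ ≡ + 1 ⊎ τ ≡ ℤ.- + 1) × z ≡ + k ℤ.* (τ ℤ.* + (p ℕ.^ h))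
      assemble (h , n≡ , ∣z∣≡) = h , n≡ , root z ∣z∣≡
    -- For σ = -1 the square of z would be negative. This is what rules out ε = ±i.
    sign (inj₂ ≡.refl) = contradiction
      (≡.trans (≡.sym (∣z∣² z)) (≡.trans z²≡ (≡.trans (lemma (+ k) (+ (p ℕ.^ n))) (≡.cong ℤ.-_ pos))))
      (nonNeg≢neg (ℕ.m*n≢0 (k ℕ.* k) (p ℕ.^ n) {{ℕ.m*n≢0 k k}} {{ℕ.m^n≢0 p n}}))
      where
      nonNeg≢neg : ∀ {x y} → ℕ.NonZero y → + x ≢ ℤ.- + y
      nonNeg≢neg {y = suc _} _ ()

  p^∣-coprime : ∀ k a x → ¬ p∣ x → + (p ℕ.^ k) ℤ∣.∣ a ℤ.* x → + (p ℕ.^ k) ℤ∣.∣ a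
  p^∣-coprime zero    a x p∤x _ = divides a (≡.sym (ℤ.*-identityʳ a))
  p^∣-coprime (suc k) a x p∤x (divides t ax≡) with Sum.[ id , (λ p∣x → contradiction p∣x p∤x) ]′ (p∣m*n a x
      (divides (t ℤ.* + (p ℕ.^ k)) (≡.trans ax≡ (≡.trans (≡.cong (t ℤ.*_) (ℤ.pos-* p (p ℕ.^ k))) (lemma t (+ p) (+ (p ℕ.^ k)))))))
    where lemma : ∀ t p x → t ℤ.* (p ℤ.* x) ≡ t ℤ.* x ℤ.* p
          lemma = solve-∀
  ... | divides b ≡.refl = lift (p^∣-coprime k b x p∤x (divides t (ℤ.*-cancelʳ-≡ _ _ (+ p)
          (≡.trans (lemma₁ b x (+ p)) (≡.trans ax≡ (≡.trans (≡.cong (t ℤ.*_) (ℤ.pos-* p (p ℕ.^ k))) (lemma₂ t (+ p) (+ (p ℕ.^ k)))))))))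
    where
    lemma₁ : ∀ b x p → b ℤ.* x ℤ.* p ≡ b ℤ.* p ℤ.* x
    lemma₁ = solve-∀
    lemma₂ : ∀ t p x → t ℤ.* (p ℤ.* x) ≡ t ℤ.* x ℤ.* p
    lemma₂ = solve-∀
    lift : + (p ℕ.^ k) ℤ∣.∣ b → + (p ℕ.^ suc k) ℤ∣.∣ b ℤ.* + p
    lift (divides c ≡.refl) = divides c (≡.trans (lemma₃ c (+ (p ℕ.^ k)) (+ p)) (≡.cong (c ℤ.*_) (≡.sym (ℤ.pos-* p (p ℕ.^ k)))))
      where lemma₃ : ∀ c x p → c ℤ.* x ℤ.* p ≡ c ℤ.* (p ℤ.* x)
            lemma₃ = solve-∀

  p∣p^ : ∀ {k} → 1 ℕ.≤ k → p∣ + (p ℕ.^ k)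
  p∣p^ {suc k} _ = ≡.subst p∣_ (≡.sym (ℤ.pos-* p (p ℕ.^ k))) (p∣p*m (+ (p ℕ.^ k)))

  p∤±1 : ∀ {τ} → τ ≡ + 1 ⊎ τ ≡ ℤ.- + 1 → ¬ p∣ τ
  p∤±1 (inj₁ ≡.refl) = p∤1
  p∤±1 (inj₂ ≡.refl) = p∤1 ∘ ℤ∣.∣m⇒∣-m

  -- Collecting the multiples of p^h gives p^h y = x p^m with y ≡ -τ modulo p, where h ≥ 1 and m ≥ 1
  -- make p^h and p^m vanish modulo p. As y is prime to p, p^m divides p^h.
  exponent-bound : ∀ {h m τ k x} → 1 ℕ.≤ h → 1 ℕ.≤ m → τ ≡ + 1 ⊎ τ ≡ ℤ.- + 1 →
    + p ℤ.* (τ ℤ.* + (p ℕ.^ h) ℤ.* k) ≡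
      + (p ℕ.^ h) ℤ.* + (p ℕ.^ h) ℤ.- + (p ℕ.^ m) ℤ.* x ℤ.+ (+ (p ℕ.^ m) ℤ.- + 1) ℤ.* (τ ℤ.* + (p ℕ.^ h)) →
    m ℕ.≤ h
  exponent-bound {h} {m} {τ} {k} {x} 1≤h 1≤m τ≡±1 eq = ℕ.≮⇒≥ λ h<m →
      ℕ.<⇒≱ (ℕ.^-monoʳ-< p 1<p h<m) (ℕ∣.∣⇒≤ {{ℕ.m^n≢0 p h}} (ℤ∣.∣⇒∣ᵤ p^m∣p^h))
    where
    open ≡-Reasoning
    Q q y : ℤ
    Q = + (p ℕ.^ h)
    q = + (p ℕ.^ m)
    y = Q ℤ.+ τ ℤ.* (q ℤ.- + 1 ℤ.- + p ℤ.* k)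
    lemma₁ : ∀ Q τ q p k x → Q ℤ.* (Q ℤ.+ τ ℤ.* (q ℤ.- + 1 ℤ.- p ℤ.* k)) ≡
      (Q ℤ.* Q ℤ.- q ℤ.* x ℤ.+ (q ℤ.- + 1) ℤ.* (τ ℤ.* Q)) ℤ.- p ℤ.* (τ ℤ.* Q ℤ.* k) ℤ.+ x ℤ.* q
    lemma₁ = solve-∀
    Qy≡ : Q ℤ.* y ≡ x ℤ.* q
    Qy≡ = begin
      Q ℤ.* y                                             ≡⟨ lemma₁ Q τ q (+ p) k x ⟩
      (Q ℤ.* Q ℤ.- q ℤ.* x ℤ.+ (q ℤ.- + 1) ℤ.* (τ ℤ.* Q)) ℤ.- + p ℤ.* (τ ℤ.* Q ℤ.* k) ℤ.+ x ℤ.* q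
                                                          ≡⟨ ≡.cong (λ z → z ℤ.- + p ℤ.* (τ ℤ.* Q ℤ.* k) ℤ.+ x ℤ.* q) eq ⟨
      + p ℤ.* (τ ℤ.* Q ℤ.* k) ℤ.- + p ℤ.* (τ ℤ.* Q ℤ.* k) ℤ.+ x ℤ.* q
                                                          ≡⟨ ≡.cong (λ z → z ℤ.+ x ℤ.* q) (ℤ.+-inverseʳ (+ p ℤ.* (τ ℤ.* Q ℤ.* k))) ⟩
      + 0 ℤ.+ x ℤ.* q                                     ≡⟨ ℤ.+-identityˡ _ ⟩
      x ℤ.* q                                             ∎
    lemma₂ : ∀ Q τ q pk → τ ≡ (Q ℤ.+ τ ℤ.* (q ℤ.- pk)) ℤ.- (Q ℤ.+ τ ℤ.* (q ℤ.- + 1 ℤ.- pk))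
    lemma₂ = solve-∀
    p∤y : ¬ p∣ y
    p∤y p∣y = p∤±1 τ≡±1 (≡.subst p∣_ (≡.sym (lemma₂ Q τ q (+ p ℤ.* k)))
      (ℤ∣.∣m∣n⇒∣m-n (ℤ∣.∣m∣n⇒∣m+n (p∣p^ 1≤h) (ℤ∣.∣n⇒∣m*n τ (ℤ∣.∣m∣n⇒∣m-n (p∣p^ 1≤m) (p∣p*m k)))) p∣y))
    p^m∣p^h : q ℤ∣.∣ Q
    p^m∣p^h = p^∣-coprime m Q y p∤y (divides x Qy≡)

  -- With m ≤ h the power p^h splits as D p^m, and the whole equation can be divided by p^m.
  fibre-formula : ∀ {h m τ} k x → m ℕ.≤ h →
    + p ℤ.* (τ ℤ.* + (p ℕ.^ h) ℤ.* + k) ≡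
      + (p ℕ.^ h) ℤ.* + (p ℕ.^ h) ℤ.- + (p ℕ.^ m) ℤ.* + x ℤ.+ (+ (p ℕ.^ m) ℤ.- + 1) ℤ.* (τ ℤ.* + (p ℕ.^ h)) →
    + x ≡ + (p ℕ.^ (h ℕ.+ h ∸ m)) ℤ.+ τ ℤ.* (+ (p ℕ.^ h) ℤ.- + (p ℕ.^ (h ∸ m)) ℤ.* + (p ℕ.* k ℕ.+ 1))
  fibre-formula {h} {m} {τ} k x m≤h eq = ℤ.*-cancelˡ-≡ q _ _ {{q-nonZero}} (begin
      q ℤ.* + x
        ≡⟨ lemma₁ Q τ q (+ p) (+ k) (+ x) ⟩
      (Q ℤ.* Q ℤ.+ (q ℤ.- + 1) ℤ.* (τ ℤ.* Q)) ℤ.- (Q ℤ.* Q ℤ.- q ℤ.* + x ℤ.+ (q ℤ.- + 1) ℤ.* (τ ℤ.* Q))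
        ≡⟨ ≡.cong (λ z → (Q ℤ.* Q ℤ.+ (q ℤ.- + 1) ℤ.* (τ ℤ.* Q)) ℤ.- z) eq ⟨
      (Q ℤ.* Q ℤ.+ (q ℤ.- + 1) ℤ.* (τ ℤ.* Q)) ℤ.- + p ℤ.* (τ ℤ.* Q ℤ.* + k)
        ≡⟨ lemma₂ Q τ q (+ p) (+ k) ⟩
      Q ℤ.* Q ℤ.+ τ ℤ.* (Q ℤ.* q ℤ.- Q ℤ.* (+ p ℤ.* + k ℤ.+ + 1))
        ≡⟨ ≡.cong₂ (λ u v → u ℤ.* Q ℤ.+ τ ℤ.* (Q ℤ.* q ℤ.- v ℤ.* (+ p ℤ.* + k ℤ.+ + 1))) Q≡Dq Q≡Dq ⟩
      (D ℤ.* q) ℤ.* Q ℤ.+ τ ℤ.* (Q ℤ.* q ℤ.- (D ℤ.* q) ℤ.* (+ p ℤ.* + k ℤ.+ + 1))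
        ≡⟨ lemma₃ Q τ q D (+ p ℤ.* + k ℤ.+ + 1) ⟩
      q ℤ.* (D ℤ.* Q ℤ.+ τ ℤ.* (Q ℤ.- D ℤ.* (+ p ℤ.* + k ℤ.+ + 1)))
        ≡⟨ ≡.cong₂ (λ u v → q ℤ.* (u ℤ.+ τ ℤ.* (Q ℤ.- D ℤ.* v))) DQ≡ (≡.cong (λ z → z ℤ.+ + 1) (≡.sym (ℤ.pos-* p k))) ⟩
      q ℤ.* (+ (p ℕ.^ (h ℕ.+ h ∸ m)) ℤ.+ τ ℤ.* (Q ℤ.- D ℤ.* + (p ℕ.* k ℕ.+ 1))) ∎)
    where
    open ≡-Reasoning
    Q q D : ℤ
    Q = + (p ℕ.^ h)
    q = + (p ℕ.^ m)
    D = + (p ℕ.^ (h ∸ m))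
    q-nonZero : ℤ.NonZero q
    q-nonZero = ℕ.m^n≢0 p m
    Q≡Dq : Q ≡ D ℤ.* q
    Q≡Dq = ≡.trans (≡.cong +_ (≡.trans (≡.cong (p ℕ.^_) (≡.sym (ℕ.m∸n+n≡m m≤h))) (ℕ.^-distribˡ-+-* p (h ∸ m) m))) (ℤ.pos-* (p ℕ.^ (h ∸ m)) (p ℕ.^ m))
    DQ≡ : D ℤ.* Q ≡ + (p ℕ.^ (h ℕ.+ h ∸ m))
    DQ≡ = ≡.trans (≡.sym (ℤ.pos-* (p ℕ.^ (h ∸ m)) (p ℕ.^ h)))
            (≡.cong +_ (≡.trans (≡.sym (ℕ.^-distribˡ-+-* p (h ∸ m) h))
              (≡.cong (p ℕ.^_) (≡.trans (ℕ.+-comm (h ∸ m) h) (≡.sym (ℕ.+-∸-assoc h m≤h))))))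
    lemma₁ : ∀ Q τ q p k x → q ℤ.* x ≡ (Q ℤ.* Q ℤ.+ (q ℤ.- + 1) ℤ.* (τ ℤ.* Q)) ℤ.- (Q ℤ.* Q ℤ.- q ℤ.* x ℤ.+ (q ℤ.- + 1) ℤ.* (τ ℤ.* Q))
    lemma₁ = solve-∀
    lemma₂ : ∀ Q τ q p k → (Q ℤ.* Q ℤ.+ (q ℤ.- + 1) ℤ.* (τ ℤ.* Q)) ℤ.- p ℤ.* (τ ℤ.* Q ℤ.* k) ≡ Q ℤ.* Q ℤ.+ τ ℤ.* (Q ℤ.* q ℤ.- Q ℤ.* (p ℤ.* k ℤ.+ + 1))
    lemma₂ = solve-∀
    lemma₃ : ∀ Q τ q D y → (D ℤ.* q) ℤ.* Q ℤ.+ τ ℤ.* (Q ℤ.* q ℤ.- (D ℤ.* q) ℤ.* y) ≡ q ℤ.* (D ℤ.* Q ℤ.+ τ ℤ.* (Q ℤ.- D ℤ.* y))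
    lemma₃ = solve-∀

  -- Dropping N₀ ≥ 0 gives p k + 1 ≤ q + k, hence k (p - 1) ≤ q - 1. Inserting the bound for k once
  -- more yields the second inequality, the form used for the fibres.
  count-bound : ∀ {N₀ k m} → + N₀ ℤ.+ (+ p ℤ.- + 1) ℤ.* + k ≡ + (p ℕ.^ m) ℤ.- + 1 →
                k ℕ.≤ geometric p-prime m × p ℕ.* k ℕ.+ 1 ℕ.≤ p ℕ.^ m ℕ.+ geometric p-prime m
  count-bound {N₀} {k} {m} eq = k≤G , pk+1≤q+G
    where
    instance
      p-1-nonZero : ℕ.NonZero (p ∸ 1)
      p-1-nonZero = ℕ.>-nonZero (ℕ.m<n⇒0<n∸m 1<p)
    q : ℕ
    q = p ℕ.^ m
    pk+N₀+1≡q+k : p ℕ.* k ℕ.+ N₀ ℕ.+ 1 ≡ q ℕ.+ k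
    pk+N₀+1≡q+k = ℤ.+-injective (begin
      + (p ℕ.* k) ℤ.+ + N₀ ℤ.+ + 1                            ≡⟨ ≡.cong (λ z → z ℤ.+ + N₀ ℤ.+ + 1) (ℤ.pos-* p k) ⟩
      + p ℤ.* + k ℤ.+ + N₀ ℤ.+ + 1                            ≡⟨ lemma₁ (+ p) (+ k) (+ N₀) ⟩
      (+ N₀ ℤ.+ (+ p ℤ.- + 1) ℤ.* + k) ℤ.+ + k ℤ.+ + 1        ≡⟨ ≡.cong (λ z → z ℤ.+ + k ℤ.+ + 1) eq ⟩
      (+ q ℤ.- + 1) ℤ.+ + k ℤ.+ + 1                           ≡⟨ lemma₂ (+ q) (+ k) ⟩
      + q ℤ.+ + k                                             ∎)
      where
      open ≡-Reasoning
      lemma₁ : ∀ p k N → p ℤ.* k ℤ.+ N ℤ.+ + 1 ≡ (N ℤ.+ (p ℤ.- + 1) ℤ.* k) ℤ.+ k ℤ.+ + 1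
      lemma₁ = solve-∀
      lemma₂ : ∀ q k → (q ℤ.- + 1) ℤ.+ k ℤ.+ + 1 ≡ q ℤ.+ k
      lemma₂ = solve-∀
    pk+1≤q+k : p ℕ.* k ℕ.+ 1 ℕ.≤ q ℕ.+ k
    pk+1≤q+k = ℕ.≤-trans (ℕ.+-monoˡ-≤ 1 (ℕ.m≤m+n (p ℕ.* k) N₀)) (ℕ.≤-reflexive pk+N₀+1≡q+k)
    k[p-1]≤q-1 : k ℕ.* (p ∸ 1) ℕ.≤ q ∸ 1
    k[p-1]≤q-1 = ℕ.m+n≤o⇒m≤o∸n (k ℕ.* (p ∸ 1)) (ℕ.+-cancelʳ-≤ k _ _
      (ℕ.≤-trans (ℕ.≤-reflexive (≡.trans (rearrange k (p ∸ 1)) (≡.cong (λ z → z ℕ.* k ℕ.+ 1) (ℕ.m+[n∸m]≡n (ℕ.<⇒≤ 1<p))))) pk+1≤q+k))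
      where
      rearrange : ∀ k d → k ℕ.* d ℕ.+ 1 ℕ.+ k ≡ (1 ℕ.+ d) ℕ.* k ℕ.+ 1
      rearrange = ℕ-Solver.solve-∀
    k≤G : k ℕ.≤ geometric p-prime m
    k≤G = ℕ.≤-trans (ℕ.≤-reflexive (≡.sym (ℕ.m*n/n≡m k (p ∸ 1)))) (ℕ./-monoˡ-≤ (p ∸ 1) k[p-1]≤q-1)
    pk+1≤q+G : p ℕ.* k ℕ.+ 1 ℕ.≤ q ℕ.+ geometric p-prime m
    pk+1≤q+G = ℕ.≤-trans pk+1≤q+k (ℕ.+-monoʳ-≤ q k≤G)

  -- Multiply X ≤ p^m + G by p^(h-m), which turns p^m into p^h. The slack in the estimate is the
  -- product of p^(h-m) with p^m + G - X.
  lower-bound : ∀ {h m} G X → m ℕ.≤ h → X ℕ.≤ p ℕ.^ m ℕ.+ G → ∀ a →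
    a ℤ.- + (G ℕ.* p ℕ.^ (h ∸ m)) ℤ.≤ a ℤ.+ + (p ℕ.^ h) ℤ.- + (p ℕ.^ (h ∸ m)) ℤ.* + X
  lower-bound {h} {m} G X m≤h X≤q+G a = ≡.subst (a ℤ.- + (G ℕ.* D) ℤ.≤_) (lemma′ (ℕ.m+[n∸m]≡n X≤q+G)) (ℤ.i≤i+j _ (+ (D ℕ.* (q ℕ.+ G ∸ X))))
    where
    open ≡-Reasoning
    D q : ℕ
    D = p ℕ.^ (h ∸ m)
    q = p ℕ.^ m
    Q≡Dq : + (p ℕ.^ h) ≡ + D ℤ.* + q
    Q≡Dq = ≡.trans (≡.cong +_ (≡.trans (≡.cong (p ℕ.^_) (≡.sym (ℕ.m∸n+n≡m m≤h))) (ℕ.^-distribˡ-+-* p (h ∸ m) m))) (ℤ.pos-* D q)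
    lemma₁ : ∀ a G D X e → (a ℤ.- G ℤ.* D) ℤ.+ D ℤ.* e ≡ a ℤ.+ D ℤ.* ((X ℤ.+ e) ℤ.- G) ℤ.- D ℤ.* X
    lemma₁ = solve-∀
    lemma₂ : ∀ q G → (q ℤ.+ G) ℤ.- G ≡ q
    lemma₂ = solve-∀
    lemma′ : ∀ {e} → X ℕ.+ e ≡ q ℕ.+ G → (a ℤ.- + (G ℕ.* D)) ℤ.+ + (D ℕ.* e) ≡ a ℤ.+ + (p ℕ.^ h) ℤ.- + D ℤ.* + X
    lemma′ {e} X+e≡q+G = begin
      (a ℤ.- + (G ℕ.* D)) ℤ.+ + (D ℕ.* e)                       ≡⟨ ≡.cong₂ (λ u v → (a ℤ.- u) ℤ.+ v) (ℤ.pos-* G D) (ℤ.pos-* D e) ⟩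
      (a ℤ.- + G ℤ.* + D) ℤ.+ + D ℤ.* + e                       ≡⟨ lemma₁ a (+ G) (+ D) (+ X) (+ e) ⟩
      a ℤ.+ + D ℤ.* ((+ X ℤ.+ + e) ℤ.- + G) ℤ.- + D ℤ.* + X     ≡⟨ ≡.cong (λ z → a ℤ.+ + D ℤ.* (+ z ℤ.- + G) ℤ.- + D ℤ.* + X) X+e≡q+G ⟩
      a ℤ.+ + D ℤ.* ((+ q ℤ.+ + G) ℤ.- + G) ℤ.- + D ℤ.* + X     ≡⟨ ≡.cong (λ z → a ℤ.+ + D ℤ.* z ℤ.- + D ℤ.* + X) (lemma₂ (+ q) (+ G)) ⟩
      a ℤ.+ + D ℤ.* + q ℤ.- + D ℤ.* + X                         ≡⟨ ≡.cong (λ z → a ℤ.+ z ℤ.- + D ℤ.* + X) Q≡Dq ⟨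
      a ℤ.+ + (p ℕ.^ h) ℤ.- + D ℤ.* + X                         ∎

  upper-bound : ∀ {h m} G X → m ℕ.≤ h → X ℕ.≤ p ℕ.^ m ℕ.+ G → ∀ a →
    a ℤ.- + (p ℕ.^ h) ℤ.+ + (p ℕ.^ (h ∸ m)) ℤ.* + X ℤ.≤ a ℤ.+ + (G ℕ.* p ℕ.^ (h ∸ m))
  upper-bound {h} {m} G X m≤h X≤q+G a = ≡.subst₂ ℤ._≤_
    (lemma₁ a (+ (p ℕ.^ h)) (+ (p ℕ.^ (h ∸ m)) ℤ.* + X)) (lemma₂ a (+ (G ℕ.* p ℕ.^ (h ∸ m))))
    (ℤ.neg-mono-≤ (lower-bound {h} {m} G X m≤h X≤q+G (ℤ.- a)))
    where
    lemma₁ : ∀ a Q y → ℤ.- (ℤ.- a ℤ.+ Q ℤ.- y) ≡ a ℤ.- Q ℤ.+ y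
    lemma₁ = solve-∀
    lemma₂ : ∀ a y → ℤ.- (ℤ.- a ℤ.- y) ≡ a ℤ.+ y
    lemma₂ = solve-∀

  halve : ∀ {n h} → n ≡ h ℕ.+ h → h ≡ n ℕ./ 2
  halve {h = h} ≡.refl = ≡.sym (≡.trans (≡.cong (ℕ._/ 2) (lemma h)) (ℕ.m*n/n≡m h 2))
    where
    lemma : ∀ h → h ℕ.+ h ≡ h ℕ.* 2
    lemma = ℕ-Solver.solve-∀

-- Ordered field facts for constructive reals

module RealLemmas {c ℓ₁ ℓ₂} (R : RealNumbers c ℓ₁ ℓ₂) where
  open RealNumbers R hiding (rawRing)

  commutativeRing : CommutativeRing c ℓ₁
  commutativeRing = record { isCommutativeRing = isCommutativeRing }

  open CommutativeRing commutativeRing using (semiring)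
  open IntegerMultiples commutativeRing public
  open Solver
  open import Relation.Binary.Reasoning.Setoid setoid
  private
    module < = IsStrictPartialOrder isStrictPartialOrder

  <-asym : ∀ {x y} → x < y → ¬ y < x
  <-asym x<y y<x = <.irrefl refl (<.trans x<y y<x)

  #⇒<⊎> : ∀ {x y} → x # y → x < y ⊎ y < x
  #⇒<⊎> {x} {y} = Equivalence.to (#⇔<⊎> x y)

  ≈-stable : ∀ {x y} → ¬ x # y → x ≈ y
  ≈-stable {x} {y} = proj₁ (tight x y)

  -- By tightness it suffices to refute y # 0. It is y that gets inverted, forcing x = 0, because ¬
  -- x ≈ 0 alone supplies no inverse of x.
  cancelᴿ : ∀ {x y} → ¬ x ≈ 0# → x * y ≈ 0# → y ≈ 0#
  cancelᴿ {x} {y} x≉0 xy≈0 = ≈-stable λ y#0 → x≉0 (vanish (#⇒invertible y#0))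
    where
    vanish : ∃[ z ] (z * (y - 0#) ≈ 1#) × ((y - 0#) * z ≈ 1#) → x ≈ 0#
    vanish (z , zy≈1 , _) = begin
      x                       ≈⟨ *-identityʳ x ⟨
      x * 1#                  ≈⟨ *-congˡ zy≈1 ⟨
      x * (z * (y - 0#))      ≈⟨ solve 3 (λ x y z → x :* (z :* (y :- con (+ 0))) := (x :* y) :* z) refl x y z ⟩
      (x * y) * z             ≈⟨ *-congʳ xy≈0 ⟩
      0# * z                  ≈⟨ zeroˡ z ⟩
      0#                      ∎

  neg-pos : ∀ {x} → x < 0# → 0# < - x
  neg-pos {x} x<0 = <.<-respʳ-≈ (+-identityˡ (- x)) (<.<-respˡ-≈ (-‿inverseʳ x) (+-monoˡ-< (- x) x<0))

  pos-neg : ∀ {x} → 0# < x → - x < 0#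
  pos-neg {x} 0<x = <.<-respʳ-≈ (-‿inverseʳ x) (<.<-respˡ-≈ (+-identityˡ (- x)) (+-monoˡ-< (- x) 0<x))

  +-pos : ∀ {x y} → 0# < x → 0# < y → 0# < x + y
  +-pos {x} {y} 0<x 0<y = <.trans 0<y (<.<-respˡ-≈ (+-identityˡ y) (+-monoˡ-< y 0<x))

  square-pos : ∀ {x} → x # 0# → 0# < x * x
  square-pos {x} x#0 with #⇒<⊎> x#0
  ... | inj₂ 0<x = *-pos 0<x 0<x
  ... | inj₁ x<0 = <.<-respʳ-≈ (solve 1 (λ x → (:- x) :* (:- x) := x :* x) refl x) (*-pos (neg-pos x<0) (neg-pos x<0))

  -- If x² < 0, then x cannot be apart from 0, since otherwise x² > 0. So x = 0 and x² = 0, a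
  -- contradiction.
  square-nonNeg : ∀ x → 0# ≤ x * x
  square-nonNeg x x²<0 = <.irrefl (trans (*-congˡ x≈0) (zeroʳ x)) x²<0
    where
    x≈0 : x ≈ 0#
    x≈0 = ≈-stable λ x#0 → <-asym (square-pos x#0) x²<0

  -- If x # 0, then x² > 0 and y² lies strictly below x² + y² = 0.
  x²+y²≈0⇒x≈0 : ∀ {x y} → x * x + y * y ≈ 0# → x ≈ 0#
  x²+y²≈0⇒x≈0 {x} {y} sum≈0 = ≈-stable λ x#0 →
    square-nonNeg y (<.<-respʳ-≈ sum≈0 (<.<-respˡ-≈ (+-identityˡ _) (+-monoˡ-< (y * y) (square-pos x#0))))

  0<1 : 0# < 1#
  0<1 with #⇒<⊎> {1#} {0#} (invertible⇒# (1# , 1*[1-0] , 1*[1-0]′))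
    where
    1*[1-0] : 1# * (1# - 0#) ≈ 1#
    1*[1-0] = solve 1 (λ x → con (+ 1) :* (con (+ 1) :- con (+ 0)) := con (+ 1)) refl 1#
    1*[1-0]′ : (1# - 0#) * 1# ≈ 1#
    1*[1-0]′ = solve 1 (λ x → (con (+ 1) :- con (+ 0)) :* con (+ 1) := con (+ 1)) refl 1#
  ... | inj₂ 0<1 = 0<1
  ... | inj₁ 1<0 = contradiction (<.<-respˡ-≈ (sym (*-identityˡ 1#)) 1<0) (square-nonNeg 1#)

  ι-pos : ∀ k → 0# < ι (+ suc k)
  ι-pos zero    = 0<1
  ι-pos (suc k) = +-pos (ι-pos k) 0<1

  ι-negative : ∀ k → ι -[1+ k ] < 0#
  ι-negative k = pos-neg (ι-pos k)

  char-0ᴿ : ∀ {z} → ι z ≈ 0# → z ≡ + 0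
  char-0ᴿ {+ zero}   _    = ≡.refl
  char-0ᴿ {+ suc k}  ι≈0  = contradiction (ι-pos k) (<.irrefl (sym ι≈0))
  char-0ᴿ { -[1+ k ]} ι≈0 = contradiction (ι-negative k) (<.irrefl ι≈0)

  fromℕ≈ι : ∀ k → fromℕ k ≈ ι (+ k)
  fromℕ≈ι k = Algebra.Properties.Semiring.Mult.TCOptimised.×ᵤ≈× semiring k 1#

-- The complex numbers as a ring with a root of unity

module ComplexLemmas {c ℓ₁ ℓ₂} (R : RealNumbers c ℓ₁ ℓ₂) where
  private
    module ℝ where
      open RealNumbers R public
      open RealLemmas R public
  open Complex R
  open ℝ.Solver

  ≈-reflᶜ : ∀ {z} → z ≈ z
  ≈-reflᶜ = ℝ.refl , ℝ.refl

  ≈-symᶜ : ∀ {z w} → z ≈ w → w ≈ z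
  ≈-symᶜ (p , q) = ℝ.sym p , ℝ.sym q

  ≈-transᶜ : ∀ {z w v} → z ≈ w → w ≈ v → z ≈ v
  ≈-transᶜ (p , q) (p′ , q′) = ℝ.trans p p′ , ℝ.trans q q′

  ℂ-commutativeRing : CommutativeRing c ℓ₁
  ℂ-commutativeRing = record
    { Carrier = ℂ ; _≈_ = _≈_ ; _+_ = _+_ ; _*_ = _*_ ; -_ = -_ ; 0# = 0# ; 1# = 1#
    ; isCommutativeRing = record
      { isRing = record
        { +-isAbelianGroup = record
          { isGroup = record
            { isMonoid = record
              { isSemigroup = record
                { isMagma = record
                  { isEquivalence = record { refl = ≈-reflᶜ ; sym = ≈-symᶜ ; trans = ≈-transᶜ }
                  ; ∙-cong = λ (p , q) (p′ , q′) → ℝ.+-cong p p′ , ℝ.+-cong q q′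
                  }
                ; assoc = λ z w v → ℝ.+-assoc (re z) (re w) (re v) , ℝ.+-assoc (im z) (im w) (im v)
                }
              ; identity = (λ z → ℝ.+-identityˡ (re z) , ℝ.+-identityˡ (im z))
                         , (λ z → ℝ.+-identityʳ (re z) , ℝ.+-identityʳ (im z))
              }
            ; inverse = (λ z → ℝ.-‿inverseˡ (re z) , ℝ.-‿inverseˡ (im z))
                      , (λ z → ℝ.-‿inverseʳ (re z) , ℝ.-‿inverseʳ (im z))
            ; ⁻¹-cong = λ (p , q) → ℝ.-‿cong p , ℝ.-‿cong q
            }
          ; comm = λ z w → ℝ.+-comm (re z) (re w) , ℝ.+-comm (im z) (im w)
          }
        ; *-cong = λ (p , q) (p′ , q′) → ℝ.+-cong (ℝ.*-cong p p′) (ℝ.-‿cong (ℝ.*-cong q q′))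
                                       , ℝ.+-cong (ℝ.*-cong p q′) (ℝ.*-cong q p′)
        ; *-assoc = λ z w v →
            solve 6 (λ a b c d e f → (a :* c :- b :* d) :* e :- (a :* d :+ b :* c) :* f
                                  := a :* (c :* e :- d :* f) :- b :* (c :* f :+ d :* e)) ℝ.refl (re z) (im z) (re w) (im w) (re v) (im v)
          , solve 6 (λ a b c d e f → (a :* c :- b :* d) :* f :+ (a :* d :+ b :* c) :* e
                                  := a :* (c :* f :+ d :* e) :+ b :* (c :* e :- d :* f)) ℝ.refl (re z) (im z) (re w) (im w) (re v) (im v)
        ; *-identity = (λ z → solve 2 (λ a b → con (+ 1) :* a :- con (+ 0) :* b := a) ℝ.refl (re z) (im z)
                            , solve 2 (λ a b → con (+ 1) :* b :+ con (+ 0) :* a := b) ℝ.refl (re z) (im z))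
                     , (λ z → solve 2 (λ a b → a :* con (+ 1) :- b :* con (+ 0) := a) ℝ.refl (re z) (im z)
                            , solve 2 (λ a b → a :* con (+ 0) :+ b :* con (+ 1) := b) ℝ.refl (re z) (im z))
        ; distrib = (λ z w v →
              solve 6 (λ a b c d e f → a :* (c :+ e) :- b :* (d :+ f) := (a :* c :- b :* d) :+ (a :* e :- b :* f))
                ℝ.refl (re z) (im z) (re w) (im w) (re v) (im v)
            , solve 6 (λ a b c d e f → a :* (d :+ f) :+ b :* (c :+ e) := (a :* d :+ b :* c) :+ (a :* f :+ b :* e))
                ℝ.refl (re z) (im z) (re w) (im w) (re v) (im v))
          , (λ z w v →
              solve 6 (λ a b c d e f → (c :+ e) :* a :- (d :+ f) :* b := (c :* a :- d :* b) :+ (e :* a :- f :* b))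
                ℝ.refl (re z) (im z) (re w) (im w) (re v) (im v)
            , solve 6 (λ a b c d e f → (c :+ e) :* b :+ (d :+ f) :* a := (c :* b :+ d :* a) :+ (e :* b :+ f :* a))
                ℝ.refl (re z) (im z) (re w) (im w) (re v) (im v))
        }
      ; *-comm = λ z w →
            solve 4 (λ a b c d → a :* c :- b :* d := c :* a :- d :* b) ℝ.refl (re z) (im z) (re w) (im w)
          , solve 4 (λ a b c d → a :* d :+ b :* c := c :* b :+ d :* a) ℝ.refl (re z) (im z) (re w) (im w)
      }
    }

  private module ℂι = IntegerMultiples ℂ-commutativeRing

  ι≈fromℝ : ∀ z → ℂι.ι z ≈ fromℝ (ℝ.ι z)
  ι≈fromℝ (+ k) = natural k
    where
    natural : ∀ k → ℂι.ι (+ k) ≈ fromℝ (ℝ.ι (+ k))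
    natural zero          = ≈-reflᶜ
    natural 1             = ≈-reflᶜ
    natural (suc (suc k)) = ℝ.+-congʳ (proj₁ (natural (suc k)))
                          , ℝ.trans (ℝ.+-congʳ (proj₂ (natural (suc k)))) (ℝ.+-identityˡ ℝ.0#)
  ι≈fromℝ -[1+ k ] = ℝ.-‿cong (proj₁ (ι≈fromℝ (+ suc k)))
                   , ℝ.trans (ℝ.-‿cong (proj₂ (ι≈fromℝ (+ suc k)))) (solve 1 (λ x → :- con (+ 0) := con (+ 0)) ℝ.refl ℝ.0#)

  -- Multiplying z w = 0 by the conjugate of z reduces the claim to cancelling |z|² from the real
  -- and imaginary parts of w.
  cancelᶜ : ∀ {z w} → ¬ z ≈ 0# → z * w ≈ 0# → w ≈ 0#
  cancelᶜ {z} {w} z≉0 (re≈0 , im≈0) =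
      ℝ.cancelᴿ ∣z∣²≉0 (ℝ.trans
        (solve 4 (λ a b c d → (a :* a :+ b :* b) :* c := a :* (a :* c :- b :* d) :+ b :* (a :* d :+ b :* c)) ℝ.refl (re z) (im z) (re w) (im w))
        (ℝ.trans (ℝ.+-cong (ℝ.*-congˡ re≈0) (ℝ.*-congˡ im≈0)) (solve 2 (λ a b → a :* con (+ 0) :+ b :* con (+ 0) := con (+ 0)) ℝ.refl (re z) (im z))))
    , ℝ.cancelᴿ ∣z∣²≉0 (ℝ.trans
        (solve 4 (λ a b c d → (a :* a :+ b :* b) :* d := a :* (a :* d :+ b :* c) :- b :* (a :* c :- b :* d)) ℝ.refl (re z) (im z) (re w) (im w))
        (ℝ.trans (ℝ.+-cong (ℝ.*-congˡ im≈0) (ℝ.-‿cong (ℝ.*-congˡ re≈0))) (solve 2 (λ a b → a :* con (+ 0) :- b :* con (+ 0) := con (+ 0)) ℝ.refl (re z) (im z))))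
    where
    ∣z∣²≉0 : ¬ re z ℝ.* re z ℝ.+ im z ℝ.* im z ℝ.≈ ℝ.0#
    ∣z∣²≉0 ∣z∣²≈0 = z≉0 (ℝ.x²+y²≈0⇒x≈0 ∣z∣²≈0 , ℝ.x²+y²≈0⇒x≈0 (ℝ.trans (ℝ.+-comm _ _) ∣z∣²≈0))

  rootOfUnity : ∀ {p} ζ → IsNontrivialRootOfUnity p ζ → RootOfUnity p c ℓ₁
  rootOfUnity ζ (ζ^p≈1 , ζ≉1) = record
    { commutativeRing = ℂ-commutativeRing
    ; cancel          = cancelᶜ
    ; char-0          = λ {z} ιz≈0 → ℝ.char-0ᴿ (proj₁ (≈-transᶜ (≈-symᶜ (ι≈fromℝ z)) ιz≈0))
    ; ζ               = ζ
    ; ζ^p≈1           = ζ^p≈1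
    ; ζ≉1             = ζ≉1
    }

  IsSqrt⇒square : ∀ {s} k → ℝ.IsSqrt s (ℝ.fromℕ k) → fromℝ s * fromℝ s ≈ ℂι.ι (+ k)
  IsSqrt⇒square {s} k (_ , s²≈k) = ≈-transᶜ
    ( ℝ.trans (solve 1 (λ x → x :* x :- con (+ 0) :* con (+ 0) := x :* x) ℝ.refl s) (ℝ.trans s²≈k (ℝ.fromℕ≈ι k))
    , solve 1 (λ x → x :* con (+ 0) :+ con (+ 0) :* x := con (+ 0)) ℝ.refl s)
    (≈-symᶜ (ι≈fromℝ (+ k)))

  -- This distinguishes √pⁿ from its negative, which decides the sign of A for a given ε.
  nonNeg≉neg : ∀ {s} → ℝ.0# ℝ.≤ s → ∀ k → 1 ℕ.≤ k → ¬ fromℝ s ≈ ℂι.ι (ℤ.- + k)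
  nonNeg≉neg s≥0 (suc k) _ (s≈-k , _) = s≥0
    (<.<-respˡ-≈ (ℝ.sym (ℝ.trans s≈-k (proj₁ (ι≈fromℝ -[1+ k ])))) (ℝ.ι-negative k))
    where module < = IsStrictPartialOrder ℝ.isStrictPartialOrder

  𝑖²≈-1 : 𝑖 * 𝑖 ≈ ℂι.ι (ℤ.- + 1)
  𝑖²≈-1 = solve 0 (con (+ 0) :* con (+ 0) :- con (+ 1) :* con (+ 1) := con (ℤ.- + 1)) ℝ.refl
        , solve 0 (con (+ 0) :* con (+ 1) :+ con (+ 1) :* con (+ 0) := :- con (+ 0)) ℝ.refl

-- Assembling the conclusions over an abstract ring

count-map′ : ∀ {ℓ₁ ℓ₂ ℓ₃} {X : Set ℓ₁} {P : Pred X ℓ₂} {Q : Pred X ℓ₃} (P? : Decidable P)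
             (to : ∀ x → P x → Q x) (from : ∀ x → Q x → P x) {k} (xs : Vec X k) →
             count (λ x → map′ (to x) (from x) (P? x)) xs ≡ count P? xs
count-map′ P? to from Vec.[]       = ≡.refl
count-map′ P? to from (x Vec.∷ xs) with P? x
... | yes _ = ≡.cong suc (count-map′ P? to from xs)
... | no  _ = count-map′ P? to from xs

module ConstantPhase
  {p : ℕ} (p-prime : Prime p) {c ℓ} (U : RootOfUnity p c ℓ) (n m : ℕ)
  {a ℓ₁ b ℓ₂} (K : FiniteField (p ℕ.^ n) a ℓ₁) (L : FiniteField (p ℕ.^ m) b ℓ₂)
  (F : Func (FiniteField.setoid K) (FiniteField.setoid L)) where

  open RootOfUnity U
  open CharacterSums p-prime U n m K L F
  open Cyclotomic p-prime U
  open Solver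
  open Arithmetic p-prime
  open import Relation.Binary.Reasoning.Setoid setoid
  private
    module L = FiniteField L
    module Kᵖ = PrimePowerField p-prime n K
    module Lᵖ = PrimePowerField p-prime m L

  module SquareRoots
    (√pⁿ 𝑖 : Carrier) (√pⁿ² : √pⁿ * √pⁿ ≈ ι (+ qᴷ)) (𝑖² : 𝑖 * 𝑖 ≈ ι (ℤ.- + 1))
    (√pⁿ≉-ℕ : ∀ k → 1 ℕ.≤ k → ¬ √pⁿ ≈ ι (ℤ.- + k)) where

    A² : ∀ ε {σ} → ε * ε ≈ ι σ → (ε * √pⁿ) * (ε * √pⁿ) ≈ ι (σ ℤ.* + qᴷ)
    A² ε {σ} ε²≈σ = begin
      (ε * √pⁿ) * (ε * √pⁿ)         ≈⟨ solve 2 (λ x y → (x :* y) :* (x :* y) := (x :* x) :* (y :* y)) refl ε √pⁿ ⟩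
      (ε * ε) * (√pⁿ * √pⁿ)         ≈⟨ *-cong ε²≈σ √pⁿ² ⟩
      ι σ * ι (+ qᴷ)                ≈⟨ ι-homo-* σ (+ qᴷ) ⟨
      ι (σ ℤ.* + qᴷ)                ∎

    1≉-1 : ¬ ι (+ 1) ≈ ι (ℤ.- + 1)
    1≉-1 1≈-1 with () ← ι-injective {+ 1} {ℤ.- + 1} 1≈-1

    ±𝑖²≈-1 : ∀ {ε} → ε ≈ 𝑖 ⊎ ε ≈ - 𝑖 → ε * ε ≈ ι (ℤ.- + 1)
    ±𝑖²≈-1 (inj₁ ε≈𝑖)  = trans (*-cong ε≈𝑖 ε≈𝑖) 𝑖²
    ±𝑖²≈-1 (inj₂ ε≈-𝑖) = trans (*-cong ε≈-𝑖 ε≈-𝑖) (trans (solve 1 (λ x → (:- x) :* (:- x) := x :* x) refl 𝑖) 𝑖²)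

    ε²≈±1 : ∀ ε → (ε ≈ 1# ⊎ ε ≈ - 1#) ⊎ (ε ≈ 𝑖 ⊎ ε ≈ - 𝑖) → ∃[ σ ] (σ ≡ + 1 ⊎ σ ≡ ℤ.- + 1) × ε * ε ≈ ι σ
    ε²≈±1 ε (inj₁ (inj₁ ε≈1))  = + 1 , inj₁ ≡.refl , trans (*-cong ε≈1 ε≈1) (*-identityˡ 1#)
    ε²≈±1 ε (inj₁ (inj₂ ε≈-1)) = + 1 , inj₁ ≡.refl , trans (*-cong ε≈-1 ε≈-1) (sym (ι-homo-* (ℤ.- + 1) (ℤ.- + 1)))
    ε²≈±1 ε (inj₂ ε≈±𝑖)        = ℤ.- + 1 , inj₂ ≡.refl , ±𝑖²≈-1 ε≈±𝑖

    module Values (W : L.Carrier → Carrier) (W≈V : ∀ y → W y ≈ V y) (ε : Carrier) {σ : ℤ} (σ≡±1 : σ ≡ + 1 ⊎ σ ≡ ℤ.- + 1) (ε²≈σ : ε * ε ≈ ι σ)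
      (values : ∀ y → ¬ (y L.≈ L.0#) → ∃[ r ] W y ≈ ε * √pⁿ * e r) where

      A : Carrier
      A = ε * √pⁿ

      -- Exponents are given only for y ≠ 0; the value 0 at y = 0 is a default that makes `phase`
      -- total.
      phase-from : ∀ {y} → Dec (y L.≈ L.0#) → ℤ
      phase-from (yes _)       = + 0
      phase-from {y} (no y≉0) = proj₁ (values y y≉0)

      phase : L.Carrier → ℤ
      phase y = phase-from (y L.≟ L.0#)

      W≈ : ∀ y → ¬ y L.≈ L.0# → W y ≈ A * e (phase y)
      W≈ y y≉0 = from (y L.≟ L.0#)
        where
        from : (d : Dec (y L.≈ L.0#)) → W y ≈ A * e (phase-from d)
        from (yes y≈0)  = contradiction y≈0 y≉0
        from (no y≉0) = proj₂ (values y y≉0)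

      ±1≢0 : σ ≡ + 1 ⊎ σ ≡ ℤ.- + 1 → σ ≢ + 0
      ±1≢0 (inj₁ ≡.refl) ()
      ±1≢0 (inj₂ ≡.refl) ()

      open FixedPhase A σ (±1≢0 σ≡±1) (A² ε {σ} ε²≈σ) phase (λ y y≉0 → trans (sym (W≈V y)) (W≈ y y≉0))

      h : ℕ
      h = n / 2

      Integrality : Set ℓ
      Integrality = σ ≡ + 1 × n ≡ h ℕ.+ h × ∃[ τ ] (τ ≡ + 1 ⊎ τ ≡ ℤ.- + 1) × A ≈ ι (τ ℤ.* + (p ℕ.^ h))

      integrality : Integrality
      integrality = from-square square-relation
        where
        k : ℤ
        k = + ℕ.pred p
        from-root : ∀ {z} → ι k * A ≈ ι z →
          σ ≡ + 1 × ∃[ h ] n ≡ h ℕ.+ h × ∃[ τ ] (τ ≡ + 1 ⊎ τ ≡ ℤ.- + 1) × z ≡ k ℤ.* (τ ℤ.* + (p ℕ.^ h)) → Integrality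
        from-root kA≈z (σ≡1 , h′ , n≡h+h , τ , τ≡±1 , z≡) =
          σ≡1 , ≡.trans n≡h+h (≡.cong₂ ℕ._+_ (halve {n} {h′} n≡h+h) (halve {n} {h′} n≡h+h)) , τ , τ≡±1
              , trans (cancelˡ k≉0 (trans kA≈z (trans (ι-cong z≡) (ι-homo-* k (τ ℤ.* + (p ℕ.^ h′))))))
                      (ι-cong (≡.cong (λ h → τ ℤ.* + (p ℕ.^ h)) (halve {n} {h′} n≡h+h)))
          where
          k≉0 : ¬ ι k ≈ 0#
          k≉0 k≈0 = ℕ.<⇒≢ (ℕ.pred-mono-≤ 1<p) (≡.sym (ℤ.+-injective (ι-injective {y = k} {z = + 0} k≈0)))
        from-square : ∃[ z ] (ι k * A ≈ ι z) × z ℤ.* z ≡ (k ℤ.* k) ℤ.* (σ ℤ.* + qᴷ) → Integrality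
        from-square (z , kA≈z , z²≡) = from-root {z} kA≈z (integer-square-root n {σ} {z} σ≡±1 z²≡)

      n≡h+h : n ≡ h ℕ.+ h
      n≡h+h = proj₁ (proj₂ integrality)

      1≤h : 1 ℕ.≤ h
      1≤h = ℕ.n≢0⇒n>0 λ h≡0 → ℕ.<⇒≢ Kᵖ.1≤n (≡.sym (≡.trans n≡h+h (≡.cong₂ ℕ._+_ h≡0 h≡0)))

      qᴷ≡ : + qᴷ ≡ + (p ℕ.^ h) ℤ.* + (p ℕ.^ h)
      qᴷ≡ = ≡.trans (≡.cong +_ (≡.trans (≡.cong (p ℕ.^_) n≡h+h) (ℕ.^-distribˡ-+-* p h h))) (ℤ.pos-* (p ℕ.^ h) (p ℕ.^ h))

      τ : ℤ
      τ = proj₁ (proj₂ (proj₂ integrality))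

      τ≡±1 : τ ≡ + 1 ⊎ τ ≡ ℤ.- + 1
      τ≡±1 = proj₁ (proj₂ (proj₂ (proj₂ integrality)))

      A≈τpʰ : A ≈ ι (τ ℤ.* + (p ℕ.^ h))
      A≈τpʰ = proj₂ (proj₂ (proj₂ (proj₂ integrality)))

      open IntegerPhase (τ ℤ.* + (p ℕ.^ h)) A≈τpʰ

      -- Among the equally frequent nonzero residues, 1 is chosen so that at y = 0 the count is that
      -- of the b with W(b,0) = √pⁿ ε ζ.
      k : L.Carrier → ℕ
      k y = N y 1

      equation : ∀ y → + p ℤ.* (τ ℤ.* + (p ℕ.^ h) ℤ.* + k y) ≡
        + (p ℕ.^ h) ℤ.* + (p ℕ.^ h) ℤ.- + (p ℕ.^ m) ℤ.* + fibre y ℤ.+ (+ (p ℕ.^ m) ℤ.- + 1) ℤ.* (τ ℤ.* + (p ℕ.^ h))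
      equation y = ≡.trans (fibre-equation y)
        (≡.cong (λ q → q ℤ.- + qᴸ ℤ.* + fibre y ℤ.+ (+ qᴸ ℤ.- + 1) ℤ.* (τ ℤ.* + (p ℕ.^ h))) qᴷ≡)

      2∣n : 2 ∣ n
      2∣n = ℕ∣.divides h (≡.trans n≡h+h (≡.trans (≡.cong (h ℕ.+_) (≡.sym (ℕ.+-identityʳ h))) (ℕ.*-comm 2 h)))

      m≤h : m ℕ.≤ h
      m≤h = exponent-bound {h} {m} 1≤h Lᵖ.1≤n τ≡±1 (equation L.0#)

      k-bound : ∀ y → k y ℕ.≤ geometric p-prime m × p ℕ.* k y ℕ.+ 1 ℕ.≤ p ℕ.^ m ℕ.+ geometric p-prime m
      k-bound y = count-bound {N y 0} {k y} {m} (count-equation y)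

      fibre≡ : ∀ y → + fibre y ≡
        + (p ℕ.^ (n ∸ m)) ℤ.+ τ ℤ.* (+ (p ℕ.^ h) ℤ.- + (p ℕ.^ (h ∸ m)) ℤ.* + (p ℕ.* k y ℕ.+ 1))
      fibre≡ y = ≡.trans (fibre-formula {h} {m} {τ} (k y) (fibre y) m≤h (equation y))
        (≡.cong (λ n → + (p ℕ.^ (n ∸ m)) ℤ.+ τ ℤ.* (+ (p ℕ.^ h) ℤ.- + (p ℕ.^ (h ∸ m)) ℤ.* + (p ℕ.* k y ℕ.+ 1))) (≡.sym n≡h+h))

      -- The predicate contains an equation in the ring, where equality is not decided. The decision
      -- comes from the equivalent condition that the exponent is 1 modulo p; cancelling A and
      -- injectivity of `e` give the equivalence.
      k₀-cardinality : L.HasCardinality (λ y → ¬ (y L.≈ L.0#) × W y ≈ √pⁿ * ε * ζ) (k L.0#)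
      k₀-cardinality = (λ y → map′ (to y) (from y) (inLevel? L.0# 1 y))
                     , count-map′ (inLevel? L.0# 1) to from (Vec.tabulate L.element)
        where
        s≅phase : ∀ y → s L.0# y ≅ phase y
        s≅phase y = ≅-trans (≅-sub (≡⇒≅ {phase y} ≡.refl) (≅-trans (Lᵖ.tr-cong (L.zeroʳ y)) Lᵖ.tr-0)) (≡⇒≅ (ℤ.+-identityʳ (phase y)))
        to : ∀ y → InLevel L.0# 1 y → ¬ (y L.≈ L.0#) × W y ≈ √pⁿ * ε * ζ
        to y (y≉0 , s%p≡1) = y≉0 , trans (W≈ y y≉0) (*-cong (*-comm ε (√pⁿ)) (trans (e-cong phase≅1) e-1))
          where
          phase≅1 : phase y ≅ + 1
          phase≅1 = ≅-trans (≅-sym (s≅phase y)) (≅-sym (≡.subst (λ r → + r ≅ s L.0# y) s%p≡1 (%-≅ (s L.0# y))))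
        from : ∀ y → ¬ (y L.≈ L.0#) × W y ≈ √pⁿ * ε * ζ → InLevel L.0# 1 y
        from y (y≉0 , W≈√εζ) = y≉0 , %-small 1<p (≅-sym (≅-trans (s≅phase y) (e-injective (cancelˡ A≉0
          (trans (sym (W≈ y y≉0)) (trans W≈√εζ (*-cong (*-comm (√pⁿ) ε) (sym e-1))))))))

      ε²≈1 : ε * ε ≈ ι (+ 1)
      ε²≈1 = trans ε²≈σ (ι-cong (proj₁ integrality))

      -- Integrality has forced ε² = 1, whereas ±𝑖 have square -1.
      ε≉±𝑖 : ¬ (ε ≈ 𝑖 ⊎ ε ≈ - 𝑖)
      ε≉±𝑖 ε≈±𝑖 = 1≉-1 (trans (sym ε²≈1) (±𝑖²≈-1 ε≈±𝑖))

      pʰ≥1 : 1 ℕ.≤ p ℕ.^ h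
      pʰ≥1 = ℕ.m^n>0 p h

      -- For τ = -1 the nonnegative number √pⁿ = A would equal -p^h.
      τ≡1 : ε ≈ 1# → τ ≡ + 1
      τ≡1 ε≈1 = Sum.[ id , (λ τ≡-1 → contradiction
        (trans (sym (trans (*-congʳ ε≈1) (solve 1 (λ x → con (+ 1) :* x := x) refl (√pⁿ))))
          (trans A≈τpʰ (ι-cong (≡.trans (≡.cong (ℤ._* + (p ℕ.^ h)) τ≡-1) (ℤ.-1*i≡-i (+ (p ℕ.^ h)))))))
        (√pⁿ≉-ℕ (p ℕ.^ h) pʰ≥1)) ]′ τ≡±1

      τ≡-1 : ε ≈ - 1# → τ ≡ ℤ.- + 1
      τ≡-1 ε≈-1 = Sum.[ (λ τ≡1 → contradiction (begin
          √pⁿ                             ≈⟨ solve 1 (λ x → x := con (ℤ.- + 1) :* (con (ℤ.- + 1) :* x)) refl (√pⁿ) ⟩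
          ι (ℤ.- + 1) * (- 1# * √pⁿ)      ≈⟨ *-congˡ (trans (*-congʳ (sym ε≈-1)) A≈τpʰ) ⟩
          ι (ℤ.- + 1) * ι (τ ℤ.* + (p ℕ.^ h))   ≈⟨ ι-homo-* (ℤ.- + 1) (τ ℤ.* + (p ℕ.^ h)) ⟨
          ι ((ℤ.- + 1) ℤ.* (τ ℤ.* + (p ℕ.^ h))) ≡⟨ ≡.cong (λ t → ι ((ℤ.- + 1) ℤ.* (t ℤ.* + (p ℕ.^ h)))) τ≡1 ⟩
          ι ((ℤ.- + 1) ℤ.* (+ 1 ℤ.* + (p ℕ.^ h))) ≡⟨ ≡.cong ι (lemma (+ (p ℕ.^ h))) ⟩
          ι (ℤ.- + (p ℕ.^ h))                   ∎) (√pⁿ≉-ℕ (p ℕ.^ h) pʰ≥1)) , id ]′ τ≡±1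
        where
        lemma : ∀ x → (ℤ.- + 1) ℤ.* (+ 1 ℤ.* x) ≡ ℤ.- x
        lemma = solve-∀

      formula⁺ : ε ≈ 1# → ∀ y → + fibre y ≡ + (p ℕ.^ (n ∸ m)) ℤ.+ + (p ℕ.^ h) ℤ.- + (p ℕ.^ (h ∸ m)) ℤ.* + (p ℕ.* k y ℕ.+ 1)
      formula⁺ ε≈1 y = ≡.trans (fibre≡ y) (≡.trans
        (≡.cong (λ t → + (p ℕ.^ (n ∸ m)) ℤ.+ t ℤ.* (+ (p ℕ.^ h) ℤ.- + (p ℕ.^ (h ∸ m)) ℤ.* + (p ℕ.* k y ℕ.+ 1))) (τ≡1 ε≈1))
        (lemma (+ (p ℕ.^ (n ∸ m))) (+ (p ℕ.^ h)) (+ (p ℕ.^ (h ∸ m)) ℤ.* + (p ℕ.* k y ℕ.+ 1))))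
        where
        lemma : ∀ x q d → x ℤ.+ + 1 ℤ.* (q ℤ.- d) ≡ x ℤ.+ q ℤ.- d
        lemma = solve-∀

      formula⁻ : ε ≈ - 1# → ∀ y → + fibre y ≡ + (p ℕ.^ (n ∸ m)) ℤ.- + (p ℕ.^ h) ℤ.+ + (p ℕ.^ (h ∸ m)) ℤ.* + (p ℕ.* k y ℕ.+ 1)
      formula⁻ ε≈-1 y = ≡.trans (fibre≡ y) (≡.trans
        (≡.cong (λ t → + (p ℕ.^ (n ∸ m)) ℤ.+ t ℤ.* (+ (p ℕ.^ h) ℤ.- + (p ℕ.^ (h ∸ m)) ℤ.* + (p ℕ.* k y ℕ.+ 1))) (τ≡-1 ε≈-1))
        (lemma (+ (p ℕ.^ (n ∸ m))) (+ (p ℕ.^ h)) (+ (p ℕ.^ (h ∸ m)) ℤ.* + (p ℕ.* k y ℕ.+ 1))))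
        where
        lemma : ∀ x q d → x ℤ.+ (ℤ.- + 1) ℤ.* (q ℤ.- d) ≡ x ℤ.- q ℤ.+ d
        lemma = solve-∀

      bound⁺ : ε ≈ 1# → ∀ y → + (p ℕ.^ (n ∸ m)) ℤ.- + (geometric p-prime m ℕ.* p ℕ.^ (h ∸ m)) ℤ.≤ + fibre y
      bound⁺ ε≈1 y = ≡.subst (λ z → + (p ℕ.^ (n ∸ m)) ℤ.- + (geometric p-prime m ℕ.* p ℕ.^ (h ∸ m)) ℤ.≤ z) (≡.sym (formula⁺ ε≈1 y))
        (lower-bound {h} {m} (geometric p-prime m) _ m≤h (proj₂ (k-bound y)) (+ (p ℕ.^ (n ∸ m))))

      bound⁻ : ε ≈ - 1# → ∀ y → + fibre y ℤ.≤ + (p ℕ.^ (n ∸ m)) ℤ.+ + (geometric p-prime m ℕ.* p ℕ.^ (h ∸ m))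
      bound⁻ ε≈-1 y = ≡.subst (λ z → z ℤ.≤ + (p ℕ.^ (n ∸ m)) ℤ.+ + (geometric p-prime m ℕ.* p ℕ.^ (h ∸ m))) (≡.sym (formula⁻ ε≈-1 y))
        (upper-bound {h} {m} (geometric p-prime m) _ m≤h (proj₂ (k-bound y)) (+ (p ℕ.^ (n ∸ m))))

    Conclusions : (L.Carrier → Carrier) → Carrier → Set _
    Conclusions W ε =
      (2 ∣ n) × (m ℕ.≤ n / 2) ×
      (ε ≈ 1# ⊎ ε ≈ 𝑖 →
        Σ[ k ∈ (L.Carrier → ℕ) ]
          (∀ y →
            (k y ℕ.≤ geometric p-prime m) ×
            (+ fibre y ≡ + (p ℕ.^ (n ∸ m)) ℤ.+ + (p ℕ.^ (n / 2))
                         ℤ.- + (p ℕ.^ (n / 2 ∸ m)) ℤ.* + (p ℕ.* k y ℕ.+ 1)) ×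
            (+ (p ℕ.^ (n ∸ m)) ℤ.- + (geometric p-prime m ℕ.* p ℕ.^ (n / 2 ∸ m)) ℤ.≤ + fibre y)) ×
          L.HasCardinality (λ y → ¬ (y L.≈ L.0#) × W y ≈ √pⁿ * ε * ζ) (k L.0#)) ×
      (ε ≈ - 1# ⊎ ε ≈ - 𝑖 →
        Σ[ k ∈ (L.Carrier → ℕ) ]
          (∀ y →
            (k y ℕ.≤ geometric p-prime m) ×
            (+ fibre y ≡ + (p ℕ.^ (n ∸ m)) ℤ.- + (p ℕ.^ (n / 2))
                         ℤ.+ + (p ℕ.^ (n / 2 ∸ m)) ℤ.* + (p ℕ.* k y ℕ.+ 1)) ×
            (+ fibre y ℤ.≤ + (p ℕ.^ (n ∸ m)) ℤ.+ + (geometric p-prime m ℕ.* p ℕ.^ (n / 2 ∸ m)))) ×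
          L.HasCardinality (λ y → ¬ (y L.≈ L.0#) × W y ≈ √pⁿ * ε * ζ) (k L.0#))

    conclusions : (W : L.Carrier → Carrier) → (∀ y → W y ≈ V y) →
      (ε : Carrier) → (ε ≈ 1# ⊎ ε ≈ - 1#) ⊎ (ε ≈ 𝑖 ⊎ ε ≈ - 𝑖) →
      (∀ y → ¬ (y L.≈ L.0#) → ∃[ r ] W y ≈ ε * √pⁿ * e r) → Conclusions W ε
    conclusions W W≈V ε ε∈ values = conclude (ε²≈±1 ε ε∈)
      where
      conclude : ∃[ σ ] (σ ≡ + 1 ⊎ σ ≡ ℤ.- + 1) × ε * ε ≈ ι σ → Conclusions W ε
      conclude (σ , σ≡±1 , ε²≈σ) =
          2∣n , m≤h
        , (λ where
            (inj₁ ε≈1) → k , (λ y → proj₁ (k-bound y) , formula⁺ ε≈1 y , bound⁺ ε≈1 y) , k₀-cardinality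
            -- This case cannot occur, as A would not be a rational integer.
            (inj₂ ε≈𝑖) → contradiction (inj₁ ε≈𝑖) ε≉±𝑖)
        , (λ where
            (inj₁ ε≈-1) → k , (λ y → proj₁ (k-bound y) , formula⁻ ε≈-1 y , bound⁻ ε≈-1 y) , k₀-cardinality
            (inj₂ ε≈-𝑖) → contradiction (inj₂ ε≈-𝑖) ε≉±𝑖)
        where open Values W W≈V ε σ≡±1 ε²≈σ values

-- The Walsh transform at 0 as a character sum

module ComplexWalsh {c ℓ₁ ℓ₂ a ℓ b ℓ′} (R : RealNumbers c ℓ₁ ℓ₂)
  {p : ℕ} (p-prime : Prime p)
  (ζ : Complex.ℂ R) (ζ-root : Complex.IsNontrivialRootOfUnity R p ζ)
  (n m : ℕ) (K : FiniteField (p ℕ.^ n) a ℓ) (L : FiniteField (p ℕ.^ m) b ℓ′)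
  (F : Func (FiniteField.setoid K) (FiniteField.setoid L)) where

  private
    module K = FiniteField K
    module L = FiniteField L
    module Kᵖ = PrimePowerField p-prime n K
  open Complex R using (_≈_)
  open ComplexLemmas R
  open Congruence p-prime

  U : RootOfUnity p c ℓ₁
  U = rootOfUnity ζ ζ-root

  W≈V : ∀ y → Walsh.W R p-prime ζ n m K L F y K.0# ≈ CharacterSums.V p-prime U n m K L F y
  W≈V y = Algebra.Properties.Semiring.Sum.sum-cong-≋ (CommutativeRing.semiring ℂ-commutativeRing) {p ℕ.^ n} λ i →
    let bF = + Trace.tr p m L (y L.* Func.to F (K.element i))
        ax = + Trace.tr p n K (K.0# K.* K.element i)
    in Cyclotomic.e-cong p-prime U {bF ℤ.- ax} {bF}
         (≅-trans (≅-sub (≡⇒≅ {bF} ≡.refl) (≅-trans (Kᵖ.tr-cong (K.zeroˡ (K.element i))) Kᵖ.tr-0))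
                  (≡⇒≅ (ℤ.+-identityʳ bF)))

theorem4p6 :
  ∀ {c ℓ₁ ℓ₂ a ℓ b ℓ′} (R : RealNumbers c ℓ₁ ℓ₂) →
  let module ℝ = RealNumbers R
      open Complex R
  in
  (p n m : ℕ) (p-prime : Prime p) →
  (ζ : ℂ) → IsNontrivialRootOfUnity p ζ →
  (√pⁿ : ℝ.Carrier) → ℝ.IsSqrt √pⁿ (ℝ.fromℕ (p ℕ.^ n)) →
  (K : FiniteField (p ℕ.^ n) a ℓ) (L : FiniteField (p ℕ.^ m) b ℓ′) →
  let module K = FiniteField K
      module L = FiniteField L
  in
  (F : Func K.setoid L.setoid) →
  let open Walsh R p-prime ζ n m K L F in
  Bent √pⁿ →
  (ε : ℂ) → (ε ≈ 1# ⊎ ε ≈ - 1#) ⊎ (ε ≈ 𝑖 ⊎ ε ≈ - 𝑖) →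
  (∀ y → ¬ (y L.≈ L.0#) → ∃[ r ] W y K.0# ≈ ε * fromℝ √pⁿ * (ζ^ r)) →
  (2 ∣ n) × (m ℕ.≤ n / 2) ×
  (ε ≈ 1# ⊎ ε ≈ 𝑖 →
    Σ[ k ∈ (L.Carrier → ℕ) ]
      (∀ y →
        (k y ℕ.≤ geometric p-prime m) ×
        (+ ∣F⁻¹ y ∣ ≡ + (p ℕ.^ (n ∸ m)) ℤ.+ + (p ℕ.^ (n / 2))
                      ℤ.- + (p ℕ.^ (n / 2 ∸ m)) ℤ.* + (p ℕ.* k y ℕ.+ 1)) ×
        (+ (p ℕ.^ (n ∸ m)) ℤ.- + (geometric p-prime m ℕ.* p ℕ.^ (n / 2 ∸ m)) ℤ.≤ + ∣F⁻¹ y ∣)) ×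
      L.HasCardinality
        (λ y → ¬ (y L.≈ L.0#) × W y K.0# ≈ fromℝ √pⁿ * ε * ζ) (k L.0#)) ×
  (ε ≈ - 1# ⊎ ε ≈ - 𝑖 →
    Σ[ k ∈ (L.Carrier → ℕ) ]
      (∀ y →
        (k y ℕ.≤ geometric p-prime m) ×
        (+ ∣F⁻¹ y ∣ ≡ + (p ℕ.^ (n ∸ m)) ℤ.- + (p ℕ.^ (n / 2))
                      ℤ.+ + (p ℕ.^ (n / 2 ∸ m)) ℤ.* + (p ℕ.* k y ℕ.+ 1)) ×
        (+ ∣F⁻¹ y ∣ ℤ.≤ + (p ℕ.^ (n ∸ m)) ℤ.+ + (geometric p-prime m ℕ.* p ℕ.^ (n / 2 ∸ m)))) ×
      L.HasCardinality
        (λ y → ¬ (y L.≈ L.0#) × W y K.0# ≈ fromℝ √pⁿ * ε * ζ) (k L.0#))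
theorem4p6 R p n m p-prime ζ ζ-root √pⁿ √pⁿ-root K L F _ =
  ConstantPhase.SquareRoots.conclusions p-prime (ComplexLemmas.rootOfUnity R ζ ζ-root) n m K L F
    (Complex.fromℝ R √pⁿ) (Complex.𝑖 R)
    (ComplexLemmas.IsSqrt⇒square R (p ℕ.^ n) √pⁿ-root)
    (ComplexLemmas.𝑖²≈-1 R)
    (ComplexLemmas.nonNeg≉neg R (proj₁ √pⁿ-root))
    (λ y → Walsh.W R p-prime ζ n m K L F y (FiniteField.0# K))
    (ComplexWalsh.W≈V R p-prime ζ ζ-root n m K L F)
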